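{- For each $m\ge2$ and $k\in\{0,1,\dots,m-1\}$, let $$q_k(m):=\lim_{n\to\infty}\frac{[x^n]H_k(x)}{[x^n]G(x)}=\lim_{n\to\infty}\frac{\#\{\text{outputs }\ge v_k\}}{\#\{\text{all outputs}\}},$$ so that $q_{m-1}(m)=p_{m-1}(m)$ (the limiting proportion of outputs equal to the top value $1=v_{m-1}$) and $p_k(m)=q_k(m)-q_{k+1}(m)$ for $0\le k\le m-2$. Fix $t\in[0,1]$ and set $k=\lfloor t(m-1)\rfloor$. Then, as $m\to\infty$, $$q_{\lfloor t(m-1)\rfloor}(m)\longrightarrow\frac{1}{\sqrt{1+2t}}.$$ Consequently, for any fixed level index $j$ (independent of $m$) one has $p_j(m)\to0$ as $m\to\infty$; to obtain a nonzero limit one must place the cut at a macroscopic rank $k\asymp m$ (equivalently, $j/(m-1)\to t$).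
   Context: For an integer $m\ge2$ let $V_m=\{v_0<v_1<\cdots<v_{m-1}\}$ ($v_0=0$, $v_{m-1}=1$) be an $m$-element chain with Gödel implication $v_p\Rightarrow_G v_q=v_{m-1}$ if $p\le q$ and $v_p\Rightarrow_G v_q=v_q$ if $p>q$. For $n\ge1$, consider the $C_{n-1}$ full bracketings of $p_1\Rightarrow_G\cdots\Rightarrow_G p_n$ in $n$ distinct variables (full binary trees with $n$ ordered leaves), $C_k$ being the Catalan numbers. An "output" is the value in $V_m$ of a bracketed formula under a valuation $\{p_1,\dots,p_n\}\to V_m$; outputs are counted over all pairs (bracketing, valuation) for the given $n$. Let $g_n^{(j)}$ be the number of outputs equal to $v_j$ (it depends on $m$), and $g_n=\sum_{j=0}^{m-1}g_n^{(j)}=m^nC_{n-1}$ the number of all outputs. Put $G_j(x)=\sum_{n\ge1}g_n^{(j)}x^n$, $G(x)=\sum_{j=0}^{m-1}G_j(x)=\sum_{n\ge1}g_nx^n$, and let $H_k(x)=\sum_{j=k}^{m-1}G_j(x)$ be the tail sums, so that $[x^n]H_k(x)$ is the number of outputs $\ge v_k$. Finally $p_j(m):=\lim_{n\to\infty}g_n^{(j)}/g_n$ is the limiting proportion of outputs equal to $v_j$. A "cut" at rank $k$ refers to the threshold $v_k$ used in $q_k(m)$. -}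

module Defs where

open import Data.Bool.Base using (if_then_else_)
open import Data.Fin.Base as Fin using (Fin; toℕ)
import Data.Fin.Properties as Fin
open import Data.Integer.Base using (+_)
open import Data.List.Base
  using (List; []; _∷_; [_]; length; map; filter; upTo; allFin; concatMap; cartesianProductWith)
open import Data.List.Membership.Propositional using (_∈_; lose; find)
open import Data.List.Membership.Propositional.Properties
  using (∈-concatMap⁺; ∈-concatMap⁻; ∈-cartesianProductWith⁺; ∈-cartesianProductWith⁻;
         ∈-upTo⁺; ∈-upTo⁻; ∈-allFin)
open import Data.List.Relation.Unary.All as All using ([])
import Data.List.Relation.Unary.All.Properties as All
open import Data.List.Relation.Unary.AllPairs as AllPairs using ([]; _∷_)
import Data.List.Relation.Unary.AllPairs.Properties as AllPairs
open import Data.List.Relation.Unary.Any using (here)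
open import Data.List.Relation.Unary.Unique.Propositional using (Unique)
open import Data.List.Relation.Unary.Unique.Propositional.Properties
  using (concat⁺; cartesianProductWith⁺; upTo⁺; allFin⁺)
open import Data.Nat.Base as ℕ using (ℕ; zero; suc; _∸_; z≤n; s≤s)
open import Data.Nat.ListAction using (sum)
import Data.Nat.Properties as ℕ
open import Data.Product.Base using (∃-syntax; _×_; _,_)
open import Data.Rational.Base as ℚ using (ℚ; 0ℚ; 1ℚ; ½; _/_)
import Data.Rational.Properties as ℚ
open import Data.Rational.Solver using (module +-*-Solver)
open import Data.Sum.Base using (_⊎_; inj₁; inj₂)
open import Data.Vec.Base using (Vec; []; _∷_; take; drop)
open import Relation.Binary.PropositionalEquality
  using (_≡_; refl; sym; trans; cong; cong₂; subst; module ≡-Reasoning)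
open import Relation.Nullary.Decidable.Core using (⌊_⌋)

Eventually : (ℕ → Set) → Set
Eventually P = ∃[ N ] ∀ n → N ℕ.≤ n → P n

IsCauchy : (ℕ → ℚ) → Set
IsCauchy a = ∀ ε → 0ℚ ℚ.< ε →
  ∃[ N ] ∀ i j → N ℕ.≤ i → N ℕ.≤ j → ℚ.∣ a i ℚ.- a j ∣ ℚ.< ε

-- Equality of reals is _≃ᴿ_ below.
record ℝ : Set where
  constructor mkℝ
  field
    seq    : ℕ → ℚ
    cauchy : IsCauchy seq

open ℝ public

private
  ≡-≤ : ∀ {p q r} → p ≡ q → q ℚ.≤ r → p ℚ.≤ r
  ≡-≤ refl q≤r = q≤r

  ≤-≡ : ∀ {p q r} → p ℚ.≤ q → q ≡ r → p ℚ.≤ r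
  ≤-≡ p≤q refl = p≤q

  half : ∀ ε → 0ℚ ℚ.< ε → 0ℚ ℚ.< ½ ℚ.* ε
  half ε 0<ε = subst (ℚ._< ½ ℚ.* ε) (ℚ.*-zeroʳ ½) (ℚ.*-monoʳ-<-pos ½ 0<ε)

  halves : ∀ ε → ½ ℚ.* ε ℚ.+ ½ ℚ.* ε ≡ ε
  halves ε = trans (sym (ℚ.*-distribʳ-+ ε ½ ½)) (ℚ.*-identityˡ ε)

  ∣-∣-sub : ∀ p q → ℚ.∣ p ∣ ℚ.≤ ℚ.∣ q ∣ ℚ.+ ℚ.∣ p ℚ.- q ∣
  ∣-∣-sub p q = ≡-≤ (cong ℚ.∣_∣ (sym eq)) (ℚ.∣p+q∣≤∣p∣+∣q∣ q (p ℚ.- q))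
    where
    open +-*-Solver
    eq : q ℚ.+ (p ℚ.- q) ≡ p
    eq = solve 2 (λ p q → q :+ (p :- q) := p) refl p q

  ∣∣-∣∣-lipschitz : ∀ p q → ℚ.∣ ℚ.∣ p ∣ ℚ.- ℚ.∣ q ∣ ∣ ℚ.≤ ℚ.∣ p ℚ.- q ∣
  ∣∣-∣∣-lipschitz p q with ℚ.∣p∣≡p∨∣p∣≡-p (ℚ.∣ p ∣ ℚ.- ℚ.∣ q ∣)
  ... | inj₁ eq = ≡-≤ eq (≤-≡ (ℚ.+-monoˡ-≤ (ℚ.- ℚ.∣ q ∣) (∣-∣-sub p q)) (cancel ℚ.∣ q ∣ _))
    where
    open +-*-Solver
    cancel : ∀ a b → a ℚ.+ b ℚ.- a ≡ b
    cancel = solve 2 (λ a b → (a :+ b) :- a := b) refl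
  ... | inj₂ eq = ≡-≤ (trans eq (flip ℚ.∣ p ∣ ℚ.∣ q ∣))
        (≤-≡ (ℚ.+-monoˡ-≤ (ℚ.- ℚ.∣ p ∣) (∣-∣-sub q p)) (trans (cancel ℚ.∣ p ∣ _) ∣q-p∣≡∣p-q∣))
    where
    open +-*-Solver
    cancel : ∀ a b → a ℚ.+ b ℚ.- a ≡ b
    cancel = solve 2 (λ a b → (a :+ b) :- a := b) refl
    flip : ∀ a b → ℚ.- (a ℚ.- b) ≡ b ℚ.- a
    flip = solve 2 (λ a b → :- (a :- b) := b :- a) refl
    ∣q-p∣≡∣p-q∣ : ℚ.∣ q ℚ.- p ∣ ≡ ℚ.∣ p ℚ.- q ∣
    ∣q-p∣≡∣p-q∣ = trans (cong ℚ.∣_∣ (sym (flip p q))) (ℚ.∣-p∣≡∣p∣ (p ℚ.- q))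

fromℚ : ℚ → ℝ
fromℚ r = mkℝ (λ _ → r) λ ε 0<ε → 0 , λ _ _ _ _ →
  subst (λ d → ℚ.∣ d ∣ ℚ.< ε) (sym (ℚ.+-inverseʳ r)) 0<ε

fromℕ : ℕ → ℝ
fromℕ n = fromℚ (+ n / 1)

0ᴿ 1ᴿ : ℝ
0ᴿ = fromℕ 0
1ᴿ = fromℕ 1

infixl 6 _+ᴿ_ _-ᴿ_
infixl 7 _*ᴿ_
infix  8 -ᴿ_
infix  4 _<ᴿ_ _≤ᴿ_ _≃ᴿ_ _#ᴿ_ _⟶_ _≍_ _IsSqrtOf_ _IsReciprocalOf_ _IsFloorOf_

_+ᴿ_ : ℝ → ℝ → ℝ
x +ᴿ y = mkℝ (λ n → seq x n ℚ.+ seq y n) λ ε 0<ε →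
  let (M , x-close) = cauchy x (½ ℚ.* ε) (half ε 0<ε)
      (N , y-close) = cauchy y (½ ℚ.* ε) (half ε 0<ε)
  in M ℕ.⊔ N , λ i j M⊔N≤i M⊔N≤j → ℚ.≤-<-trans
    (≡-≤ (cong ℚ.∣_∣ (sym (regroup (seq x i) (seq x j) (seq y i) (seq y j))))
           (ℚ.∣p+q∣≤∣p∣+∣q∣ (seq x i ℚ.- seq x j) (seq y i ℚ.- seq y j)))
    (subst (ℚ._<_ _) (halves ε) (ℚ.+-mono-<
      (x-close i j (ℕ.m⊔n≤o⇒m≤o M N M⊔N≤i) (ℕ.m⊔n≤o⇒m≤o M N M⊔N≤j))
      (y-close i j (ℕ.m⊔n≤o⇒n≤o M N M⊔N≤i) (ℕ.m⊔n≤o⇒n≤o M N M⊔N≤j))))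
  where
  open +-*-Solver
  regroup : ∀ a b c d → (a ℚ.- b) ℚ.+ (c ℚ.- d) ≡ (a ℚ.+ c) ℚ.- (b ℚ.+ d)
  regroup = solve 4 (λ a b c d → (a :- b) :+ (c :- d) := (a :+ c) :- (b :+ d)) refl

-ᴿ_ : ℝ → ℝ
-ᴿ x = mkℝ (λ n → ℚ.- seq x n) λ ε 0<ε →
  let (N , x-close) = cauchy x ε 0<ε
  in N , λ i j N≤i N≤j → subst (ℚ._< ε)
       (trans (sym (ℚ.∣-p∣≡∣p∣ (seq x i ℚ.- seq x j)))
              (cong ℚ.∣_∣ (ℚ.neg-distrib-+ (seq x i) (ℚ.- seq x j))))
       (x-close i j N≤i N≤j)

_-ᴿ_ : ℝ → ℝ → ℝ
x -ᴿ y = x +ᴿ -ᴿ y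

∣_∣ᴿ : ℝ → ℝ
∣ x ∣ᴿ = mkℝ (λ n → ℚ.∣ seq x n ∣) λ ε 0<ε →
  let (N , x-close) = cauchy x ε 0<ε
  in N , λ i j N≤i N≤j →
    ℚ.≤-<-trans (∣∣-∣∣-lipschitz (seq x i) (seq x j)) (x-close i j N≤i N≤j)

private
  bounded : ∀ x → ∃[ B ] (0ℚ ℚ.< B) × Eventually (λ n → ℚ.∣ seq x n ∣ ℚ.≤ B)
  bounded x =
    let (N , x-close) = cauchy x 1ℚ (ℚ.positive⁻¹ 1ℚ)
        c = ℚ.∣ seq x N ∣
    in c ℚ.+ 1ℚ
     , ℚ.+-mono-≤-< (ℚ.0≤∣p∣ (seq x N)) (ℚ.positive⁻¹ 1ℚ)
     , N , λ n N≤n → ℚ.≤-trans (∣-∣-sub (seq x n) (seq x N))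
             (ℚ.+-monoʳ-≤ c (ℚ.<⇒≤ (x-close n N N≤n ℕ.≤-refl)))

  *-bound : ∀ {p d B δ} → 0ℚ ℚ.< B → ℚ.∣ p ∣ ℚ.≤ B → ℚ.∣ d ∣ ℚ.< δ →
            ℚ.∣ p ℚ.* d ∣ ℚ.< B ℚ.* δ
  *-bound {p} {d} {B} 0<B ∣p∣≤B ∣d∣<δ =
    subst (ℚ._< _) (sym (ℚ.∣p*q∣≡∣p∣*∣q∣ p d)) (ℚ.≤-<-trans
      (ℚ.*-monoʳ-≤-nonNeg ℚ.∣ d ∣ {{ℚ.∣-∣-nonNeg d}} ∣p∣≤B)
      (ℚ.*-monoʳ-<-pos B {{ℚ.positive 0<B}} ∣d∣<δ))

_*ᴿ_ : ℝ → ℝ → ℝ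
x *ᴿ y = mkℝ (λ n → seq x n ℚ.* seq y n) λ ε 0<ε →
  let (B , 0<B , K , x-bound) = bounded x
      (C , 0<C , L , y-bound) = bounded y
      instance
        B+C-positive : ℚ.Positive (B ℚ.+ C)
        B+C-positive = ℚ.positive (ℚ.+-mono-< 0<B 0<C)
        B+C-nonZero : ℚ.NonZero (B ℚ.+ C)
        B+C-nonZero = ℚ.pos⇒nonZero (B ℚ.+ C)
      δ = ℚ.1/ (B ℚ.+ C) ℚ.* ε
      0<δ = subst (ℚ._< δ) (ℚ.*-zeroʳ (ℚ.1/ (B ℚ.+ C)))
              (ℚ.*-monoʳ-<-pos (ℚ.1/ (B ℚ.+ C)) {{ℚ.1/pos⇒pos (B ℚ.+ C)}} 0<ε)
      Bδ+Cδ≡ε : B ℚ.* δ ℚ.+ C ℚ.* δ ≡ ε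
      Bδ+Cδ≡ε = begin
        B ℚ.* δ ℚ.+ C ℚ.* δ                        ≡⟨ ℚ.*-distribʳ-+ δ B C ⟨
        (B ℚ.+ C) ℚ.* (ℚ.1/ (B ℚ.+ C) ℚ.* ε)       ≡⟨ ℚ.*-assoc (B ℚ.+ C) _ ε ⟨
        (B ℚ.+ C) ℚ.* ℚ.1/ (B ℚ.+ C) ℚ.* ε         ≡⟨ cong (ℚ._* ε) (ℚ.*-inverseʳ (B ℚ.+ C)) ⟩
        1ℚ ℚ.* ε                                   ≡⟨ ℚ.*-identityˡ ε ⟩
        ε                                          ∎
      (M , x-close) = cauchy x δ 0<δ
      (N , y-close) = cauchy y δ 0<δ
  in (K ℕ.⊔ L) ℕ.⊔ (M ℕ.⊔ N) , λ i j big-i big-j →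
    let KL≤i = ℕ.m⊔n≤o⇒m≤o (K ℕ.⊔ L) (M ℕ.⊔ N) big-i
        MN≤i = ℕ.m⊔n≤o⇒n≤o (K ℕ.⊔ L) (M ℕ.⊔ N) big-i
        KL≤j = ℕ.m⊔n≤o⇒m≤o (K ℕ.⊔ L) (M ℕ.⊔ N) big-j
        MN≤j = ℕ.m⊔n≤o⇒n≤o (K ℕ.⊔ L) (M ℕ.⊔ N) big-j
    in ℚ.≤-<-trans
      (≡-≤ (cong ℚ.∣_∣ (sym (regroup (seq x i) (seq x j) (seq y i) (seq y j))))
        (ℚ.∣p+q∣≤∣p∣+∣q∣ (seq x i ℚ.* (seq y i ℚ.- seq y j))
                         (seq y j ℚ.* (seq x i ℚ.- seq x j))))
      (subst (_ ℚ.<_) Bδ+Cδ≡ε (ℚ.+-mono-<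
        (*-bound 0<B (x-bound i (ℕ.m⊔n≤o⇒m≤o K L KL≤i))
          (y-close i j (ℕ.m⊔n≤o⇒n≤o M N MN≤i) (ℕ.m⊔n≤o⇒n≤o M N MN≤j)))
        (*-bound 0<C (y-bound j (ℕ.m⊔n≤o⇒n≤o K L KL≤j))
          (x-close i j (ℕ.m⊔n≤o⇒m≤o M N MN≤i) (ℕ.m⊔n≤o⇒m≤o M N MN≤j)))))
  where
  open ≡-Reasoning
  regroup : ∀ a b c d → a ℚ.* (c ℚ.- d) ℚ.+ d ℚ.* (a ℚ.- b) ≡ a ℚ.* c ℚ.- b ℚ.* d
  regroup = solve 4 (λ a b c d → a :* (c :- d) :+ d :* (a :- b) := a :* c :- b :* d) refl
    where open +-*-Solver

_<ᴿ_ _≤ᴿ_ _≃ᴿ_ _#ᴿ_ : ℝ → ℝ → Set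
x <ᴿ y = ∃[ ε ] (0ℚ ℚ.< ε) × Eventually (λ n → seq x n ℚ.+ ε ℚ.≤ seq y n)
x ≤ᴿ y = ∀ ε → 0ℚ ℚ.< ε → Eventually (λ n → seq x n ℚ.≤ seq y n ℚ.+ ε)
x ≃ᴿ y = x ≤ᴿ y × y ≤ᴿ x
x #ᴿ y = x <ᴿ y ⊎ y <ᴿ x

_⟶_ : (ℕ → ℝ) → ℝ → Set
xs ⟶ L = ∀ ε → 0ℚ ℚ.< ε → Eventually (λ n → ∣ xs n -ᴿ L ∣ᴿ <ᴿ fromℚ ε)

_IsSqrtOf_ : ℝ → ℝ → Set
r IsSqrtOf x = 0ᴿ ≤ᴿ r × r *ᴿ r ≃ᴿ x

_IsReciprocalOf_ : ℝ → ℝ → Set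
s IsReciprocalOf r = s *ᴿ r ≃ᴿ 1ᴿ

-- The floor of a Cauchy real is not computable, so it is given as a relation.
_IsFloorOf_ : ℕ → ℝ → Set
k IsFloorOf x = fromℕ k ≤ᴿ x × x <ᴿ fromℕ (suc k)

-- The junk value at denominator 0 only occurs at finitely many indices of
-- the sequences whose limits are considered.
infix 7 _÷_
_÷_ : ℕ → ℕ → ℝ
a ÷ zero    = 0ᴿ
a ÷ (suc b) = fromℚ (+ a / suc b)

_≍_ : (ℕ → ℕ) → (ℕ → ℕ) → Set
f ≍ h = ∃[ C ] Eventually (λ m → (f m ℕ.≤ C ℕ.* h m) × (h m ℕ.≤ C ℕ.* f m))

-- The chain v₀ < ⋯ < v_{m-1} is Fin m; only its order matters.
infixr 5 _⇒G_
_⇒G_ : ∀ {m} → Fin m → Fin m → Fin m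
_⇒G_ {suc m} p q = if ⌊ p Fin.≤? q ⌋ then Fin.fromℕ m else q

-- The variables p₁, …, pₙ are distinct and in order, so the leaves carry no names.
infix 5 _⇒_
data Bracketing : Set where
  var : Bracketing
  _⇒_ : Bracketing → Bracketing → Bracketing

leaves : Bracketing → ℕ
leaves var     = 1
leaves (s ⇒ t) = leaves s ℕ.+ leaves t

Valuation : ℕ → ℕ → Set
Valuation m n = Vec (Fin m) n

value : ∀ {m} (t : Bracketing) → Valuation m (leaves t) → Fin m
value var     (v ∷ []) = v
value (s ⇒ t) ρ        = value s (take (leaves s) ρ) ⇒G value t (drop (leaves s) ρ)

bracketingsWithin : (fuel n : ℕ) → List Bracketing
bracketingsWithin zero       n             = []
bracketingsWithin (suc fuel) zero          = []
bracketingsWithin (suc fuel) (suc zero)    = [ var ]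
bracketingsWithin (suc fuel) (suc (suc k)) = concatMap
  (λ i → cartesianProductWith _⇒_ (bracketingsWithin fuel (suc i))
                                  (bracketingsWithin fuel (suc (k ∸ i))))
  (upTo (suc k))

-- All bracketings with n leaves, each listed once: see bracketings-sound,
-- bracketings-complete and bracketings-unique.
bracketings : ℕ → List Bracketing
bracketings n = bracketingsWithin n n

valuations : ∀ m n → List (Valuation m n)
valuations m zero    = [ [] ]
valuations m (suc n) = cartesianProductWith _∷_ (allFin m) (valuations m n)

outputs : ∀ m n → List (Fin m)
outputs m n = concatMap (λ t → map (value t) (valuations m (leaves t))) (bracketings n)

-- A generating function is its coefficient sequence: G⟨ j ⟩ m n is [xⁿ] G_j(x).
G⟨_⟩ : ∀ (j m n : ℕ) → ℕ
G⟨ j ⟩ m n = length (filter (λ v → toℕ v ℕ.≟ j) (outputs m n))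

G : ∀ (m n : ℕ) → ℕ
G m n = sum (map (λ j → G⟨ j ⟩ m n) (upTo m))

H⟨_⟩ : ∀ (k m n : ℕ) → ℕ
H⟨ k ⟩ m n = sum (map (λ i → G⟨ k ℕ.+ i ⟩ m n) (upTo (m ∸ k)))

#outputs : ∀ (m n : ℕ) → ℕ
#outputs m n = length (outputs m n)

#outputs≥ : ∀ (k m n : ℕ) → ℕ
#outputs≥ k m n = length (filter (λ v → k ℕ.≤? toℕ v) (outputs m n))

within-sound : ∀ fuel n {t} → t ∈ bracketingsWithin fuel n → leaves t ≡ n
within-sound (suc fuel) (suc zero) (here refl) = refl
within-sound (suc fuel) (suc (suc k)) t∈
  with i , i∈ , t∈ᵢ ← find (∈-concatMap⁻ _ {xs = upTo (suc k)} t∈)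
  with s , u , s∈ , u∈ , refl ← ∈-cartesianProductWith⁻ _⇒_ (bracketingsWithin fuel (suc i)) _ t∈ᵢ
  = trans (cong₂ ℕ._+_ (within-sound fuel _ s∈) (within-sound fuel _ u∈))
          (cong suc (trans (ℕ.+-suc i (k ∸ i))
                           (cong suc (ℕ.m+[n∸m]≡n (ℕ.s≤s⁻¹ (∈-upTo⁻ i∈))))))

leaves-positive : ∀ t → ∃[ k ] leaves t ≡ suc k
leaves-positive var     = 0 , refl
leaves-positive (s ⇒ t) with leaves s | leaves-positive s
... | _ | k , refl = k ℕ.+ leaves t , refl

within-complete : ∀ fuel t → leaves t ℕ.≤ fuel → t ∈ bracketingsWithin fuel (leaves t)
within-complete (suc fuel) var     le = here refl
within-complete zero       (s ⇒ t) le with leaves s | leaves-positive s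
within-complete zero       (s ⇒ t) () | _ | _ , refl
within-complete (suc fuel) (s ⇒ t) le
  with leaves s | leaves-positive s | leaves t | leaves-positive t
     | within-complete fuel s | within-complete fuel t
... | _ | a , refl | _ | b , refl | s∈ | t∈
  rewrite ℕ.+-suc a b
  = ∈-concatMap⁺ _ (lose (∈-upTo⁺ (s≤s (ℕ.m≤m+n a b)))
      (∈-cartesianProductWith⁺ _⇒_
        (s∈ (ℕ.≤-trans (s≤s (ℕ.m≤m+n a b)) (ℕ.s≤s⁻¹ le)))
        (subst (λ c → t ∈ bracketingsWithin fuel (suc c)) (sym (ℕ.m+n∸m≡n a b))
          (t∈ (ℕ.≤-trans (s≤s (ℕ.m≤n+m b a)) (ℕ.s≤s⁻¹ le))))))

within-unique : ∀ fuel n → Unique (bracketingsWithin fuel n)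
within-unique zero       n             = []
within-unique (suc fuel) zero          = []
within-unique (suc fuel) (suc zero)    = [] ∷ []
within-unique (suc fuel) (suc (suc k)) = concat⁺
  (All.map⁺ (All.universal
    (λ i → cartesianProductWith⁺ _⇒_ (λ { refl → refl , refl })
             (within-unique fuel (suc i)) (within-unique fuel (suc (k ∸ i))))
    (upTo (suc k))))
  (AllPairs.map⁺ (AllPairs.map
    (λ {i} {j} i≢j {t} → λ (t∈ᵢ , t∈ⱼ) → i≢j (ℕ.suc-injective (left≡ i j t∈ᵢ t∈ⱼ)))
    (upTo⁺ (suc k))))
  where
  left≡ : ∀ i j {t} →
    t ∈ cartesianProductWith _⇒_ (bracketingsWithin fuel (suc i)) (bracketingsWithin fuel (suc (k ∸ i))) →
    t ∈ cartesianProductWith _⇒_ (bracketingsWithin fuel (suc j)) (bracketingsWithin fuel (suc (k ∸ j))) →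
    suc i ≡ suc j
  left≡ i j t∈ᵢ t∈ⱼ
    with _ , _ , s∈ , _ , refl ← ∈-cartesianProductWith⁻ _⇒_ (bracketingsWithin fuel (suc i)) _ t∈ᵢ
    with _ , _ , s∈′ , _ , refl ← ∈-cartesianProductWith⁻ _⇒_ (bracketingsWithin fuel (suc j)) _ t∈ⱼ
    = trans (sym (within-sound fuel _ s∈)) (within-sound fuel _ s∈′)

bracketings-sound : ∀ {n t} → t ∈ bracketings n → leaves t ≡ n
bracketings-sound {n} = within-sound n n

bracketings-complete : ∀ t → t ∈ bracketings (leaves t)
bracketings-complete t = within-complete (leaves t) t ℕ.≤-refl

bracketings-unique : ∀ n → Unique (bracketings n)
bracketings-unique n = within-unique n n

valuations-complete : ∀ {m n} (ρ : Valuation m n) → ρ ∈ valuations m n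
valuations-complete []      = here refl
valuations-complete (v ∷ ρ) = ∈-cartesianProductWith⁺ _∷_ (∈-allFin v) (valuations-complete ρ)

valuations-unique : ∀ m n → Unique (valuations m n)
valuations-unique m zero    = [] ∷ []
valuations-unique m (suc n) =
  cartesianProductWith⁺ _∷_ (λ { refl → refl , refl }) (allFin⁺ m) (valuations-unique m n)

-- For s ⇒ t the output is v_j with j < m-1 exactly when t gives v_j and s gives more than v_j. With
-- x the variable, this reads G_j = x + G_j H_{j+1}, and G = m x + G² for all outputs. At the
-- singularity x = 1/(4m) put u_k = 1 - H_k. Then u_0 = ½, (u_{k+1} - u_k) u_{k+1} = x, and
-- q_{k+1} (2 u_{k+1} - u_k) = q_k u_{k+1}. From these u_{k+1}² - u_k² = 2x + O(x²), so 4 u_k² is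
-- 1 + 2k/m + O(1/m), and q_{k+1} u_{k+1} - q_k u_k = O(x²), so 2 q_k u_k = 1 + O(1/m). Together
-- q_k² (1 + 2k/m) = 1 + O(1/m).
--
-- The limits q_k exist by an elementary argument instead of singularity analysis. Scale the n-th
-- coefficients by (4m)^-n, so that G becomes the sequence e of scaled Catalan numbers; indexed from 0,
-- it satisfies e(n+1) = Σ e(i) e(n-i), decreases and has sum ½. For sequences f and g between 0 and e,
-- Σ f(i) g(n-i) divided by e(n+1) is within twice a tail of Σ e of a finite combination of earlier
-- ratios f/e and g/e. Applied to G_k = x + G_k H_{k+1} with H_{k+1} = H_k - G_k, it
-- expresses each late ratio of G_k by earlier ones with weights of total at most ½, hence the
-- oscillation of these ratios contracts.

module Submission where

open import Defs

-- For a given m all estimates take place between rationals at one finite n: u_k is replaced by its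
-- partial sum up to n, and q_k by the proportion at n. The two recurrences then hold up to x² once
-- n passes a threshold common to the finitely many ranks. As there are fewer than m = 1/(4x) steps,
-- the accumulated error is O(x), uniformly in the rank. Reals enter only as Cauchy sequences of
-- proportions and in the final comparison. A relation s² a ≈ 1 determines each of s and a from the
-- other with a Lipschitz bound. One direction carries k/m to q_k and yields the limit 1/√(1+2t),
-- whose approximants come from a search on ever finer grids. The other direction recovers k/m from
-- q_k and yields the converse, that a cut with a nonzero limit sits at a macroscopic rank. For
-- single levels, one step of the recursion lowers q by at most 10x. So every level below the top
-- vanishes in the limit, and a sequence of levels with a nonzero limit must be eventually the top
-- one, of rank m - 1.

module Asymptotics where

  open import Data.Bool.Base using (true; false; if_then_else_)
  open import Data.Empty using (⊥; ⊥-elim)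
  open import Data.Fin.Base as Fin using (Fin; toℕ)
  import Data.Fin.Properties as Fin
  open import Data.Integer.Base as ℤ using (+_)
  import Data.Integer.Properties as ℤ
  open import Data.List.Base
    using (List; []; _∷_; _++_; length; map; filter; upTo; applyUpTo; allFin; tabulate; concatMap; cartesianProductWith)
  open import Data.Nat.Base as ℕ using (ℕ; zero; suc; _∸_; z≤n; s≤s)
  open import Data.Nat.ListAction using (sum)
  import Data.Nat.Properties as ℕ
  open import Data.Product.Base using (∃-syntax; _×_; _,_; proj₁; proj₂)
  open import Data.Rational.Base hiding (_÷_)
  open import Data.Rational.Properties
  import Data.Rational.Unnormalised.Base as ℚᵘ
  import Data.Rational.Unnormalised.Properties as ℚᵘ
  open import Data.Sum.Base using (_⊎_; inj₁; inj₂; [_,_]′)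
  open import Data.Vec.Base as Vec using (take; drop)
  open import Function.Base using (_∘_; id)
  open import Level using (0ℓ)
  open import Relation.Binary.Definitions using (tri<; tri≈; tri>)
  open import Relation.Binary.PropositionalEquality
    using (_≡_; refl; sym; trans; cong; cong₂; subst; subst₂; module ≡-Reasoning)
  open import Relation.Nullary.Decidable using (dec⇒maybe)
  open import Relation.Nullary.Decidable.Core using (Dec; yes; no; does)
  open import Relation.Nullary.Negation using (¬_)
  open import Tactic.RingSolver using (solve)
  open import Tactic.RingSolver.Core.AlmostCommutativeRing using (AlmostCommutativeRing; fromCommutativeRing)

  -- Rational arithmetic

  ℚ-ring : AlmostCommutativeRing 0ℓ 0ℓ
  ℚ-ring = fromCommutativeRing +-*-commutativeRing (λ p → dec⇒maybe (0ℚ ≟ p))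

  infixl 6 _⊕_
  infixl 7 _⊗_

  _⊕_ : ∀ {a b} → 0ℚ ≤ a → 0ℚ ≤ b → 0ℚ ≤ a + b
  _⊕_ = +-mono-≤

  _⊗_ : ∀ {a b} → 0ℚ ≤ a → 0ℚ ≤ b → 0ℚ ≤ a * b
  _⊗_ {a} {b} 0≤a 0≤b =
    subst (_≤ a * b) (*-zeroˡ b) (*-monoʳ-≤-nonNeg b {{nonNegative 0≤b}} 0≤a)

  gap : ∀ {a b} → a ≤ b → 0ℚ ≤ b - a
  gap {a} {b} a≤b = subst (_≤ b - a) (+-inverseʳ a) (+-monoˡ-≤ (- a) a≤b)

  -- An inequality a ≤ b is certified by writing b - a as a nonnegative expression e.
  ≤-by : ∀ {a b e} → 0ℚ ≤ e → b - a ≡ e → a ≤ b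
  ≤-by {a} {b} {e} 0≤e eq = subst₂ _≤_ (+-identityˡ a) e+a≡b (+-monoˡ-≤ a 0≤e)
    where
    cancel : ∀ a b → b - a + a ≡ b
    cancel a b = solve (a ∷ b ∷ []) ℚ-ring
    e+a≡b : e + a ≡ b
    e+a≡b = trans (cong (_+ a) (sym eq)) (cancel a b)

  square-nonneg : ∀ a → 0ℚ ≤ a * a
  square-nonneg a with ≤-total 0ℚ a
  ... | inj₁ 0≤a = 0≤a ⊗ 0≤a
  ... | inj₂ a≤0 = subst (0ℚ ≤_) (eq a) (gap a≤0 ⊗ gap a≤0)
    where
    eq : ∀ a → (0ℚ - a) * (0ℚ - a) ≡ a * a
    eq a = solve (a ∷ []) ℚ-ring

  ⟦_⟧ : ℕ → ℚ
  ⟦ n ⟧ = + n / 1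

  0≤⟦_⟧ : ∀ n → 0ℚ ≤ ⟦ n ⟧
  0≤⟦ n ⟧ = nonNegative⁻¹ ⟦ n ⟧ {{normalize-nonNeg n 1}}

  0<⟦suc_⟧ : ∀ n → 0ℚ < ⟦ suc n ⟧
  0<⟦suc n ⟧ = positive⁻¹ ⟦ suc n ⟧ {{normalize-pos (suc n) 1}}

  -- fromℚᵘ (mkℚᵘ i d) is by definition i / suc d.
  ⟦⟧-+ : ∀ m n → ⟦ m ℕ.+ n ⟧ ≡ ⟦ m ⟧ + ⟦ n ⟧
  ⟦⟧-+ m n = toℚᵘ-injective (begin
    toℚᵘ ⟦ m ℕ.+ n ⟧                   ≈⟨ toℚᵘ-fromℚᵘ (ℚᵘ.mkℚᵘ (+ (m ℕ.+ n)) 0) ⟩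
    ℚᵘ.mkℚᵘ (+ (m ℕ.+ n)) 0            ≈⟨ ℚᵘ.*≡* (cong (ℤ._* + 1) eq) ⟩
    ℚᵘ.mkℚᵘ (+ m) 0 ℚᵘ.+ ℚᵘ.mkℚᵘ (+ n) 0
      ≈⟨ ℚᵘ.+-cong (toℚᵘ-fromℚᵘ (ℚᵘ.mkℚᵘ (+ m) 0)) (toℚᵘ-fromℚᵘ (ℚᵘ.mkℚᵘ (+ n) 0)) ⟨
    toℚᵘ ⟦ m ⟧ ℚᵘ.+ toℚᵘ ⟦ n ⟧         ≈⟨ toℚᵘ-homo-+ ⟦ m ⟧ ⟦ n ⟧ ⟨
    toℚᵘ (⟦ m ⟧ + ⟦ n ⟧)               ∎)
    where
    open ℚᵘ.≃-Reasoning
    eq : + (m ℕ.+ n) ≡ + m ℤ.* + 1 ℤ.+ + n ℤ.* + 1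
    eq = sym (cong₂ ℤ._+_ (ℤ.*-identityʳ (+ m)) (ℤ.*-identityʳ (+ n)))

  /-* : ∀ a b .{{_ : ℕ.NonZero b}} → (+ a / b) * ⟦ b ⟧ ≡ ⟦ a ⟧
  /-* a (suc b) = toℚᵘ-injective (begin
    toℚᵘ ((+ a / suc b) * ⟦ suc b ⟧)            ≈⟨ toℚᵘ-homo-* (+ a / suc b) ⟦ suc b ⟧ ⟩
    toℚᵘ (+ a / suc b) ℚᵘ.* toℚᵘ ⟦ suc b ⟧
      ≈⟨ ℚᵘ.*-cong (toℚᵘ-fromℚᵘ (ℚᵘ.mkℚᵘ (+ a) b)) (toℚᵘ-fromℚᵘ (ℚᵘ.mkℚᵘ (+ suc b) 0)) ⟩
    ℚᵘ.mkℚᵘ (+ a) b ℚᵘ.* ℚᵘ.mkℚᵘ (+ suc b) 0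
      ≈⟨ ℚᵘ.*≡* (ℤ.*-assoc (+ a) (+ suc b) (+ 1)) ⟩
    ℚᵘ.mkℚᵘ (+ a) 0                             ≈⟨ toℚᵘ-fromℚᵘ (ℚᵘ.mkℚᵘ (+ a) 0) ⟨
    toℚᵘ ⟦ a ⟧                                  ∎)
    where open ℚᵘ.≃-Reasoning

  ⟦⟧-suc : ∀ n → ⟦ suc n ⟧ ≡ 1ℚ + ⟦ n ⟧
  ⟦⟧-suc = ⟦⟧-+ 1

  ⟦⟧-* : ∀ m n → ⟦ m ℕ.* n ⟧ ≡ ⟦ m ⟧ * ⟦ n ⟧
  ⟦⟧-* zero    n = sym (*-zeroˡ ⟦ n ⟧)
  ⟦⟧-* (suc m) n = begin
    ⟦ n ℕ.+ m ℕ.* n ⟧         ≡⟨ ⟦⟧-+ n (m ℕ.* n) ⟩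
    ⟦ n ⟧ + ⟦ m ℕ.* n ⟧       ≡⟨ cong (_+_ ⟦ n ⟧) (⟦⟧-* m n) ⟩
    ⟦ n ⟧ + ⟦ m ⟧ * ⟦ n ⟧     ≡⟨ eq ⟦ m ⟧ ⟦ n ⟧ ⟩
    (1ℚ + ⟦ m ⟧) * ⟦ n ⟧      ≡⟨ cong (_* ⟦ n ⟧) (⟦⟧-suc m) ⟨
    ⟦ suc m ⟧ * ⟦ n ⟧         ∎
    where
    open ≡-Reasoning
    eq : ∀ x y → y + x * y ≡ (1ℚ + x) * y
    eq x y = solve (x ∷ y ∷ []) ℚ-ring

  ⟦⟧-mono : ∀ {m n} → m ℕ.≤ n → ⟦ m ⟧ ≤ ⟦ n ⟧
  ⟦⟧-mono {m} {n} m≤n = subst (λ k → ⟦ m ⟧ ≤ ⟦ k ⟧) (ℕ.m+[n∸m]≡n m≤n)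
    (subst₂ _≤_ (+-identityʳ ⟦ m ⟧) (sym (⟦⟧-+ m (n ∸ m))) (+-monoʳ-≤ ⟦ m ⟧ 0≤⟦ n ∸ m ⟧))

  ⟦⟧-cancel : ∀ {m n} → ⟦ m ⟧ ≤ ⟦ n ⟧ → m ℕ.≤ n
  ⟦⟧-cancel {m} {n} le = ℕ.≮⇒≥ λ n<m →
    <-irrefl refl (<-≤-trans (<-≤-trans (⟦n⟧<⟦1+n⟧ n) (⟦⟧-mono n<m)) le)
    where
    ⟦n⟧<⟦1+n⟧ : ∀ n → ⟦ n ⟧ < ⟦ suc n ⟧
    ⟦n⟧<⟦1+n⟧ n = subst₂ _<_ (+-identityˡ ⟦ n ⟧) (sym (⟦⟧-suc n)) (+-monoˡ-< ⟦ n ⟧ (positive⁻¹ 1ℚ))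

  *-cancelʳ : ∀ {a b c} → 0ℚ < c → a * c ≡ b * c → a ≡ b
  *-cancelʳ {a} {b} {c} 0<c eq = ≤-antisym
    (*-cancelʳ-≤-pos c {{positive 0<c}} (≤-reflexive eq))
    (*-cancelʳ-≤-pos c {{positive 0<c}} (≤-reflexive (sym eq)))

  ≤-cancel : ∀ {a b c} → 0ℚ < c → a * c ≤ b * c → a ≤ b
  ≤-cancel {c = c} 0<c = *-cancelʳ-≤-pos c {{positive 0<c}}

  0<-* : ∀ {a b} → 0ℚ < a → 0ℚ < b → 0ℚ < a * b
  0<-* {a} {b} 0<a 0<b = subst (_< a * b) (*-zeroˡ b) (*-monoˡ-<-pos b {{positive 0<b}} 0<a)

  ∣∣≤ : ∀ {a b} → a ≤ b → - a ≤ b → ∣ a ∣ ≤ b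
  ∣∣≤ {a} {b} a≤b -a≤b = [ (λ eq → subst (_≤ b) (sym eq) a≤b) , (λ eq → subst (_≤ b) (sym eq) -a≤b) ]′ (∣p∣≡p∨∣p∣≡-p a)

  a≤∣a∣ : ∀ a → a ≤ ∣ a ∣
  a≤∣a∣ a with ≤-total 0ℚ a
  ... | inj₁ 0≤a = ≤-reflexive (sym (0≤p⇒∣p∣≡p 0≤a))
  ... | inj₂ a≤0 = ≤-trans a≤0 (0≤∣p∣ a)

  -a≤∣a∣ : ∀ a → - a ≤ ∣ a ∣
  -a≤∣a∣ a = subst (- a ≤_) (∣-p∣≡∣p∣ a) (a≤∣a∣ (- a))

  ∣∣-hi : ∀ {a b} → ∣ a ∣ ≤ b → a ≤ b
  ∣∣-hi {a} = ≤-trans (a≤∣a∣ a)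

  ∣∣-lo : ∀ {a b} → ∣ a ∣ ≤ b → - a ≤ b
  ∣∣-lo {a} = ≤-trans (-a≤∣a∣ a)

  -‿swap : ∀ a b → a - b ≡ - (b - a)
  -‿swap a b = solve (a ∷ b ∷ []) ℚ-ring

  ∣∣-sym : ∀ a b → ∣ a - b ∣ ≡ ∣ b - a ∣
  ∣∣-sym a b = trans (cong ∣_∣ (-‿swap a b)) (∣-p∣≡∣p∣ (b - a))

  ∣∣-scale : ∀ {a b c} → 0ℚ ≤ c → ∣ a ∣ ≤ b → ∣ c * a ∣ ≤ c * b
  ∣∣-scale {a} {b} {c} 0≤c le = subst (_≤ c * b)
    (sym (trans (∣p*q∣≡∣p∣*∣q∣ c a) (cong (_* ∣ a ∣) (0≤p⇒∣p∣≡p 0≤c))))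
    (*-monoˡ-≤-nonNeg c {{nonNegative 0≤c}} le)


  ∣p∣*↧p≡∣↥p∣ : ∀ p → ∣ p ∣ * ⟦ ↧ₙ p ⟧ ≡ ⟦ ℤ.∣ ↥ p ∣ ⟧
  ∣p∣*↧p≡∣↥p∣ p@(mkℚ n d _) =
    trans (cong (_* ⟦ suc d ⟧) (sym (↥p/↧p≡p ∣ p ∣))) (/-* ℤ.∣ n ∣ (suc d))

  -- `a` is at most the absolute value of its numerator, and `ε` is at least the inverse of its
  -- denominator. The successor of the one times the other denominator therefore suffices.
  archimedean : ∀ a ε → 0ℚ < ε → ∃[ n ] a < ⟦ n ⟧ * ε
  archimedean a ε@(mkℚ (+ zero) d _) 0<ε with () ← positive 0<ε
  archimedean a ε@(mkℚ ℤ.-[1+ _ ] d _) 0<ε with () ← positive 0<ε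
  archimedean a ε@(mkℚ (+ suc e) d _) 0<ε = suc num ℕ.* suc d , (begin-strict
    a                                ≤⟨ a≤∣a∣ a ⟩
    ∣ a ∣                            ≤⟨ ≤-by (0≤∣p∣ a ⊗ 0≤⟦ den ⟧) (eq ∣ a ∣ ⟦ den ⟧) ⟩
    ∣ a ∣ * (1ℚ + ⟦ den ⟧)           ≡⟨ cong (∣ a ∣ *_) (⟦⟧-suc den) ⟨
    ∣ a ∣ * ⟦ suc den ⟧              ≡⟨ ∣p∣*↧p≡∣↥p∣ a ⟩
    ⟦ num ⟧                          ≡⟨ +-identityˡ ⟦ num ⟧ ⟨
    0ℚ + ⟦ num ⟧                     <⟨ +-monoˡ-< ⟦ num ⟧ (positive⁻¹ 1ℚ) ⟩
    1ℚ + ⟦ num ⟧                     ≡⟨ ⟦⟧-suc num ⟨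
    ⟦ suc num ⟧                      ≤⟨ ⟦⟧-mono (ℕ.m≤m*n (suc num) (suc e)) ⟩
    ⟦ suc num ℕ.* suc e ⟧            ≡⟨ ⟦⟧-* (suc num) (suc e) ⟩
    ⟦ suc num ⟧ * ⟦ suc e ⟧          ≡⟨ cong (⟦ suc num ⟧ *_) (trans (*-comm ⟦ suc d ⟧ ε) ε*d≡e) ⟨
    ⟦ suc num ⟧ * (⟦ suc d ⟧ * ε)    ≡⟨ *-assoc ⟦ suc num ⟧ ⟦ suc d ⟧ ε ⟨
    ⟦ suc num ⟧ * ⟦ suc d ⟧ * ε      ≡⟨ cong (_* ε) (⟦⟧-* (suc num) (suc d)) ⟨
    ⟦ suc num ℕ.* suc d ⟧ * ε        ∎)
    where
    open ≤-Reasoning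
    num = ℤ.∣ ↥ a ∣
    den = ℚ.denominator-1 a
    eq : ∀ x y → x * (1ℚ + y) - x ≡ x * y
    eq x y = solve (x ∷ y ∷ []) ℚ-ring
    ε*d≡e : ε * ⟦ suc d ⟧ ≡ ⟦ suc e ⟧
    ε*d≡e = trans (cong (_* ⟦ suc d ⟧) (sym (↥p/↧p≡p ε))) (/-* (suc e) (suc d))

  -- Finite sums and convolutions

  ∑ : ℕ → (ℕ → ℚ) → ℚ
  ∑ zero    f = 0ℚ
  ∑ (suc n) f = f 0 + ∑ n (f ∘ suc)

  ∑-cong : ∀ n {f g} → (∀ i → i ℕ.< n → f i ≡ g i) → ∑ n f ≡ ∑ n g
  ∑-cong zero    eq = refl
  ∑-cong (suc n) eq = cong₂ _+_ (eq 0 (s≤s z≤n)) (∑-cong n λ i i<n → eq (suc i) (s≤s i<n))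

  ∑-mono : ∀ n {f g} → (∀ i → i ℕ.< n → f i ≤ g i) → ∑ n f ≤ ∑ n g
  ∑-mono zero    le = ≤-refl
  ∑-mono (suc n) le = +-mono-≤ (le 0 (s≤s z≤n)) (∑-mono n λ i i<n → le (suc i) (s≤s i<n))

  ∑-snoc : ∀ n f → ∑ (suc n) f ≡ ∑ n f + f n
  ∑-snoc zero    f = +-comm (f 0) 0ℚ
  ∑-snoc (suc n) f = trans (cong (_+_ (f 0)) (∑-snoc n (f ∘ suc))) (sym (+-assoc (f 0) _ (f (suc n))))

  ∑-+ : ∀ n f g → ∑ n (λ i → f i + g i) ≡ ∑ n f + ∑ n g
  ∑-+ zero    f g = refl
  ∑-+ (suc n) f g = trans (cong (_+_ (f 0 + g 0)) (∑-+ n (f ∘ suc) (g ∘ suc))) (eq (f 0) (g 0) _ _)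
    where
    eq : ∀ a b c d → a + b + (c + d) ≡ a + c + (b + d)
    eq a b c d = solve (a ∷ b ∷ c ∷ d ∷ []) ℚ-ring

  ∑-*ʳ : ∀ n f c → ∑ n (λ i → f i * c) ≡ ∑ n f * c
  ∑-*ʳ zero    f c = sym (*-zeroˡ c)
  ∑-*ʳ (suc n) f c = trans (cong (_+_ (f 0 * c)) (∑-*ʳ n (f ∘ suc) c)) (sym (*-distribʳ-+ c (f 0) _))

  ∑-zero : ∀ n → ∑ n (λ _ → 0ℚ) ≡ 0ℚ
  ∑-zero zero    = refl
  ∑-zero (suc n) = trans (+-identityˡ _) (∑-zero n)

  ∑-nonneg : ∀ n {f} → (∀ i → 0ℚ ≤ f i) → 0ℚ ≤ ∑ n f
  ∑-nonneg n {f} 0≤f = subst (_≤ ∑ n f) (∑-zero n) (∑-mono n λ i _ → 0≤f i)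

  ∑-incr : ∀ {f m n} → (∀ i → 0ℚ ≤ f i) → m ℕ.≤ n → ∑ m f ≤ ∑ n f
  ∑-incr {n = n} 0≤f z≤n       = ∑-nonneg n 0≤f
  ∑-incr {f}     0≤f (s≤s m≤n) = +-monoʳ-≤ (f 0) (∑-incr (0≤f ∘ suc) m≤n)

  ∑-∣∣ : ∀ n f → ∣ ∑ n f ∣ ≤ ∑ n (λ i → ∣ f i ∣)
  ∑-∣∣ zero    f = ≤-refl
  ∑-∣∣ (suc n) f = ≤-trans (∣p+q∣≤∣p∣+∣q∣ (f 0) _) (+-monoʳ-≤ ∣ f 0 ∣ (∑-∣∣ n (f ∘ suc)))

  conv : (ℕ → ℚ) → (ℕ → ℚ) → ℕ → ℚ
  conv f g n = ∑ (suc n) (λ i → f i * g (n ∸ i))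

  conv-snoc : ∀ f g n → conv f g (suc n) ≡ conv f (g ∘ suc) n + f (suc n) * g 0
  conv-snoc f g zero    = eq (f 0 * g 1) (f 1 * g 0)
    where
    eq : ∀ a b → a + (b + 0ℚ) ≡ a + 0ℚ + b
    eq a b = solve (a ∷ b ∷ []) ℚ-ring
  conv-snoc f g (suc n) = trans (cong (_+_ (f 0 * g (suc (suc n)))) (conv-snoc (f ∘ suc) g n))
    (sym (+-assoc (f 0 * g (suc (suc n))) (conv (f ∘ suc) (g ∘ suc) n) (f (suc (suc n)) * g 0)))

  conv-comm : ∀ f g n → conv f g n ≡ conv g f n
  conv-comm f g zero    = cong (_+ 0ℚ) (*-comm (f 0) (g 0))
  conv-comm f g (suc n) = begin
    f 0 * g (suc n) + conv (f ∘ suc) g n   ≡⟨ cong₂ _+_ (*-comm (f 0) _) (conv-comm (f ∘ suc) g n) ⟩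
    g (suc n) * f 0 + conv g (f ∘ suc) n   ≡⟨ +-comm (g (suc n) * f 0) _ ⟩
    conv g (f ∘ suc) n + g (suc n) * f 0   ≡⟨ conv-snoc g f n ⟨
    conv g f (suc n)                       ∎
    where open ≡-Reasoning

  conv-split : ∀ K f g n →
    conv f g (K ℕ.+ n) ≡ ∑ K (λ i → f i * g (K ℕ.+ n ∸ i)) + conv (λ i → f (K ℕ.+ i)) g n
  conv-split zero    f g n = sym (+-identityˡ _)
  conv-split (suc K) f g n = trans (cong (_+_ (f 0 * g (suc K ℕ.+ n))) (conv-split K (f ∘ suc) g n))
    (sym (+-assoc (f 0 * g (suc K ℕ.+ n)) _ _))

  conv-cong : ∀ n {f f′ g g′} → (∀ i → i ℕ.≤ n → f i ≡ f′ i) → (∀ i → i ℕ.≤ n → g i ≡ g′ i) → conv f g n ≡ conv f′ g′ n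
  conv-cong n f≡ g≡ = ∑-cong (suc n) λ i i<1+n →
    cong₂ _*_ (f≡ i (ℕ.s≤s⁻¹ i<1+n)) (g≡ (n ∸ i) (ℕ.m∸n≤m n i))

  *-mono : ∀ {a b c d} → 0ℚ ≤ a → a ≤ b → 0ℚ ≤ c → c ≤ d → a * c ≤ b * d
  *-mono {a} {b} {c} {d} 0≤a a≤b 0≤c c≤d = ≤-by (0≤a ⊗ gap c≤d ⊕ gap a≤b ⊗ 0≤d) (eq a b c d)
    where
    0≤d : 0ℚ ≤ d
    0≤d = ≤-trans 0≤c c≤d
    eq : ∀ a b c d → b * d - a * c ≡ a * (d - c) + (b - a) * d
    eq a b c d = solve (a ∷ b ∷ c ∷ d ∷ []) ℚ-ring

  -- Nonnegativity is part of the order because only then are products, and with them convolutions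
  -- and corners, monotone in both factors.
  record _≼_ (f g : ℕ → ℚ) : Set where
    constructor dominated
    field
      nonneg : ∀ i → 0ℚ ≤ f i
      below  : ∀ i → f i ≤ g i

  open _≼_ public

  ≼-∘ : ∀ {f g} (h : ℕ → ℕ) → f ≼ g → (f ∘ h) ≼ (g ∘ h)
  ≼-∘ h f≼g = dominated (nonneg f≼g ∘ h) (below f≼g ∘ h)

  ∑-≼ : ∀ n {f g} → f ≼ g → ∑ n f ≤ ∑ n g
  ∑-≼ n f≼g = ∑-mono n λ i _ → below f≼g i

  conv-≼ : ∀ {f f′ g g′} → f ≼ f′ → g ≼ g′ → conv f g ≼ conv f′ g′
  conv-≼ f≼ g≼ = dominated
    (λ n → ∑-nonneg (suc n) λ i → nonneg f≼ i ⊗ nonneg g≼ (n ∸ i))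
    (λ n → ∑-mono (suc n) λ i _ → *-mono (nonneg f≼ i) (below f≼ i) (nonneg g≼ (n ∸ i)) (below g≼ (n ∸ i)))

  -- The sum of the f i * g j with i, j < n and n ≤ i + j.
  corner : (f g : ℕ → ℚ) → ℕ → ℚ
  corner f g n = ∑ n f * ∑ n g - ∑ n (conv f g)

  -- No pair with i = 0 lies in the corner. Shifting i down by one leaves the corner of size n for
  -- `f ∘ suc`, and the column j = n, which is complete.
  corner-suc : ∀ f g n → corner f g (suc n) ≡ corner (f ∘ suc) g n + ∑ n (f ∘ suc) * g n
  corner-suc f g n = begin
    (f 0 + F) * ∑ (suc n) g - ∑ (suc n) (conv f g)
      ≡⟨ cong (λ s → (f 0 + F) * ∑ (suc n) g - s) (∑-conv-suc n) ⟩
    (f 0 + F) * ∑ (suc n) g - (f 0 * ∑ (suc n) g + C)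
      ≡⟨ cong (λ s → (f 0 + F) * s - (f 0 * s + C)) (∑-snoc n g) ⟩
    (f 0 + F) * (∑ n g + g n) - (f 0 * (∑ n g + g n) + C)
      ≡⟨ eq (f 0) F (∑ n g) (g n) C ⟩
    corner (f ∘ suc) g n + F * g n ∎
    where
    open ≡-Reasoning
    F = ∑ n (f ∘ suc)
    C = ∑ n (conv (f ∘ suc) g)
    eq : ∀ a F G b C → (a + F) * (G + b) - (a * (G + b) + C) ≡ F * G - C + F * b
    eq a F G b C = solve (a ∷ F ∷ G ∷ b ∷ C ∷ []) ℚ-ring
    swap : ∀ a b c d → a + b + (c + d) ≡ a + c + (b + d)
    swap a b c d = solve (a ∷ b ∷ c ∷ d ∷ []) ℚ-ring
    ∑-conv-suc : ∀ n → ∑ (suc n) (conv f g) ≡ f 0 * ∑ (suc n) g + ∑ n (conv (f ∘ suc) g)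
    ∑-conv-suc n = begin
      conv f g 0 + ∑ n (λ i → f 0 * g (suc i) + conv (f ∘ suc) g i)
        ≡⟨ cong (_+_ (conv f g 0)) (∑-+ n (λ i → f 0 * g (suc i)) (conv (f ∘ suc) g)) ⟩
      f 0 * g 0 + 0ℚ + (∑ n (λ i → f 0 * g (suc i)) + ∑ n (conv (f ∘ suc) g))
        ≡⟨ swap (f 0 * g 0) 0ℚ _ _ ⟩
      f 0 * g 0 + ∑ n (λ i → f 0 * g (suc i)) + (0ℚ + ∑ n (conv (f ∘ suc) g))
        ≡⟨ cong₂ _+_ scaled (+-identityˡ _) ⟩
      f 0 * ∑ (suc n) g + ∑ n (conv (f ∘ suc) g) ∎
      where
      scaled : ∑ (suc n) (λ i → f 0 * g i) ≡ f 0 * ∑ (suc n) g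
      scaled = trans (∑-cong (suc n) λ i _ → *-comm (f 0) (g i))
        (trans (∑-*ʳ (suc n) g (f 0)) (*-comm _ (f 0)))

  -- A difference is not visibly monotone; the recursion `corner-suc` exhibits it as a sum of
  -- nonnegative products.
  corner-≼ : ∀ n {f f′ g g′} → f ≼ f′ → g ≼ g′ → 0ℚ ≤ corner f g n × corner f g n ≤ corner f′ g′ n
  corner-≼ zero    f≼ g≼ = ≤-refl , ≤-refl
  corner-≼ (suc n) {f} {f′} {g} {g′} f≼ g≼ =
      subst (0ℚ ≤_) (sym (corner-suc f g n)) (proj₁ IH ⊕ 0≤F ⊗ nonneg g≼ n)
    , subst₂ _≤_ (sym (corner-suc f g n)) (sym (corner-suc f′ g′ n))
        (+-mono-≤ (proj₂ IH) (*-mono 0≤F (∑-≼ n (≼-∘ suc f≼)) (nonneg g≼ n) (below g≼ n)))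
    where
    IH = corner-≼ n (≼-∘ suc f≼) g≼
    0≤F = ∑-nonneg n (nonneg f≼ ∘ suc)

  -- Catalan numbers

  -- catalan n is C_n / 4^(n+1).
  catalan : ℕ → ℚ
  catalan zero    = + 1 / 4
  catalan (suc n) = catalan n * (+ (1 ℕ.+ 2 ℕ.* n) / (4 ℕ.+ 2 ℕ.* n))

  private
    e = catalan

  catalan-suc : ∀ n → e (suc n) * (⟦ 4 ⟧ + ⟦ 2 ⟧ * ⟦ n ⟧) ≡ e n * (1ℚ + ⟦ 2 ⟧ * ⟦ n ⟧)
  catalan-suc n = begin
    e n * r * (⟦ 4 ⟧ + ⟦ 2 ⟧ * ⟦ n ⟧)    ≡⟨ cong (e n * r *_) (cast 4) ⟨
    e n * r * ⟦ 4 ℕ.+ 2 ℕ.* n ⟧          ≡⟨ *-assoc (e n) r ⟦ 4 ℕ.+ 2 ℕ.* n ⟧ ⟩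
    e n * (r * ⟦ 4 ℕ.+ 2 ℕ.* n ⟧)        ≡⟨ cong (e n *_) (/-* (1 ℕ.+ 2 ℕ.* n) (4 ℕ.+ 2 ℕ.* n)) ⟩
    e n * ⟦ 1 ℕ.+ 2 ℕ.* n ⟧              ≡⟨ cong (e n *_) (cast 1) ⟩
    e n * (1ℚ + ⟦ 2 ⟧ * ⟦ n ⟧)           ∎
    where
    open ≡-Reasoning
    r = + (1 ℕ.+ 2 ℕ.* n) / (4 ℕ.+ 2 ℕ.* n)
    cast : ∀ a → ⟦ a ℕ.+ 2 ℕ.* n ⟧ ≡ ⟦ a ⟧ + ⟦ 2 ⟧ * ⟦ n ⟧
    cast a = trans (⟦⟧-+ a (2 ℕ.* n)) (cong (_+_ ⟦ a ⟧) (⟦⟧-* 2 n))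

  catalan-positive : ∀ n → 0ℚ < e n
  catalan-positive zero    = positive⁻¹ (+ 1 / 4)
  catalan-positive (suc n) = 0<-* (catalan-positive n) (positive⁻¹ _ {{normalize-pos (1 ℕ.+ 2 ℕ.* n) (4 ℕ.+ 2 ℕ.* n)}})

  catalan-nonneg : ∀ n → 0ℚ ≤ e n
  catalan-nonneg n = <⇒≤ (catalan-positive n)

  0<4+2n : ∀ n → 0ℚ < ⟦ 4 ⟧ + ⟦ 2 ⟧ * ⟦ n ⟧
  0<4+2n n = +-mono-<-≤ 0<⟦suc 3 ⟧ (0≤⟦ 2 ⟧ ⊗ 0≤⟦ n ⟧)

  catalan-decreasing : ∀ n → e (suc n) ≤ e n
  catalan-decreasing n = ≤-cancel (0<4+2n n)
    (≤-by (0≤⟦ 3 ⟧ ⊗ catalan-nonneg n) (eq (e n) (e (suc n)) ⟦ n ⟧ (catalan-suc n)))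
    where
    eq : ∀ a b x → b * (⟦ 4 ⟧ + ⟦ 2 ⟧ * x) ≡ a * (1ℚ + ⟦ 2 ⟧ * x) →
         a * (⟦ 4 ⟧ + ⟦ 2 ⟧ * x) - b * (⟦ 4 ⟧ + ⟦ 2 ⟧ * x) ≡ ⟦ 3 ⟧ * a
    eq a b x h = trans (cong (λ c → a * (⟦ 4 ⟧ + ⟦ 2 ⟧ * x) - c) h) (solve (a ∷ x ∷ []) ℚ-ring)

  antitone : ∀ {f : ℕ → ℚ} → (∀ n → f (suc n) ≤ f n) → ∀ k n → f (k ℕ.+ n) ≤ f n
  antitone f↓ zero    n = ≤-refl
  antitone f↓ (suc k) n = ≤-trans (f↓ (k ℕ.+ n)) (antitone f↓ k n)

  catalan-antitone : ∀ {m n} → m ℕ.≤ n → e n ≤ e m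
  catalan-antitone {m} {n} m≤n =
    subst (λ k → e k ≤ e m) (ℕ.m∸n+n≡m m≤n) (antitone catalan-decreasing (n ∸ m) m)

  index : (ℕ → ℚ) → ℕ → ℚ
  index f n = ⟦ n ⟧ * f n

  -- Multiplication by the index is x d/dx on generating functions, so this is 2 (x f′) f = x (f²)′.
  conv-index : ∀ f n → conv (index f) f n + conv (index f) f n ≡ ⟦ n ⟧ * conv f f n
  conv-index f n = begin
    conv (index f) f n + conv (index f) f n
      ≡⟨ cong (_+_ (conv (index f) f n)) (conv-comm (index f) f n) ⟩
    conv (index f) f n + conv f (index f) n
      ≡⟨ ∑-+ (suc n) (λ i → ⟦ i ⟧ * f i * f (n ∸ i)) (λ i → f i * (⟦ n ∸ i ⟧ * f (n ∸ i))) ⟨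
    ∑ (suc n) (λ i → ⟦ i ⟧ * f i * f (n ∸ i) + f i * (⟦ n ∸ i ⟧ * f (n ∸ i)))
      ≡⟨ ∑-cong (suc n) (λ i i≤n → collect i (ℕ.s≤s⁻¹ i≤n)) ⟩
    ∑ (suc n) (λ i → f i * f (n ∸ i) * ⟦ n ⟧)
      ≡⟨ ∑-*ʳ (suc n) (λ i → f i * f (n ∸ i)) ⟦ n ⟧ ⟩
    conv f f n * ⟦ n ⟧
      ≡⟨ *-comm (conv f f n) ⟦ n ⟧ ⟩
    ⟦ n ⟧ * conv f f n ∎
    where
    open ≡-Reasoning
    eq : ∀ a b x y → x * a * b + a * (y * b) ≡ a * b * (x + y)
    eq a b x y = solve (a ∷ b ∷ x ∷ y ∷ []) ℚ-ring
    collect : ∀ i → i ℕ.≤ n →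
      ⟦ i ⟧ * f i * f (n ∸ i) + f i * (⟦ n ∸ i ⟧ * f (n ∸ i)) ≡ f i * f (n ∸ i) * ⟦ n ⟧
    collect i i≤n = trans (eq (f i) (f (n ∸ i)) ⟦ i ⟧ ⟦ n ∸ i ⟧)
      (cong (f i * f (n ∸ i) *_) (trans (sym (⟦⟧-+ i (n ∸ i))) (cong ⟦_⟧ (ℕ.m+[n∸m]≡n i≤n))))

  conv-linearˡ : ∀ a b f g h n → conv (λ i → a * f i + b * g i) h n ≡ a * conv f h n + b * conv g h n
  conv-linearˡ a b f g h n = begin
    conv (λ i → a * f i + b * g i) h n
      ≡⟨ ∑-cong (suc n) (λ i _ → eq a b (f i) (g i) (h (n ∸ i))) ⟩
    ∑ (suc n) (λ i → f i * h (n ∸ i) * a + g i * h (n ∸ i) * b)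
      ≡⟨ ∑-+ (suc n) (λ i → f i * h (n ∸ i) * a) (λ i → g i * h (n ∸ i) * b) ⟩
    ∑ (suc n) (λ i → f i * h (n ∸ i) * a) + ∑ (suc n) (λ i → g i * h (n ∸ i) * b)
      ≡⟨ cong₂ _+_ (∑-*ʳ (suc n) (λ i → f i * h (n ∸ i)) a) (∑-*ʳ (suc n) (λ i → g i * h (n ∸ i)) b) ⟩
    conv f h n * a + conv g h n * b
      ≡⟨ cong₂ _+_ (*-comm (conv f h n) a) (*-comm (conv g h n) b) ⟩
    a * conv f h n + b * conv g h n ∎
    where
    open ≡-Reasoning
    eq : ∀ a b x y z → (a * x + b * y) * z ≡ x * z * a + y * z * b
    eq a b x y z = solve (a ∷ b ∷ x ∷ y ∷ z ∷ []) ℚ-ring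

  -- Both sides of Σᵢ (2i+4) eᵢ₊₁ eₙ₋ᵢ = Σᵢ (2i+1) eᵢ eₙ₋ᵢ symmetrise under i ↔ n-i to
  -- multiples of conv e e, which yields a first-order recurrence for conv e e.
  catalan-conv : ∀ n → e (suc n) ≡ conv e e n
  catalan-conv zero    = refl
  catalan-conv (suc n) = *-cancelʳ (0<4+2n (suc n)) (trans (catalan-suc (suc n)) (sym (begin
    S₁ * (⟦ 4 ⟧ + ⟦ 2 ⟧ * ⟦ suc n ⟧)
      ≡⟨ expand S₁ I₁ ⟦ suc n ⟧ (conv-index e (suc n)) ⟩
    ⟦ 2 ⟧ * (⟦ 2 ⟧ * I₁ + ⟦ 2 ⟧ * S₁)
      ≡⟨ cong (⟦ 2 ⟧ *_) (conv-linearˡ ⟦ 2 ⟧ ⟦ 2 ⟧ (index e) e e (suc n)) ⟨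
    -- The term i = 0 has weight 2 e₀ = ½. In every later term the recurrence turns (2i + 4) e(i+1)
    -- into (2i + 1) e(i).
    ⟦ 2 ⟧ * ((⟦ 2 ⟧ * (0ℚ * e 0) + ⟦ 2 ⟧ * e 0) * e (suc n)
        + conv (λ i → ⟦ 2 ⟧ * (⟦ suc i ⟧ * e (suc i)) + ⟦ 2 ⟧ * e (suc i)) e n)
      ≡⟨ cong (λ c → ⟦ 2 ⟧ * ((⟦ 2 ⟧ * (0ℚ * e 0) + ⟦ 2 ⟧ * e 0) * e (suc n) + c)) (conv-cong n
          {g = e} (λ i _ → shift i) (λ _ _ → refl)) ⟩
    ⟦ 2 ⟧ * ((⟦ 2 ⟧ * (0ℚ * e 0) + ⟦ 2 ⟧ * e 0) * e (suc n) + conv (λ i → ⟦ 2 ⟧ * index e i + 1ℚ * e i) e n)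
      ≡⟨ cong (λ c → ⟦ 2 ⟧ * ((+ 1 / 2) * e (suc n) + c)) (conv-linearˡ ⟦ 2 ⟧ 1ℚ (index e) e e n) ⟩
    ⟦ 2 ⟧ * ((+ 1 / 2) * e (suc n) + (⟦ 2 ⟧ * I₀ + 1ℚ * S₀))
      ≡⟨ collect (e (suc n)) S₀ I₀ ⟦ n ⟧ (conv-index e n) (catalan-conv n) ⟩
    e (suc n) * (1ℚ + ⟦ 2 ⟧ * (1ℚ + ⟦ n ⟧))
      ≡⟨ cong (λ x → e (suc n) * (1ℚ + ⟦ 2 ⟧ * x)) (⟦⟧-suc n) ⟨
    e (suc n) * (1ℚ + ⟦ 2 ⟧ * ⟦ suc n ⟧) ∎)))
    where
    open ≡-Reasoning
    S₀ = conv e e n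
    S₁ = conv e e (suc n)
    I₀ = conv (index e) e n
    I₁ = conv (index e) e (suc n)
    expand : ∀ S I x → I + I ≡ x * S → S * (⟦ 4 ⟧ + ⟦ 2 ⟧ * x) ≡ ⟦ 2 ⟧ * (⟦ 2 ⟧ * I + ⟦ 2 ⟧ * S)
    expand S I x h = trans (lhs S x) (trans (cong (λ c → ⟦ 2 ⟧ * (c + ⟦ 2 ⟧ * S)) (sym h)) (rhs S I))
      where
      lhs : ∀ S x → S * (⟦ 4 ⟧ + ⟦ 2 ⟧ * x) ≡ ⟦ 2 ⟧ * (x * S + ⟦ 2 ⟧ * S)
      lhs S x = solve (S ∷ x ∷ []) ℚ-ring
      rhs : ∀ S I → ⟦ 2 ⟧ * (I + I + ⟦ 2 ⟧ * S) ≡ ⟦ 2 ⟧ * (⟦ 2 ⟧ * I + ⟦ 2 ⟧ * S)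
      rhs S I = solve (S ∷ I ∷ []) ℚ-ring
    shift : ∀ i → ⟦ 2 ⟧ * (⟦ suc i ⟧ * e (suc i)) + ⟦ 2 ⟧ * e (suc i) ≡ ⟦ 2 ⟧ * (⟦ i ⟧ * e i) + 1ℚ * e i
    shift i = trans (cong (λ x → ⟦ 2 ⟧ * (x * e (suc i)) + ⟦ 2 ⟧ * e (suc i)) (⟦⟧-suc i))
      (trans (lhs (e (suc i)) ⟦ i ⟧) (trans (catalan-suc i) (rhs (e i) ⟦ i ⟧)))
      where
      lhs : ∀ b x → ⟦ 2 ⟧ * ((1ℚ + x) * b) + ⟦ 2 ⟧ * b ≡ b * (⟦ 4 ⟧ + ⟦ 2 ⟧ * x)
      lhs b x = solve (b ∷ x ∷ []) ℚ-ring
      rhs : ∀ a x → a * (1ℚ + ⟦ 2 ⟧ * x) ≡ ⟦ 2 ⟧ * (x * a) + 1ℚ * a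
      rhs a x = solve (a ∷ x ∷ []) ℚ-ring
    collect : ∀ b S I x → I + I ≡ x * S → b ≡ S →
      ⟦ 2 ⟧ * ((+ 1 / 2) * b + (⟦ 2 ⟧ * I + 1ℚ * S)) ≡ b * (1ℚ + ⟦ 2 ⟧ * (1ℚ + x))
    collect b S I x h refl = trans (lhs S I) (trans (cong (λ c → ⟦ 2 ⟧ * c + ⟦ 3 ⟧ * S) h) (rhs S x))
      where
      lhs : ∀ S I → ⟦ 2 ⟧ * ((+ 1 / 2) * S + (⟦ 2 ⟧ * I + 1ℚ * S)) ≡ ⟦ 2 ⟧ * (I + I) + ⟦ 3 ⟧ * S
      lhs S I = solve (S ∷ I ∷ []) ℚ-ring
      rhs : ∀ S x → ⟦ 2 ⟧ * (x * S) + ⟦ 3 ⟧ * S ≡ S * (1ℚ + ⟦ 2 ⟧ * (1ℚ + x))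
      rhs S x = solve (S ∷ x ∷ []) ℚ-ring

  -- Central binomial coefficients: tail n is binom(2n,n) / 4^n, which is twice the
  -- sum of catalan i over i ≥ n.
  tail : ℕ → ℚ
  tail n = ⟦ 4 ⟧ * (1ℚ + ⟦ n ⟧) * e n

  tail-suc : ∀ n → tail (suc n) ≡ tail n - ⟦ 2 ⟧ * e n
  tail-suc n = begin
    ⟦ 4 ⟧ * (1ℚ + ⟦ suc n ⟧) * e (suc n)       ≡⟨ cong (λ x → ⟦ 4 ⟧ * (1ℚ + x) * e (suc n)) (⟦⟧-suc n) ⟩
    ⟦ 4 ⟧ * (1ℚ + (1ℚ + ⟦ n ⟧)) * e (suc n)    ≡⟨ lhs (e (suc n)) ⟦ n ⟧ ⟩
    ⟦ 2 ⟧ * (e (suc n) * (⟦ 4 ⟧ + ⟦ 2 ⟧ * ⟦ n ⟧)) ≡⟨ cong (⟦ 2 ⟧ *_) (catalan-suc n) ⟩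
    ⟦ 2 ⟧ * (e n * (1ℚ + ⟦ 2 ⟧ * ⟦ n ⟧))       ≡⟨ rhs (e n) ⟦ n ⟧ ⟩
    tail n - ⟦ 2 ⟧ * e n                       ∎
    where
    open ≡-Reasoning
    lhs : ∀ b x → ⟦ 4 ⟧ * (1ℚ + (1ℚ + x)) * b ≡ ⟦ 2 ⟧ * (b * (⟦ 4 ⟧ + ⟦ 2 ⟧ * x))
    lhs b x = solve (b ∷ x ∷ []) ℚ-ring
    rhs : ∀ a x → ⟦ 2 ⟧ * (a * (1ℚ + ⟦ 2 ⟧ * x)) ≡ ⟦ 4 ⟧ * (1ℚ + x) * a - ⟦ 2 ⟧ * a
    rhs a x = solve (a ∷ x ∷ []) ℚ-ring

  -- The remainder telescopes by `tail-suc`. Exactness matters: errors for general sequences below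
  -- `e` are bounded by the same errors for `e`, which this identity evaluates.
  ∑-catalan : ∀ n → ⟦ 2 ⟧ * ∑ n e + tail n ≡ 1ℚ
  ∑-catalan zero    = refl
  ∑-catalan (suc n) = begin
    ⟦ 2 ⟧ * ∑ (suc n) e + tail (suc n)              ≡⟨ cong₂ (λ s t → ⟦ 2 ⟧ * s + t) (∑-snoc n e) (tail-suc n) ⟩
    ⟦ 2 ⟧ * (∑ n e + e n) + (tail n - ⟦ 2 ⟧ * e n)  ≡⟨ eq (∑ n e) (e n) (tail n) ⟩
    ⟦ 2 ⟧ * ∑ n e + tail n                          ≡⟨ ∑-catalan n ⟩
    1ℚ                                              ∎
    where
    open ≡-Reasoning
    eq : ∀ s a t → ⟦ 2 ⟧ * (s + a) + (t - ⟦ 2 ⟧ * a) ≡ ⟦ 2 ⟧ * s + t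
    eq s a t = solve (s ∷ a ∷ t ∷ []) ℚ-ring

  tail-nonneg : ∀ n → 0ℚ ≤ tail n
  tail-nonneg n = 0≤⟦ 4 ⟧ ⊗ (0≤⟦ 1 ⟧ ⊕ 0≤⟦ n ⟧) ⊗ catalan-nonneg n

  -- Wallis bound for the central binomial coefficient: the left side decreases in n, the quotient
  -- of consecutive values being (2n+1)(2n+3)/(2n+2)².
  tail-square : ∀ n → tail n * tail n * (1ℚ + ⟦ 2 ⟧ * ⟦ n ⟧) ≤ 1ℚ
  tail-square zero    = ≤-refl
  tail-square (suc n) = ≤-trans (subst (λ x → tail (suc n) * tail (suc n) * (1ℚ + ⟦ 2 ⟧ * x)
      ≤ tail n * tail n * (1ℚ + ⟦ 2 ⟧ * ⟦ n ⟧)) (sym (⟦⟧-suc n))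
    (subst (λ t → t * t * (1ℚ + ⟦ 2 ⟧ * (1ℚ + ⟦ n ⟧)) ≤ tail n * tail n * (1ℚ + ⟦ 2 ⟧ * ⟦ n ⟧)) (sym (tail-suc n))
      (≤-by (square-nonneg (e n) ⊗ (0≤⟦ 4 ⟧ ⊕ 0≤⟦ 8 ⟧ ⊗ 0≤⟦ n ⟧)) (eq (e n) ⟦ n ⟧))))
    (tail-square n)
    where
    eq : ∀ a x → ⟦ 4 ⟧ * (1ℚ + x) * a * (⟦ 4 ⟧ * (1ℚ + x) * a) * (1ℚ + ⟦ 2 ⟧ * x)
               - (⟦ 4 ⟧ * (1ℚ + x) * a - ⟦ 2 ⟧ * a) * (⟦ 4 ⟧ * (1ℚ + x) * a - ⟦ 2 ⟧ * a) * (1ℚ + ⟦ 2 ⟧ * (1ℚ + x))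
               ≡ a * a * (⟦ 4 ⟧ + ⟦ 8 ⟧ * x)
    eq a x = solve (a ∷ x ∷ []) ℚ-ring

  tail-decreasing : ∀ n → tail (suc n) ≤ tail n
  tail-decreasing n = subst (_≤ tail n) (sym (tail-suc n))
    (≤-by (0≤⟦ 2 ⟧ ⊗ catalan-nonneg n) (eq (tail n) (e n)))
    where
    eq : ∀ t a → t - (t - ⟦ 2 ⟧ * a) ≡ ⟦ 2 ⟧ * a
    eq t a = solve (t ∷ a ∷ []) ℚ-ring

  tail-antitone : ∀ {m n} → m ℕ.≤ n → tail n ≤ tail m
  tail-antitone {m} {n} m≤n =
    subst (λ k → tail k ≤ tail m) (ℕ.m∸n+n≡m m≤n) (antitone tail-decreasing (n ∸ m) m)

  tail-vanishes : ∀ ε → 0ℚ < ε → Eventually (λ n → tail n ≤ ε)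
  tail-vanishes ε 0<ε with archimedean 1ℚ (ε * ε) (0<-* 0<ε 0<ε)
  ... | N , 1<Nε² = N , λ n N≤n → ≤-trans (tail-antitone N≤n) (≮⇒≥ λ ε<t →
    <-irrefl refl (<-≤-trans 1<Nε² (≤-trans
      (≤-by (0≤⟦ N ⟧ ⊗ gap (*-mono (<⇒≤ 0<ε) (<⇒≤ ε<t) (<⇒≤ 0<ε) (<⇒≤ ε<t))
          ⊕ square-nonneg (tail N) ⊗ (0≤⟦ 1 ⟧ ⊕ 0≤⟦ N ⟧))
        (eq (tail N) ε ⟦ N ⟧))
      (tail-square N))))
    where
    eq : ∀ t ε n → t * t * (1ℚ + ⟦ 2 ⟧ * n) - n * (ε * ε) ≡ n * (t * t - ε * ε) + t * t * (1ℚ + n)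
    eq t ε n = solve (t ∷ ε ∷ n ∷ []) ℚ-ring

  -- Limits of coefficient ratios

  -- Since n is at least 2K, the terms with i < K and those with n - i < K do not overlap. What lies
  -- between is again a convolution, of the shifted sequences.
  conv-ends : ∀ K r f g → let n = K ℕ.+ (K ℕ.+ r) in
    conv f g n ≡ ∑ K (λ i → f i * g (n ∸ i) + g i * f (n ∸ i))
               + conv (λ i → g (K ℕ.+ i)) (λ i → f (K ℕ.+ i)) r
  conv-ends K r f g = begin
    conv f g n
      ≡⟨ conv-split K f g (K ℕ.+ r) ⟩
    ∑ K (λ i → f i * g (n ∸ i)) + conv f′ g (K ℕ.+ r)
      ≡⟨ cong (_+_ (∑ K (λ i → f i * g (n ∸ i)))) (trans (conv-comm f′ g (K ℕ.+ r)) (conv-split K g f′ r)) ⟩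
    ∑ K (λ i → f i * g (n ∸ i)) + (∑ K (λ i → g i * f (K ℕ.+ (K ℕ.+ r ∸ i))) + conv g′ f′ r)
      ≡⟨ cong (λ s → ∑ K (λ i → f i * g (n ∸ i)) + (s + conv g′ f′ r))
           (∑-cong K (λ i i<K → cong (λ j → g i * f j)
             (sym (ℕ.+-∸-assoc K (ℕ.≤-trans (ℕ.<⇒≤ i<K) (ℕ.m≤m+n K r)))))) ⟩
    ∑ K (λ i → f i * g (n ∸ i)) + (∑ K (λ i → g i * f (n ∸ i)) + conv g′ f′ r)
      ≡⟨ +-assoc (∑ K (λ i → f i * g (n ∸ i))) _ _ ⟨
    ∑ K (λ i → f i * g (n ∸ i)) + ∑ K (λ i → g i * f (n ∸ i)) + conv g′ f′ r
      ≡⟨ cong (_+ conv g′ f′ r) (∑-+ K (λ i → f i * g (n ∸ i)) (λ i → g i * f (n ∸ i))) ⟨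
    ∑ K (λ i → f i * g (n ∸ i) + g i * f (n ∸ i)) + conv g′ f′ r ∎
    where
    open ≡-Reasoning
    n = K ℕ.+ (K ℕ.+ r)
    f′ = λ i → f (K ℕ.+ i)
    g′ = λ i → g (K ℕ.+ i)

  -- φ is the quotient f / e, stated multiplicatively to avoid division; positivity of `e` makes it
  -- unique.
  record Ratio (f φ : ℕ → ℚ) : Set where
    field
      dom    : f ≼ e
      scaled : ∀ n → φ n * e n ≡ f n

    ratio-nonneg : ∀ n → 0ℚ ≤ φ n
    ratio-nonneg n = ≤-cancel (catalan-positive n)
      (subst₂ _≤_ (sym (*-zeroˡ (e n))) (sym (scaled n)) (nonneg dom n))

    ratio-≤1 : ∀ n → φ n ≤ 1ℚ
    ratio-≤1 n = ≤-cancel (catalan-positive n)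
      (subst₂ _≤_ (sym (scaled n)) (sym (*-identityˡ (e n))) (below dom n))

  open Ratio public

  e-ratio : Ratio e (λ _ → 1ℚ)
  e-ratio = record { dom = dominated catalan-nonneg (λ _ → ≤-refl) ; scaled = λ n → *-identityˡ (e n) }

  -- The finite combination of earlier ratios that approximates `conv f g n` divided by `e (suc n)`;
  -- `excess` corrects for treating every `e (n ∸ i)` as `e (suc n)`.
  ends : (K : ℕ) (f g φ γ : ℕ → ℚ) → ℕ → ℚ
  ends K f g φ γ n = ∑ K (λ i → f i * γ (n ∸ i) + g i * φ (n ∸ i))

  excess : (f g φ γ : ℕ → ℚ) (n i : ℕ) → ℚ
  excess f g φ γ n i = (f i * γ (n ∸ i) + g i * φ (n ∸ i)) * (e (n ∸ i) - e (suc n))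

  conv-ratio : ∀ {f g φ γ} → Ratio f φ → Ratio g γ → ∀ K r → let n = K ℕ.+ (K ℕ.+ r) in
    conv f g n ≡ ends K f g φ γ n * e (suc n) + ∑ K (excess f g φ γ n)
               + conv (λ i → g (K ℕ.+ i)) (λ i → f (K ℕ.+ i)) r
  conv-ratio {f} {g} {φ} {γ} f:φ g:γ K r = trans (conv-ends K r f g) (cong (_+ _) (begin
    ∑ K (λ i → f i * g (n ∸ i) + g i * f (n ∸ i))
      ≡⟨ ∑-cong K (λ i _ → trans
           (cong₂ (λ x y → f i * x + g i * y) (sym (scaled g:γ (n ∸ i))) (sym (scaled f:φ (n ∸ i))))
           (eq (f i) (g i) (γ (n ∸ i)) (φ (n ∸ i)) (e (n ∸ i)) (e (suc n)))) ⟩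
    ∑ K (λ i → (f i * γ (n ∸ i) + g i * φ (n ∸ i)) * e (suc n) + excess f g φ γ n i)
      ≡⟨ ∑-+ K (λ i → (f i * γ (n ∸ i) + g i * φ (n ∸ i)) * e (suc n)) (excess f g φ γ n) ⟩
    ∑ K (λ i → (f i * γ (n ∸ i) + g i * φ (n ∸ i)) * e (suc n)) + ∑ K (excess f g φ γ n)
      ≡⟨ cong (_+ ∑ K (excess f g φ γ n)) (∑-*ʳ K (λ i → f i * γ (n ∸ i) + g i * φ (n ∸ i)) (e (suc n))) ⟩
    ends K f g φ γ n * e (suc n) + ∑ K (excess f g φ γ n) ∎))
    where
    open ≡-Reasoning
    n = K ℕ.+ (K ℕ.+ r)
    eq : ∀ f g γ φ e e′ → f * (γ * e) + g * (φ * e) ≡ (f * γ + g * φ) * e′ + (f * γ + g * φ) * (e - e′)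
    eq f g γ φ e e′ = solve (f ∷ g ∷ γ ∷ φ ∷ e ∷ e′ ∷ []) ℚ-ring

  -- The error made by replacing each e (n ∸ i) by e (suc n) and dropping the middle of the
  -- convolution is largest for f = g = e, where it is known exactly since conv e e n = e (suc n).
  conv-ends-bound : ∀ {f g φ γ} → Ratio f φ → Ratio g γ → ∀ K r → let n = K ℕ.+ (K ℕ.+ r) in
    ∀ {ρ} → ρ * e (suc n) ≡ conv f g n →
    0ℚ ≤ ρ - ends K f g φ γ n × ρ - ends K f g φ γ n ≤ tail K
  conv-ends-bound {f} {g} {φ} {γ} f:φ g:γ K r {ρ} ρe≡ =
      ≤-cancel 0<e′ (subst₂ _≤_ (sym (*-zeroˡ e′)) (sym error≡) (∑-nonneg K x-nonneg ⊕ nonneg mid r))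
    , ≤-cancel 0<e′ (subst₂ _≤_ (sym error≡) (sym tail≡) (+-mono-≤ (∑-mono K λ i _ → x≤X i) (below mid r)))
    where
    n = K ℕ.+ (K ℕ.+ r)
    e′ = e (suc n)
    0<e′ = catalan-positive (suc n)
    L = ends K f g φ γ n
    x = excess f g φ γ n
    X = excess e e (λ _ → 1ℚ) (λ _ → 1ℚ) n
    mid : conv (λ i → g (K ℕ.+ i)) (λ i → f (K ℕ.+ i)) ≼ conv (λ i → e (K ℕ.+ i)) (λ i → e (K ℕ.+ i))
    mid = conv-≼ (≼-∘ (K ℕ.+_) (dom g:γ)) (≼-∘ (K ℕ.+_) (dom f:φ))
    e′≤ : ∀ i → e′ ≤ e (n ∸ i)
    e′≤ i = catalan-antitone (ℕ.≤-trans (ℕ.m∸n≤m n i) (ℕ.n≤1+n n))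
    w-nonneg : ∀ i → 0ℚ ≤ f i * γ (n ∸ i) + g i * φ (n ∸ i)
    w-nonneg i = nonneg (dom f:φ) i ⊗ ratio-nonneg g:γ (n ∸ i) ⊕ nonneg (dom g:γ) i ⊗ ratio-nonneg f:φ (n ∸ i)
    x-nonneg : ∀ i → 0ℚ ≤ x i
    x-nonneg i = w-nonneg i ⊗ gap (e′≤ i)
    x≤X : ∀ i → x i ≤ X i
    x≤X i = *-mono (w-nonneg i)
      (+-mono-≤ (*-mono (nonneg (dom f:φ) i) (below (dom f:φ) i) (ratio-nonneg g:γ (n ∸ i)) (ratio-≤1 g:γ (n ∸ i)))
                (*-mono (nonneg (dom g:γ) i) (below (dom g:γ) i) (ratio-nonneg f:φ (n ∸ i)) (ratio-≤1 f:φ (n ∸ i))))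
      (gap (e′≤ i)) ≤-refl
    error≡ : (ρ - L) * e′ ≡ ∑ K x + conv (λ i → g (K ℕ.+ i)) (λ i → f (K ℕ.+ i)) r
    error≡ = eq ρ L e′ (∑ K x) _ (trans ρe≡ (conv-ratio f:φ g:γ K r))
      where
      move : ∀ L e s m → L * e + s + m - L * e ≡ s + m
      move L e s m = solve (L ∷ e ∷ s ∷ m ∷ []) ℚ-ring
      dist : ∀ ρ L e → (ρ - L) * e ≡ ρ * e - L * e
      dist ρ L e = solve (ρ ∷ L ∷ e ∷ []) ℚ-ring
      eq : ∀ ρ L e s m → ρ * e ≡ L * e + s + m → (ρ - L) * e ≡ s + m
      eq ρ L e s m h = trans (dist ρ L e) (trans (cong (_- L * e) h) (move L e s m))
    -- Here every ratio is 1 and the ends sum to `2 ∑ K e`, so `∑-catalan` identifies the total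
    -- error as `tail K`.
    tail≡ : tail K * e′ ≡ ∑ K X + conv (λ i → e (K ℕ.+ i)) (λ i → e (K ℕ.+ i)) r
    tail≡ = eq (tail K) (∑ K e) e′ (∑ K X) _ (∑-catalan K)
      (trans (catalan-conv n) (trans (conv-ratio e-ratio e-ratio K r)
          (cong (λ s → s * e′ + ∑ K X + conv (λ i → e (K ℕ.+ i)) (λ i → e (K ℕ.+ i)) r) ends≡)))
      where
      ends≡ : ends K e e (λ _ → 1ℚ) (λ _ → 1ℚ) n ≡ ∑ K e * ⟦ 2 ⟧
      ends≡ = trans (∑-cong K (λ i _ → double (e i))) (∑-*ʳ K e ⟦ 2 ⟧)
        where
        double : ∀ a → a * 1ℚ + a * 1ℚ ≡ a * ⟦ 2 ⟧
        double a = solve (a ∷ []) ℚ-ring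
      lhs : ∀ t S e → t * e ≡ (⟦ 2 ⟧ * S + t) * e - S * ⟦ 2 ⟧ * e
      lhs t S e = solve (t ∷ S ∷ e ∷ []) ℚ-ring
      rhs : ∀ S e s m → S * ⟦ 2 ⟧ * e + s + m - S * ⟦ 2 ⟧ * e ≡ s + m
      rhs S e s m = solve (S ∷ e ∷ s ∷ m ∷ []) ℚ-ring
      eq : ∀ t S e s m → ⟦ 2 ⟧ * S + t ≡ 1ℚ → e ≡ S * ⟦ 2 ⟧ * e + s + m → t * e ≡ s + m
      eq t S e s m h h′ = trans (lhs t S e) (trans (cong (λ c → c * e - S * ⟦ 2 ⟧ * e) h)
        (trans (cong (_- S * ⟦ 2 ⟧ * e) (trans (*-identityˡ e) h′)) (rhs S e s m)))

  ∑-catalan-≤½ : ∀ n → ∑ n e ≤ ½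
  ∑-catalan-≤½ n = ≤-by (nonNegative⁻¹ ½ ⊗ tail-nonneg n) (eq (∑ n e) (tail n) (∑-catalan n))
    where
    half : ∀ S t → ½ * (⟦ 2 ⟧ * S + t) - S ≡ ½ * t
    half S t = solve (S ∷ t ∷ []) ℚ-ring
    eq : ∀ S t → ⟦ 2 ⟧ * S + t ≡ 1ℚ → ½ - S ≡ ½ * t
    eq S t h = trans (cong (λ c → ½ * c - S) (sym h)) (half S t)

  -- Cauchy property of the ratios, one rank at a time

  Osc : (ℕ → ℚ) → ℚ → ℕ → Set
  Osc f M N = ∀ i j → N ℕ.≤ i → N ℕ.≤ j → ∣ f i - f j ∣ ≤ M

  Cauchyℚ : (ℕ → ℚ) → Set
  Cauchyℚ f = ∀ ε → 0ℚ < ε → ∃[ N ] Osc f ε N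

  -- The factor ¾ is what one contraction ½(ε + M) + tail K leaves of M when ε = M/4 and tail K is
  -- at most M/8.
  powers : ℕ → ℚ
  powers zero    = 1ℚ
  powers (suc p) = (+ 3 / 4) * powers p

  powers-positive : ∀ p → 0ℚ < powers p
  powers-positive zero    = positive⁻¹ 1ℚ
  powers-positive (suc p) = 0<-* (positive⁻¹ (+ 3 / 4)) (powers-positive p)

  -- Bernoulli's inequality (4/3)^p ≥ 1 + p/3, cleared of denominators.
  powers-bernoulli : ∀ p → powers p * (⟦ 3 ⟧ + ⟦ p ⟧) ≤ ⟦ 3 ⟧
  powers-bernoulli zero    = ≤-refl
  powers-bernoulli (suc p) = ≤-trans (subst (λ x → powers (suc p) * (⟦ 3 ⟧ + x) ≤ powers p * (⟦ 3 ⟧ + ⟦ p ⟧))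
      (sym (⟦⟧-suc p))
    (≤-by (nonNegative⁻¹ (+ 1 / 4) ⊗ <⇒≤ (powers-positive p) ⊗ 0≤⟦ p ⟧) (eq (powers p) ⟦ p ⟧)))
    (powers-bernoulli p)
    where
    eq : ∀ a x → a * (⟦ 3 ⟧ + x) - (+ 3 / 4) * a * (⟦ 3 ⟧ + (1ℚ + x)) ≡ (+ 1 / 4) * a * x
    eq a x = solve (a ∷ x ∷ []) ℚ-ring

  powers-vanish : ∀ ε → 0ℚ < ε → ∃[ p ] powers p ≤ ε
  powers-vanish ε 0<ε with archimedean ⟦ 3 ⟧ ε 0<ε
  ... | p , 3<pε = p , ≮⇒≥ λ ε<a → <-irrefl refl (<-≤-trans 3<pε (≤-trans
    (≤-by (0≤⟦ p ⟧ ⊗ gap (<⇒≤ ε<a) ⊕ 0≤⟦ 3 ⟧ ⊗ <⇒≤ (powers-positive p)) (eq (powers p) ⟦ p ⟧ ε))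
    (powers-bernoulli p)))
    where
    eq : ∀ a p ε → a * (⟦ 3 ⟧ + p) - p * ε ≡ p * (a - ε) + ⟦ 3 ⟧ * a
    eq a p ε = solve (a ∷ p ∷ ε ∷ []) ℚ-ring

  osc-≤ : ∀ {f M M′ N} → M ≤ M′ → Osc f M N → Osc f M′ N
  osc-≤ le osc i j N≤i N≤j = ≤-trans (osc i j N≤i N≤j) le

  -- For f the scaled coefficients of H_k this is u_k with the series cut off after n terms, which
  -- keeps it rational.
  mass : (ℕ → ℚ) → ℕ → ℚ
  mass f n = 1ℚ - ∑ n f

  -- One rank k: `h`, `a`, `d` stand for the scaled H_k, H_{k+1}, G_k, and `η`, `α`, `ρ` for their
  -- ratios. Index n means n + 1 leaves, so the product G_k H_{k+1} shows up one index later.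
  record Rank (x : ℚ) (h a d η α ρ : ℕ → ℚ) : Set where
    field
      h:η    : Ratio h η
      a:α    : Ratio a α
      d:ρ    : Ratio d ρ
      split  : ∀ n → h n ≡ a n + d n
      d-zero : d 0 ≡ x
      d-suc  : ∀ n → d (suc n) ≡ conv d a n

  module _ {x h a d η α ρ} (ℓ : Rank x h a d η α ρ) where
    open Rank ℓ

    private
      ρ-suc : ∀ n → ρ (suc n) * e (suc n) ≡ conv d a n
      ρ-suc n = trans (scaled d:ρ (suc n)) (d-suc n)

      ratio-split : ∀ n → η n ≡ α n + ρ n
      ratio-split n = *-cancelʳ (catalan-positive n) (begin
        η n * e n               ≡⟨ scaled h:η n ⟩
        h n                     ≡⟨ split n ⟩
        a n + d n               ≡⟨ cong₂ _+_ (scaled a:α n) (scaled d:ρ n) ⟨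
        α n * e n + ρ n * e n   ≡⟨ *-distribʳ-+ (e n) (α n) (ρ n) ⟨
        (α n + ρ n) * e n       ∎)
        where open ≡-Reasoning

      α-diff : ∀ i j → α i - α j ≡ (η i - η j) - (ρ i - ρ j)
      α-diff i j = trans (eq (α i) (α j) (ρ i) (ρ j))
        (sym (cong₂ (λ u v → u - v - (ρ i - ρ j)) (ratio-split i) (ratio-split j)))
        where
        eq : ∀ a b c d → a - b ≡ (a + c) - (b + d) - (c - d)
        eq a b c d = solve (a ∷ b ∷ c ∷ d ∷ []) ℚ-ring

      -- With α = η - ρ, the coefficient of the variation of ρ is a i - d i, which is at most h i in
      -- absolute value; since the h i sum to at most ½, the oscillation of ρ is contracted.
      term-bound : ∀ {ε M} i j k → ∣ η j - η k ∣ ≤ ε → ∣ ρ j - ρ k ∣ ≤ M →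
        ∣ d i * (α j - α k) + a i * (ρ j - ρ k) ∣ ≤ e i * (ε + M)
      term-bound {ε} {M} i j k Δη Δρ = subst (λ Δα → ∣ d i * Δα
          + a i * (ρ j - ρ k) ∣ ≤ e i * (ε + M)) (sym (α-diff j k))
        (∣∣≤ (bound Δη Δρ) (subst (_≤ e i * (ε + M)) (reflected (d i) (a i) (η j) (η k) (ρ j) (ρ k))
          (bound (subst (_≤ ε) (∣∣-sym (η j) (η k)) Δη) (subst (_≤ M) (∣∣-sym (ρ j) (ρ k)) Δρ))))
        where
        reflected : ∀ d a s t u v → d * ((t - s) - (v - u)) + a * (v - u) ≡ - (d * ((s - t) - (u - v)) + a * (u - v))
        reflected d a s t u v = solve (d ∷ a ∷ s ∷ t ∷ u ∷ v ∷ []) ℚ-ring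
        bound : ∀ {y z} → ∣ y ∣ ≤ ε → ∣ z ∣ ≤ M → d i * (y - z) + a i * z ≤ e i * (ε + M)
        bound {y} {z} ∣y∣≤ε ∣z∣≤M = ≤-trans
          (≤-by (nonneg (dom d:ρ) i ⊗ gap (∣∣-hi ∣y∣≤ε) ⊕ nonneg (dom a:α) i ⊗ ≤-trans (0≤∣p∣ y) ∣y∣≤ε
                 ⊕ nonneg (dom a:α) i ⊗ gap (∣∣-hi ∣z∣≤M) ⊕ nonneg (dom d:ρ) i ⊗ gap (∣∣-lo ∣z∣≤M))
                (eq (d i) (a i) ε M y z))
          (*-mono (nonneg (dom a:α) i ⊕ nonneg (dom d:ρ) i)
                  (subst (_≤ e i) (split i) (below (dom h:η) i))
                  (≤-trans (0≤∣p∣ y) ∣y∣≤ε ⊕ ≤-trans (0≤∣p∣ z) ∣z∣≤M) ≤-refl)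
          where
          eq : ∀ d a ε M y z → (a + d) * (ε + M) - (d * (y - z) + a * z) ≡ d * (ε - y) + a * ε + a * (M - z)
              + d * (M - - z)
          eq d a ε M y z = solve (d ∷ a ∷ ε ∷ M ∷ y ∷ z ∷ []) ℚ-ring

      -- The compared indices may depend on i: the contraction compares two late positions m - i and
      -- n - i, the recurrence compares m - i with a fixed n.
      weighted-bound : ∀ K {ε M} → 0ℚ ≤ ε → 0ℚ ≤ M → (j k : ℕ → ℕ) →
        (∀ i → i ℕ.< K → ∣ η (j i) - η (k i) ∣ ≤ ε) → (∀ i → i ℕ.< K → ∣ ρ (j i) - ρ (k i) ∣ ≤ M) →
        ∣ ∑ K (λ i → d i * (α (j i) - α (k i)) + a i * (ρ (j i) - ρ (k i))) ∣ ≤ ½ * (ε + M)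
      weighted-bound K {ε} {M} 0≤ε 0≤M j k Δη Δρ = begin
        ∣ ∑ K (λ i → d i * (α (j i) - α (k i)) + a i * (ρ (j i) - ρ (k i))) ∣   ≤⟨ ∑-∣∣ K _ ⟩
        ∑ K (λ i → ∣ d i * (α (j i) - α (k i)) + a i * (ρ (j i) - ρ (k i)) ∣)
          ≤⟨ ∑-mono K (λ i i<K → term-bound i (j i) (k i) (Δη i i<K) (Δρ i i<K)) ⟩
        ∑ K (λ i → e i * (ε + M))   ≡⟨ ∑-*ʳ K e (ε + M) ⟩
        ∑ K e * (ε + M)             ≤⟨ *-mono (∑-nonneg K catalan-nonneg) (∑-catalan-≤½ K) (0≤ε ⊕ 0≤M) ≤-refl ⟩
        ½ * (ε + M)                 ∎
        where open ≤-Reasoning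

      approx : ∀ K n → K ℕ.+ K ℕ.≤ n →
        0ℚ ≤ ρ (suc n) - ends K d a ρ α n × ρ (suc n) - ends K d a ρ α n ≤ tail K
      approx K n 2K≤n = subst (λ n → 0ℚ ≤ ρ (suc n) - ends K d a ρ α n × ρ (suc n) - ends K d a ρ α n ≤ tail K)
        n≡ (conv-ends-bound d:ρ a:α K (n ∸ (K ℕ.+ K)) {ρ (suc (K ℕ.+ (K ℕ.+ (n ∸ (K ℕ.+ K)))))} (ρ-suc
            (K ℕ.+ (K ℕ.+ (n ∸ (K ℕ.+ K))))))
        where
        n≡ : K ℕ.+ (K ℕ.+ (n ∸ (K ℕ.+ K))) ≡ n
        n≡ = trans (sym (ℕ.+-assoc K K _)) (ℕ.m+[n∸m]≡n 2K≤n)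

      late : ∀ {K N i n} → i ℕ.< K → K ℕ.+ N ℕ.≤ n → N ℕ.≤ n ∸ i
      late {K} {N} {i} {n} i<K K+N≤n = ℕ.m+n≤o⇒m≤o∸n N
        (ℕ.≤-trans (ℕ.+-monoʳ-≤ N (ℕ.<⇒≤ i<K)) (subst (ℕ._≤ n) (ℕ.+-comm K N) K+N≤n))

    -- Each late ρ exceeds its combination of earlier ratios by an amount between 0 and `tail K`. As
    -- this error is one-sided, a difference of two values costs `tail K` only once.
    osc-contract : ∀ {ε M N₁ N₂} → 0ℚ ≤ ε → 0ℚ ≤ M → Osc η ε N₁ → Osc ρ M N₂ →
      ∀ K → ∃[ N ] Osc ρ (½ * (ε + M) + tail K) N
    osc-contract {ε} {M} {N₁} {N₂} 0≤ε 0≤M η-osc ρ-osc K = suc N , osc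
      where
      -- From 2K on both ends fit, and from K + N₁ + N₂ on every position `l ∸ i` with i < K is
      -- still late for `η` and for `ρ`.
      N = (K ℕ.+ K) ℕ.+ (N₁ ℕ.+ N₂)
      ends-diff : ∀ m n → ends K d a ρ α m - ends K d a ρ α n
        ≡ ∑ K (λ i → d i * (α (m ∸ i) - α (n ∸ i)) + a i * (ρ (m ∸ i) - ρ (n ∸ i)))
      ends-diff m n = sym (eq _ (ends K d a ρ α n) (trans (sym (∑-+ K _ _))
        (∑-cong K λ i _ → join (d i) (a i) (α (m ∸ i)) (α (n ∸ i)) (ρ (m ∸ i)) (ρ (n ∸ i)))))
        where
        join : ∀ d a s t u v → d * (s - t) + a * (u - v) + (d * t + a * v) ≡ d * s + a * u
        join d a s t u v = solve (d ∷ a ∷ s ∷ t ∷ u ∷ v ∷ []) ℚ-ring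
        cancel : ∀ s t → s ≡ s + t - t
        cancel s t = solve (s ∷ t ∷ []) ℚ-ring
        eq : ∀ s t {w} → s + t ≡ w → s ≡ w - t
        eq s t refl = cancel s t
      osc : Osc ρ (½ * (ε + M) + tail K) (suc N)
      osc (suc m) (suc n) (s≤s N≤m) (s≤s N≤n) =
        ∣∣≤ (bound (ρ (suc m)) (ρ (suc n)) _ _ (approx K m 2K≤m) (approx K n 2K≤n) (∣∣-hi Δends))
            (subst (_≤ ½ * (ε + M) + tail K) (-‿swap (ρ (suc n)) (ρ (suc m)))
              (bound (ρ (suc n)) (ρ (suc m)) _ _ (approx K n 2K≤n) (approx K m 2K≤m)
                (subst (_≤ ½ * (ε + M)) (sym (-‿swap (ends K d a ρ α n) (ends K d a ρ α m))) (∣∣-lo Δends))))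
        where
        2K≤m : K ℕ.+ K ℕ.≤ m
        2K≤m = ℕ.≤-trans (ℕ.m≤m+n (K ℕ.+ K) _) N≤m
        2K≤n : K ℕ.+ K ℕ.≤ n
        2K≤n = ℕ.≤-trans (ℕ.m≤m+n (K ℕ.+ K) _) N≤n
        K≤N : K ℕ.+ (N₁ ℕ.+ N₂) ℕ.≤ N
        K≤N = ℕ.+-monoˡ-≤ (N₁ ℕ.+ N₂) (ℕ.m≤m+n K K)
        late₁ : ∀ {l i} → N ℕ.≤ l → i ℕ.< K → N₁ ℕ.≤ l ∸ i
        late₁ N≤l i<K = ℕ.≤-trans (ℕ.m≤m+n N₁ N₂) (late i<K (ℕ.≤-trans K≤N N≤l))
        late₂ : ∀ {l i} → N ℕ.≤ l → i ℕ.< K → N₂ ℕ.≤ l ∸ i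
        late₂ N≤l i<K = ℕ.≤-trans (ℕ.m≤n+m N₂ N₁) (late i<K (ℕ.≤-trans K≤N N≤l))
        Δends : ∣ ends K d a ρ α m - ends K d a ρ α n ∣ ≤ ½ * (ε + M)
        Δends = subst (λ s → ∣ s ∣ ≤ ½ * (ε + M)) (sym (ends-diff m n))
          (weighted-bound K 0≤ε 0≤M (m ∸_) (n ∸_)
            (λ i i<K → η-osc _ _ (late₁ N≤m i<K) (late₁ N≤n i<K))
            (λ i i<K → ρ-osc _ _ (late₂ N≤m i<K) (late₂ N≤n i<K)))
        bound : ∀ r s L L′ {c t} → 0ℚ ≤ r - L × r - L ≤ t → 0ℚ ≤ s - L′ × s - L′ ≤ t →
          L - L′ ≤ c → r - s ≤ c + t
        bound r s L L′ {c} {t} (_ , r-L≤t) (0≤s-L′ , _) L-L′≤c =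
          ≤-by (gap r-L≤t ⊕ 0≤s-L′ ⊕ gap L-L′≤c) (eq r s L L′ c t)
          where
          eq : ∀ r s L L′ c t → c + t - (r - s) ≡ t - (r - L) + (s - L′) + (c - (L - L′))
          eq r s L L′ c t = solve (r ∷ s ∷ L ∷ L′ ∷ c ∷ t ∷ []) ℚ-ring

    ρ-osc-powers : Cauchyℚ η → ∀ p → ∃[ N ] Osc ρ (powers p) N
    ρ-osc-powers η-cauchy zero    = 0 , λ i j _ _ → ∣∣≤ (bound i j)
      (subst (_≤ 1ℚ) (-‿swap (ρ j) (ρ i)) (bound j i))
      where
      eq : ∀ a b → 1ℚ - (a - b) ≡ 1ℚ - a + b
      eq a b = solve (a ∷ b ∷ []) ℚ-ring
      bound : ∀ i j → ρ i - ρ j ≤ 1ℚ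
      bound i j = ≤-by (gap (ratio-≤1 d:ρ i) ⊕ ratio-nonneg d:ρ j) (eq (ρ i) (ρ j))
    ρ-osc-powers η-cauchy (suc p) =
      let M = powers p
          0<M = powers-positive p
          _ , η-osc = η-cauchy ((+ 1 / 4) * M) (0<-* (positive⁻¹ (+ 1 / 4)) 0<M)
          _ , ρ-osc = ρ-osc-powers η-cauchy p
          K , tail-small = tail-vanishes ((+ 1 / 8) * M) (0<-* (positive⁻¹ (+ 1 / 8)) 0<M)
          N , osc = osc-contract (<⇒≤ (0<-* (positive⁻¹ (+ 1 / 4)) 0<M)) (<⇒≤ 0<M) η-osc ρ-osc K
      in N , osc-≤ {ρ} (≤-by (gap (tail-small K ℕ.≤-refl)) (eq M (tail K))) osc
      where
      eq : ∀ M t → (+ 3 / 4) * M - (½ * ((+ 1 / 4) * M + M) + t) ≡ (+ 1 / 8) * M - t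
      eq M t = solve (M ∷ t ∷ []) ℚ-ring

    ρ-cauchy : Cauchyℚ η → Cauchyℚ ρ
    ρ-cauchy η-cauchy ε 0<ε =
      let p , small = powers-vanish ε 0<ε
          N , osc   = ρ-osc-powers η-cauchy p
      in N , osc-≤ {ρ} small osc

    -- As α = η - ρ, this carries convergence from rank k to rank k + 1.
    α-cauchy : Cauchyℚ η → Cauchyℚ α
    α-cauchy η-cauchy ε 0<ε =
      let 0<ε/2 = 0<-* (positive⁻¹ ½) 0<ε
          N₁ , η-osc = η-cauchy (½ * ε) 0<ε/2
          N₂ , ρ-osc = ρ-cauchy η-cauchy (½ * ε) 0<ε/2
      in N₁ ℕ.+ N₂ , λ i j N≤i N≤j → subst (λ c → ∣ c ∣ ≤ ε) (sym (α-diff i j))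
           (≤-trans (∣p-q∣≤∣p∣+∣q∣ (η i - η j) (ρ i - ρ j)) (≤-trans
             (+-mono-≤ (η-osc i j (ℕ.m+n≤o⇒m≤o N₁ N≤i) (ℕ.m+n≤o⇒m≤o N₁ N≤j))
                       (ρ-osc i j (ℕ.m+n≤o⇒n≤o N₁ N≤i) (ℕ.m+n≤o⇒n≤o N₁ N≤j)))
             (≤-reflexive (halves ε))))
      where
      halves : ∀ ε → ½ * ε + ½ * ε ≡ ε
      halves ε = solve (ε ∷ []) ℚ-ring

    private
      ∑-split : ∀ n → ∑ n h ≡ ∑ n a + ∑ n d
      ∑-split n = trans (∑-cong n λ i _ → split i) (∑-+ n a d)

      -- Termwise h is at most e, and the terms of e between K and n add up to (tail K - tail n)/2.
      late-mass : ∀ {K n} → K ℕ.≤ n → ∑ n h - ∑ K h ≤ tail K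
      late-mass {K} {n} K≤n = bound (∑-incr (λ i → gap (below (dom h:η) i)) K≤n) (∑-diff K) (∑-diff n)
          (∑-catalan K) (∑-catalan n)
        where
        cancel : ∀ a b → a - b + b ≡ a
        cancel a b = solve (a ∷ b ∷ []) ℚ-ring
        ∑-diff : ∀ n → ∑ n (λ i → e i - h i) + ∑ n h ≡ ∑ n e
        ∑-diff n = trans (sym (∑-+ n (λ i → e i - h i) h)) (∑-cong n λ i _ → cancel (e i) (h i))
        eq : ∀ p q H H′ s t → ⟦ 2 ⟧ * (p + H) + s ≡ 1ℚ → ⟦ 2 ⟧ * (q + H′) + t ≡ 1ℚ →
             s - (H′ - H) ≡ (q - p) + ½ * t + ½ * s
        eq p q H H′ s t h h′ = trans (lhs p q H H′ s t)
            (trans (cong₂ (λ a b → ½ * (a - b) + (q - p) + ½ * t + ½ * s) h h′) (rhs p q s t))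
          where
          lhs : ∀ p q H H′ s t → s - (H′ - H) ≡ ½ * (⟦ 2 ⟧ * (p + H) + s - (⟦ 2 ⟧ * (q + H′) + t)) + (q - p)
              + ½ * t + ½ * s
          lhs p q H H′ s t = solve (p ∷ q ∷ H ∷ H′ ∷ s ∷ t ∷ []) ℚ-ring
          rhs : ∀ p q s t → ½ * (1ℚ - 1ℚ) + (q - p) + ½ * t + ½ * s ≡ (q - p) + ½ * t + ½ * s
          rhs p q s t = solve (p ∷ q ∷ s ∷ t ∷ []) ℚ-ring
        bound : ∀ {p q H H′ E E′} → p ≤ q → p + H ≡ E → q + H′ ≡ E′ →
          ⟦ 2 ⟧ * E + tail K ≡ 1ℚ → ⟦ 2 ⟧ * E′ + tail n ≡ 1ℚ → H′ - H ≤ tail K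
        bound {p} {q} {H} {H′} p≤q refl refl hK hn = ≤-by
          (gap p≤q ⊕ nonNegative⁻¹ ½ ⊗ tail-nonneg n ⊕ nonNegative⁻¹ ½ ⊗ tail-nonneg K)
          (eq p q H H′ (tail K) (tail n) hK hn)

    -- In the limit, q_{k+1} (2 u_{k+1} - u_k) = q_k u_{k+1} where u_k = 1 - H_k(1/4m).
    ratio-recurrence : Cauchyℚ η → ∀ ε → 0ℚ < ε → Eventually (λ n →
      ∣ α n * (mass a n + (mass a n - mass h n)) - η n * mass a n ∣ ≤ ε)
    ratio-recurrence η-cauchy ε 0<ε = suc N , bound
      where
      0<ε/2 : 0ℚ < ½ * ε
      0<ε/2 = 0<-* (positive⁻¹ ½) 0<ε
      N₁ = proj₁ (η-cauchy (½ * ε) 0<ε/2)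
      N₂ = proj₁ (ρ-cauchy η-cauchy (½ * ε) 0<ε/2)
      K = proj₁ (tail-vanishes (½ * ε) 0<ε/2)
      t≤ε/2 : tail K ≤ ½ * ε
      t≤ε/2 = proj₂ (tail-vanishes (½ * ε) 0<ε/2) K ℕ.≤-refl
      N = (K ℕ.+ K) ℕ.+ (N₁ ℕ.+ N₂)
      bound : ∀ n → suc N ℕ.≤ n → ∣ α n * (mass a n + (mass a n - mass h n)) - η n * mass a n ∣ ≤ ε
      bound n@(suc m) (s≤s N≤m) = subst (λ z → ∣ z ∣ ≤ ε) (sym value≡)
        -- `L - ρ n` lies in [-tail K, 0] and `extra` in [0, tail K]. Having opposite signs they
        -- cost one `tail K` together, and `Σ` takes the other half of ε.
        (∣∣≤ (upper L (ρ n) Σ extra (tail K) (∣∣-lo Δ) (proj₁ near) extra≤t t≤ε/2)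
            (lower L (ρ n) Σ extra (tail K) (∣∣-hi Δ) (proj₂ near) 0≤extra t≤ε/2))
        where
        2K≤m : K ℕ.+ K ℕ.≤ m
        2K≤m = ℕ.≤-trans (ℕ.m≤m+n (K ℕ.+ K) _) N≤m
        K+N≤m : K ℕ.+ (N₁ ℕ.+ N₂) ℕ.≤ m
        K+N≤m = ℕ.≤-trans (ℕ.+-monoˡ-≤ (N₁ ℕ.+ N₂) (ℕ.m≤m+n K K)) N≤m
        K≤n : K ℕ.≤ n
        K≤n = ℕ.m≤n⇒m≤1+n (ℕ.m+n≤o⇒m≤o K K+N≤m)
        both : ∀ i → i ℕ.< K → (N₁ ℕ.+ N₂) ℕ.≤ m ∸ i
        both i i<K = late i<K K+N≤m
        N₁+N₂≤n : N₁ ℕ.+ N₂ ℕ.≤ n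
        N₁+N₂≤n = ℕ.m≤n⇒m≤1+n (ℕ.m+n≤o⇒n≤o K K+N≤m)
        L = ends K d a ρ α m
        near = approx K m 2K≤m
        Σ = ∑ K (λ i → d i * (α (m ∸ i) - α n) + a i * (ρ (m ∸ i) - ρ n))
        extra = (∑ n d - ∑ K d) * α n + (∑ n a - ∑ K a) * ρ n
        Δ : ∣ Σ ∣ ≤ ½ * (½ * ε + ½ * ε)
        Δ = weighted-bound K (<⇒≤ 0<ε/2) (<⇒≤ 0<ε/2) (m ∸_) (λ _ → n)
          (λ i i<K → proj₂ (η-cauchy (½ * ε) 0<ε/2) _ _
            (ℕ.m+n≤o⇒m≤o N₁ (both i i<K)) (ℕ.m+n≤o⇒m≤o N₁ N₁+N₂≤n))
          (λ i i<K → proj₂ (ρ-cauchy η-cauchy (½ * ε) 0<ε/2) _ _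
            (ℕ.m+n≤o⇒n≤o N₁ (both i i<K)) (ℕ.m+n≤o⇒n≤o N₁ N₁+N₂≤n))
        Σ≡ : Σ + (∑ K d * α n + ∑ K a * ρ n) ≡ L
        Σ≡ = begin
          Σ + (∑ K d * α n + ∑ K a * ρ n)
            ≡⟨ cong (_+_ Σ) (cong₂ _+_ (∑-*ʳ K d (α n)) (∑-*ʳ K a (ρ n))) ⟨
          Σ + (∑ K (λ i → d i * α n) + ∑ K (λ i → a i * ρ n))
            ≡⟨ cong (_+_ Σ) (∑-+ K (λ i → d i * α n) (λ i → a i * ρ n)) ⟨
          Σ + ∑ K (λ i → d i * α n + a i * ρ n)
            ≡⟨ ∑-+ K (λ i → d i * (α (m ∸ i) - α n) + a i * (ρ (m ∸ i) - ρ n)) (λ i → d i * α n + a i * ρ n) ⟨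
          ∑ K (λ i → d i * (α (m ∸ i) - α n) + a i * (ρ (m ∸ i) - ρ n) + (d i * α n + a i * ρ n))
            ≡⟨ ∑-cong K (λ i _ → join (d i) (a i) (α (m ∸ i)) (α n) (ρ (m ∸ i)) (ρ n)) ⟩
          L ∎
          where
          open ≡-Reasoning
          join : ∀ d a s t u v → d * (s - t) + a * (u - v) + (d * t + a * v) ≡ d * s + a * u
          join d a s t u v = solve (d ∷ a ∷ s ∷ t ∷ u ∷ v ∷ []) ℚ-ring
        0≤Δd : 0ℚ ≤ ∑ n d - ∑ K d
        0≤Δd = gap (∑-incr (nonneg (dom d:ρ)) K≤n)
        0≤Δa : 0ℚ ≤ ∑ n a - ∑ K a
        0≤Δa = gap (∑-incr (nonneg (dom a:α)) K≤n)
        0≤extra : 0ℚ ≤ extra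
        0≤extra = 0≤Δd ⊗ ratio-nonneg a:α n ⊕ 0≤Δa ⊗ ratio-nonneg d:ρ n
        extra≤t : extra ≤ tail K
        extra≤t = ≤-trans (≤-by (0≤Δd ⊗ gap (ratio-≤1 a:α n) ⊕ 0≤Δa ⊗ gap (ratio-≤1 d:ρ n))
            (eq (∑ n h) (∑ K h) (∑ n a) (∑ K a) (∑ n d) (∑ K d) (α n) (ρ n) (∑-split n) (∑-split K)))
          (late-mass K≤n)
          where
          eq : ∀ H H′ A A′ D D′ α ρ → H ≡ A + D → H′ ≡ A′ + D′ →
            H - H′ - ((D - D′) * α + (A - A′) * ρ) ≡ (D - D′) * (1ℚ - α) + (A - A′) * (1ℚ - ρ)
          eq _ _ A A′ D D′ α ρ refl refl = solve (A ∷ A′ ∷ D ∷ D′ ∷ α ∷ ρ ∷ []) ℚ-ring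
        -- With D and A the partial sums of d and a, the expression is α D + ρ A - ρ. It is small
        -- because α D + ρ A is the limiting ratio of the product G_k H_{k+1}, which is that of G_k.
        value≡ : α n * (mass a n + (mass a n - mass h n)) - η n * mass a n ≡ (L - ρ n) - Σ + extra
        value≡ = eq (∑ n h) (∑ n a) (∑ K a) (∑ n d) (∑ K d) (η n) (α n) (ρ n) L Σ (∑-split n) (ratio-split n) Σ≡
          where
          eq : ∀ H A A′ D D′ η α ρ L Σ → H ≡ A + D → η ≡ α + ρ → Σ + (D′ * α + A′ * ρ) ≡ L →
            α * (1ℚ - A + (1ℚ - A - (1ℚ - H))) - η * (1ℚ - A) ≡ (L - ρ) - Σ + ((D - D′) * α + (A - A′) * ρ)
          eq _ A A′ D D′ _ α ρ _ Σ refl refl refl = solve (A ∷ A′ ∷ D ∷ D′ ∷ α ∷ ρ ∷ Σ ∷ []) ℚ-ring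
        upper : ∀ L r Σ x t → - Σ ≤ ½ * (½ * ε + ½ * ε) → 0ℚ ≤ r - L → x ≤ t → t ≤ ½ * ε → (L - r) - Σ + x ≤ ε
        upper L r Σ x t h₁ h₂ h₃ h₄ = ≤-by (gap h₁ ⊕ h₂ ⊕ gap h₃ ⊕ gap h₄) (eq L r Σ x t ε)
          where
          eq : ∀ L r Σ x t ε → ε - ((L - r) - Σ + x) ≡ ½ * (½ * ε + ½ * ε) - - Σ + (r - L) + (t - x) + (½ * ε - t)
          eq L r Σ x t ε = solve (L ∷ r ∷ Σ ∷ x ∷ t ∷ ε ∷ []) ℚ-ring
        lower : ∀ L r Σ x t → Σ ≤ ½ * (½ * ε + ½ * ε) → r - L ≤ t → 0ℚ ≤ x → t ≤ ½ * ε → - ((L - r) - Σ + x) ≤ ε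
        lower L r Σ x t h₁ h₂ h₃ h₄ = ≤-by (gap h₁ ⊕ gap h₂ ⊕ h₃ ⊕ gap h₄) (eq L r Σ x t ε)
          where
          eq : ∀ L r Σ x t ε → ε - (- ((L - r) - Σ + x)) ≡ ½ * (½ * ε + ½ * ε) - Σ + (t - (r - L)) + x + (½ * ε - t)
          eq L r Σ x t ε = solve (L ∷ r ∷ Σ ∷ x ∷ t ∷ ε ∷ []) ℚ-ring

    -- In the limit this is G_k = x / (1 - H_{k+1}) at the singularity.
    mass-recurrence : ∀ n → 1 ℕ.≤ n → ∣ (mass a n - mass h n) * mass a n - x ∣ ≤ tail n
    mass-recurrence n@(suc m) _ = subst (λ z → ∣ z ∣ ≤ tail n) (sym value≡)
      (∣∣≤ (≤-trans (≤-by (proj₁ corner-bound ⊕ nonneg (dom d:ρ) n) (negated (corner d a n) (d n))) (tail-nonneg n))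
           (≤-trans (subst₂ _≤_ (double- (corner d a n + d n)) (corner-e)
               (+-mono-≤ (proj₂ corner-bound) (below (dom d:ρ) n)))
             t²/4≤t))
      where
      corner-bound = corner-≼ n (dom d:ρ) (dom a:α)
      negated : ∀ c d → 0ℚ - - (c + d) ≡ c + d
      negated c d = solve (c ∷ d ∷ []) ℚ-ring
      double- : ∀ c → c ≡ - - c
      double- c = solve (c ∷ []) ℚ-ring
      ∑d : ∑ (suc n) d ≡ x + ∑ n (conv d a)
      ∑d = cong₂ _+_ d-zero (∑-cong n λ i _ → d-suc i)
      -- `mass a n - mass h n` is the partial sum of d. Its product with that of a exceeds the
      -- partial sum of `conv d a`, a shift of d, by exactly the corner.
      value≡ : (mass a n - mass h n) * mass a n - x ≡ - (corner d a n + d n)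
      value≡ = eq (∑ n h) (∑ n a) (∑ n d) (d n) (∑ n (conv d a)) (∑-split n) (trans (sym ∑d) (∑-snoc n d))
        where
        move : ∀ A D d C x → x ≡ D + d - C → (1ℚ - A - (1ℚ - (A + D))) * (1ℚ - A) - x ≡ - (D * A - C + d)
        move A D d C _ refl = solve (A ∷ D ∷ d ∷ C ∷ []) ℚ-ring
        cancel : ∀ x C → x ≡ x + C - C
        cancel x C = solve (x ∷ C ∷ []) ℚ-ring
        eq : ∀ H A D d C → H ≡ A + D → x + C ≡ D + d → (1ℚ - A - (1ℚ - H)) * (1ℚ - A) - x ≡ - (D * A - C + d)
        eq _ A D d C refl h = move A D d C x (trans (cancel x C) (cong (_- C) h))
      -- With S the partial sum of `e`, that of `conv e e` is S + e(n) - ¼, so the left side becomes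
      -- (½ - S)².
      corner-e : corner e e n + e n ≡ (+ 1 / 4) * (tail n * tail n)
      corner-e = eq (∑ n e) (e n) (∑ n (conv e e)) (tail n) (∑-catalan n)
          (trans (cong (_+_ (+ 1 / 4)) (∑-cong n λ i _ → sym (catalan-conv i))) (∑-snoc n e))
        where
        eq : ∀ S a C t → ⟦ 2 ⟧ * S + t ≡ 1ℚ → (+ 1 / 4) + C ≡ S + a → S * S - C + a ≡ (+ 1 / 4) * (t * t)
        eq S a C t h h′ = trans (lhs S a C) (trans (cong (λ z → S * S - (z - (+ 1 / 4)) + a) h′)
            (trans (mid S a) (trans (cong (λ z → (+ 1 / 4) * ((z - ⟦ 2 ⟧ * S) * (z - ⟦ 2 ⟧ * S))) (sym h)) (rhs S t))))
          where
          lhs : ∀ S a C → S * S - C + a ≡ S * S - ((+ 1 / 4) + C - (+ 1 / 4)) + a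
          lhs S a C = solve (S ∷ a ∷ C ∷ []) ℚ-ring
          mid : ∀ S a → S * S - (S + a - (+ 1 / 4)) + a ≡ (+ 1 / 4) * ((1ℚ - ⟦ 2 ⟧ * S) * (1ℚ - ⟦ 2 ⟧ * S))
          mid S a = solve (S ∷ a ∷ []) ℚ-ring
          rhs : ∀ S t → (+ 1 / 4) * ((⟦ 2 ⟧ * S + t - ⟦ 2 ⟧ * S) * (⟦ 2 ⟧ * S + t - ⟦ 2 ⟧ * S)) ≡ (+ 1 / 4) * (t * t)
          rhs S t = solve (S ∷ t ∷ []) ℚ-ring
      t²/4≤t : (+ 1 / 4) * (tail n * tail n) ≤ tail n
      t²/4≤t = ≤-by (nonNegative⁻¹ (+ 1 / 4) ⊗ tail-nonneg n ⊗ gap (tail-antitone {0} {n} z≤n)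
          ⊕ nonNegative⁻¹ (+ 3 / 4) ⊗ tail-nonneg n)
        (eq (tail n))
        where
        eq : ∀ t → t - (+ 1 / 4) * (t * t) ≡ (+ 1 / 4) * t * (1ℚ - t) + (+ 3 / 4) * t
        eq t = solve (t ∷ []) ℚ-ring

  -- The recursion over the ranks

  0≤½ : 0ℚ ≤ ½
  0≤½ = nonNegative⁻¹ ½

  0≤1 : 0ℚ ≤ 1ℚ
  0≤1 = nonNegative⁻¹ 1ℚ

  -- One passage from rank k to k + 1 at a fixed n. The tolerance x² is chosen because up to 1/(4x)
  -- such steps are added up, which leaves an error of order x.
  record Step (x u u′ q q′ : ℚ) : Set where
    field
      u≤u′   : u ≤ u′
      ½≤u    : ½ ≤ u
      u′≤1   : u′ ≤ 1ℚ
      0≤q′   : 0ℚ ≤ q′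
      q′≤1   : q′ ≤ 1ℚ
      u-step : ∣ (u′ - u) * u′ - x ∣ ≤ x * x
      q-step : ∣ q′ * (u′ + (u′ - u)) - q * u′ ∣ ≤ x * x

  module _ {x u u′ q q′} (0≤x : 0ℚ ≤ x) (x≤1 : x ≤ 1ℚ) (s : Step x u u′ q q′) where
    open Step s

    private
      D = u′ - u
      θ = q′ * (u′ + D) - q * u′

      0≤D : 0ℚ ≤ D
      0≤D = gap u≤u′

      ½≤u′ : ½ ≤ u′
      ½≤u′ = ≤-trans ½≤u u≤u′

      0<u′ : 0ℚ < u′
      0<u′ = <-≤-trans (positive⁻¹ ½) ½≤u′

      0≤x² : 0ℚ ≤ x * x
      0≤x² = 0≤x ⊗ 0≤x

      D≤4x : D ≤ ⟦ 4 ⟧ * x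
      D≤4x = ≤-by (0≤⟦ 2 ⟧ ⊗ gap (∣∣-hi u-step) ⊕ 0≤⟦ 2 ⟧ ⊗ (0≤x ⊗ gap x≤1) ⊕ 0≤⟦ 2 ⟧ ⊗ (0≤D ⊗ gap ½≤u′)) (eq x u′ D)
        where
        eq : ∀ x v D → ⟦ 4 ⟧ * x - D ≡ ⟦ 2 ⟧ * (x * x - (D * v - x)) + ⟦ 2 ⟧ * (x * (1ℚ - x)) + ⟦ 2 ⟧ * (D * (v - ½))
        eq x v D = solve (x ∷ v ∷ D ∷ []) ℚ-ring

      D²≤16x² : D * D ≤ ⟦ 16 ⟧ * (x * x)
      D²≤16x² = subst (D * D ≤_) (eq x) (*-mono 0≤D D≤4x 0≤D D≤4x)
        where
        eq : ∀ x → ⟦ 4 ⟧ * x * (⟦ 4 ⟧ * x) ≡ ⟦ 16 ⟧ * (x * x)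
        eq x = solve (x ∷ []) ℚ-ring

    -- With D = u′ - u, the increment u′² - u² is 2Du′ - D². The first term is within 2x² of 2x, and
    -- D is at most 4x since u′ is at least ½.
    u²-step : ∣ u′ * u′ - u * u - ⟦ 2 ⟧ * x ∣ ≤ ⟦ 18 ⟧ * (x * x)
    u²-step = ∣∣≤
      (≤-by (0≤⟦ 2 ⟧ ⊗ gap (∣∣-hi u-step) ⊕ 0≤D ⊗ 0≤D ⊕ 0≤⟦ 16 ⟧ ⊗ 0≤x²) (hi x u u′))
      (≤-by (0≤⟦ 2 ⟧ ⊗ gap (∣∣-lo u-step) ⊕ gap D²≤16x²) (lo x u u′))
      where
      hi : ∀ x u v → ⟦ 18 ⟧ * (x * x) - (v * v - u * u - ⟦ 2 ⟧ * x)
        ≡ ⟦ 2 ⟧ * (x * x - ((v - u) * v - x)) + (v - u) * (v - u) + ⟦ 16 ⟧ * (x * x)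
      hi x u v = solve (x ∷ u ∷ v ∷ []) ℚ-ring
      lo : ∀ x u v → ⟦ 18 ⟧ * (x * x) - - (v * v - u * u - ⟦ 2 ⟧ * x)
        ≡ ⟦ 2 ⟧ * (x * x - - ((v - u) * v - x)) + (⟦ 16 ⟧ * (x * x) - (v - u) * (v - u))
      lo x u v = solve (x ∷ u ∷ v ∷ []) ℚ-ring

    -- The exact increment of q u in the limit is q′ D² / u′, of second order in x.
    qu-step : ∣ q′ * u′ - q * u ∣ ≤ ⟦ 34 ⟧ * (x * x)
    qu-step = ∣∣≤
      -- With θ the error of `q-step`, (q′u′ - qu) u′ = q′D² + uθ. This is at most 17x² in absolute
      -- value, and dividing by u′ ≥ ½ gives 34x².
      (≤-cancel 0<u′ (≤-by
        (gap D²≤16x² ⊕ gap q′≤1 ⊗ (0≤D ⊗ 0≤D) ⊕ 0≤u ⊗ gap (∣∣-hi q-step) ⊕ gap u≤1 ⊗ 0≤x² ⊕ 0≤⟦ 34 ⟧ ⊗ 0≤x² ⊗ gap ½≤u′)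
        (hi x u u′ q q′)))
      (≤-cancel 0<u′ (≤-by
        (0≤q′ ⊗ (0≤D ⊗ 0≤D) ⊕ 0≤u ⊗ gap (∣∣-lo q-step) ⊕ gap u≤1 ⊗ 0≤x² ⊕ 0≤⟦ 16 ⟧ ⊗ 0≤x² ⊕ 0≤⟦ 34 ⟧ ⊗ 0≤x² ⊗ gap ½≤u′)
        (lo x u u′ q q′)))
      where
      0≤u : 0ℚ ≤ u
      0≤u = ≤-trans 0≤½ ½≤u
      u≤1 : u ≤ 1ℚ
      u≤1 = ≤-trans u≤u′ u′≤1
      hi : ∀ x u v q r → ⟦ 34 ⟧ * (x * x) * v - (r * v - q * u) * v
        ≡ (⟦ 16 ⟧ * (x * x) - (v - u) * (v - u)) + (1ℚ - r) * ((v - u) * (v - u))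
        + u * (x * x - (r * (v + (v - u)) - q * v)) + (1ℚ - u) * (x * x) + ⟦ 34 ⟧ * (x * x) * (v - ½)
      hi x u v q r = solve (x ∷ u ∷ v ∷ q ∷ r ∷ []) ℚ-ring
      lo : ∀ x u v q r → ⟦ 34 ⟧ * (x * x) * v - - (r * v - q * u) * v
        ≡ r * ((v - u) * (v - u)) + u * (x * x - - (r * (v + (v - u)) - q * v))
        + (1ℚ - u) * (x * x) + ⟦ 16 ⟧ * (x * x) + ⟦ 34 ⟧ * (x * x) * (v - ½)
      lo x u v q r = solve (x ∷ u ∷ v ∷ q ∷ r ∷ []) ℚ-ring

    -- (q - q′) u′ equals q′D minus the error of `q-step`, hence is at most 4x + x² ≤ 5x; then u′ ≥
    -- ½ doubles the bound.
    q-drop : q - q′ ≤ ⟦ 10 ⟧ * x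
    q-drop = ≤-cancel 0<u′ (≤-by
      (gap D≤4x ⊕ gap q′≤1 ⊗ 0≤D ⊕ gap (∣∣-lo q-step) ⊕ 0≤x ⊗ gap x≤1 ⊕ 0≤⟦ 10 ⟧ ⊗ 0≤x ⊗ gap ½≤u′)
      (eq x u u′ q q′))
      where
      eq : ∀ x u v q r → ⟦ 10 ⟧ * x * v - (q - r) * v
        ≡ (⟦ 4 ⟧ * x - (v - u)) + (1ℚ - r) * (v - u) + (x * x - - (r * (v + (v - u)) - q * v)) + x * (1ℚ - x)
            + ⟦ 10 ⟧ * x * (v - ½)
      eq x u v q r = solve (x ∷ u ∷ v ∷ q ∷ r ∷ []) ℚ-ring

  telescope : ∀ (f : ℕ → ℚ) {c b b₀ v} K → ∣ f 0 - v ∣ ≤ b₀ →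
    (∀ k → k ℕ.< K → ∣ f (suc k) - f k - c ∣ ≤ b) →
    ∀ k → k ℕ.≤ K → ∣ f k - v - ⟦ k ⟧ * c ∣ ≤ ⟦ k ⟧ * b + b₀
  telescope f {c} {b} {b₀} {v} K base step zero    _     =
    subst₂ (λ y z → ∣ y ∣ ≤ z) (eq (f 0) v c) (eq′ b b₀) base
    where
    eq : ∀ a v c → a - v ≡ a - v - 0ℚ * c
    eq a v c = solve (a ∷ v ∷ c ∷ []) ℚ-ring
    eq′ : ∀ b b₀ → b₀ ≡ 0ℚ * b + b₀
    eq′ b b₀ = solve (b ∷ b₀ ∷ []) ℚ-ring
  telescope f {c} {b} {b₀} {v} K base step (suc k) 1+k≤K =
    subst₂ _≤_ (trans (cong ∣_∣ (eq (f (suc k)) (f k) v c ⟦ k ⟧))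
        (cong (λ z → ∣ f (suc k) - v - z * c ∣) (sym (⟦⟧-suc k))))
               (trans (eq′ b b₀ ⟦ k ⟧) (cong (λ z → z * b + b₀) (sym (⟦⟧-suc k))))
      (≤-trans (∣p+q∣≤∣p∣+∣q∣ (f (suc k) - f k - c) (f k - v - ⟦ k ⟧ * c))
        (+-mono-≤ (step k 1+k≤K) (telescope f K base step k (ℕ.<⇒≤ 1+k≤K))))
    where
    eq : ∀ a a′ v c k → (a - a′ - c) + (a′ - v - k * c) ≡ a - v - (1ℚ + k) * c
    eq a a′ v c k = solve (a ∷ a′ ∷ v ∷ c ∷ k ∷ []) ℚ-ring
    eq′ : ∀ b b₀ k → b + (k * b + b₀) ≡ (1ℚ + k) * b + b₀
    eq′ b b₀ k = solve (b ∷ b₀ ∷ k ∷ []) ℚ-ring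

  module _ {x} (0≤x : 0ℚ ≤ x) (x≤¼ : x ≤ + 1 / 4) (u q : ℕ → ℚ) (K : ℕ) (Kx≤¼ : ⟦ K ⟧ * x ≤ + 1 / 4)
           (q0≡1 : q 0 ≡ 1ℚ) (½≤u0 : ½ ≤ u 0) (u0≤1 : u 0 ≤ 1ℚ) (u0≤ : u 0 - ½ ≤ ½ * (x * x))
           (steps : ∀ k → k ℕ.< K → Step x (u k) (u (suc k)) (q k) (q (suc k))) where

    private
      x≤1 : x ≤ 1ℚ
      x≤1 = ≤-by (gap x≤¼ ⊕ nonNegative⁻¹ (+ 3 / 4)) (eq x)
        where
        eq : ∀ x → 1ℚ - x ≡ + 1 / 4 - x + + 3 / 4
        eq x = solve (x ∷ []) ℚ-ring

      0≤x² : 0ℚ ≤ x * x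
      0≤x² = 0≤x ⊗ 0≤x

      u0-base : ∣ u 0 * u 0 - + 1 / 4 ∣ ≤ x * x
      u0-base = ∣∣≤
        (≤-by (0≤⟦ 2 ⟧ ⊗ gap u0≤ ⊕ gap ½≤u0 ⊗ (gap u0≤1 ⊕ 0≤½)) (hi x (u 0)))
        (≤-by (0≤x² ⊕ gap ½≤u0 ⊗ (gap ½≤u0 ⊕ 0≤1)) (lo x (u 0)))
        where
        hi : ∀ x u → x * x - (u * u - + 1 / 4) ≡ ⟦ 2 ⟧ * (½ * (x * x) - (u - ½)) + (u - ½) * (1ℚ - u + ½)
        hi x u = solve (x ∷ u ∷ []) ℚ-ring
        lo : ∀ x u → x * x - - (u * u - + 1 / 4) ≡ x * x + (u - ½) * (u - ½ + 1ℚ)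
        lo x u = solve (x ∷ u ∷ []) ℚ-ring

      qu0-base : ∣ q 0 * u 0 - ½ ∣ ≤ ½ * (x * x)
      qu0-base = subst (λ z → ∣ z - ½ ∣ ≤ ½ * (x * x)) (sym (trans (cong (_* u 0) q0≡1) (*-identityˡ (u 0))))
        (∣∣≤ u0≤ (≤-by (0≤½ ⊗ 0≤x² ⊕ gap ½≤u0) (eq x (u 0))))
        where
        eq : ∀ x u → ½ * (x * x) - - (u - ½) ≡ ½ * (x * x) + (u - ½)
        eq x u = solve (x ∷ u ∷ []) ℚ-ring

      kx≤¼ : ∀ k → k ℕ.≤ K → ⟦ k ⟧ * x ≤ + 1 / 4
      kx≤¼ k k≤K = ≤-trans (*-mono 0≤⟦ k ⟧ (⟦⟧-mono k≤K) 0≤x ≤-refl) Kx≤¼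

      u²-estimate : ∀ k → k ℕ.≤ K → ∣ u k * u k - + 1 / 4 - ⟦ k ⟧ * (⟦ 2 ⟧ * x) ∣ ≤ ⟦ k ⟧ * (⟦ 18 ⟧ * (x * x)) + x * x
      u²-estimate = telescope (λ k → u k * u k) {v = + 1 / 4} K u0-base (λ k k<K → u²-step 0≤x x≤1 (steps k k<K))

      qu-estimate : ∀ k → k ℕ.≤ K → ∣ q k * u k - ½ - ⟦ k ⟧ * 0ℚ ∣ ≤ ⟦ k ⟧ * (⟦ 34 ⟧ * (x * x)) + ½ * (x * x)
      qu-estimate = telescope (λ k → q k * u k) {v = ½} K qu0-base (λ k k<K →
        subst (λ z → ∣ z ∣ ≤ ⟦ 34 ⟧ * (x * x)) (sym (+-identityʳ _)) (qu-step 0≤x x≤1 (steps k k<K)))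

      q-bounds : ∀ k → k ℕ.≤ K → 0ℚ ≤ q k × q k ≤ 1ℚ
      q-bounds zero    _     = subst (λ z → 0ℚ ≤ z × z ≤ 1ℚ) (sym q0≡1) (0≤1 , ≤-refl)
      q-bounds (suc k) 1+k≤K = Step.0≤q′ (steps k 1+k≤K) , Step.q′≤1 (steps k 1+k≤K)

      u-bounds : ∀ k → k ℕ.≤ K → ½ ≤ u k × u k ≤ 1ℚ
      u-bounds zero    _     = ½≤u0 , u0≤1
      u-bounds (suc k) 1+k≤K = ≤-trans (Step.½≤u (steps k 1+k≤K))
          (Step.u≤u′ (steps k 1+k≤K)) , Step.u′≤1 (steps k 1+k≤K)

    -- Because Kx is at most ¼, the telescoped errors are 9x for qu and 5x for u². The factorisation
    -- 4(qu)² - 1 = 2(qu - ½)(2qu + 1) contributes at most 54x, and 4q² times the error of u² at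
    -- most 20x.
    q²-estimate : ∀ k → k ℕ.≤ K → ∣ q k * q k * (1ℚ + ⟦ 8 ⟧ * (⟦ k ⟧ * x)) - 1ℚ ∣ ≤ ⟦ 74 ⟧ * x
    q²-estimate k k≤K = ∣∣≤
      (upper (q k) (u k) ⟦ k ⟧ (∣∣-hi z-est) (∣∣-lo v-est) (kx≤¼ k k≤K) (q-bounds k k≤K) (u-bounds k k≤K))
      (lower (q k) (u k) ⟦ k ⟧ (∣∣-lo z-est) (∣∣-hi v-est) (kx≤¼ k k≤K) (q-bounds k k≤K) (u-bounds k k≤K))
      where
      z-est = qu-estimate k k≤K
      v-est = u²-estimate k k≤K
      upper : ∀ q u k → q * u - ½ - k * 0ℚ ≤ k * (⟦ 34 ⟧ * (x * x)) + ½ * (x * x) →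
        - (u * u - + 1 / 4 - k * (⟦ 2 ⟧ * x)) ≤ k * (⟦ 18 ⟧ * (x * x)) + x * x →
        k * x ≤ + 1 / 4 → 0ℚ ≤ q × q ≤ 1ℚ → ½ ≤ u × u ≤ 1ℚ →
        q * q * (1ℚ + ⟦ 8 ⟧ * (k * x)) - 1ℚ ≤ ⟦ 74 ⟧ * x
      upper q u k h₁ h₂ h₃ (0≤q , q≤1) (½≤u , u≤1) = ≤-by
        (0≤⟦ 2 ⟧ ⊗ gap z≤ ⊗ (0≤⟦ 2 ⟧ ⊗ 0≤qu ⊕ 0≤1) ⊕ 0≤⟦ 36 ⟧ ⊗ 0≤x ⊗ gap qu≤1
          ⊕ 0≤⟦ 4 ⟧ ⊗ (0≤q ⊗ 0≤q) ⊗ gap v≤ ⊕ 0≤⟦ 20 ⟧ ⊗ 0≤x ⊗ (gap q≤1 ⊗ (0≤1 ⊕ 0≤q)))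
        (eq q u k x)
        where
        0≤qu : 0ℚ ≤ q * u
        0≤qu = 0≤q ⊗ ≤-trans 0≤½ ½≤u
        qu≤1 : q * u ≤ 1ℚ
        qu≤1 = *-mono 0≤q q≤1 (≤-trans 0≤½ ½≤u) u≤1
        z≤ : q * u - ½ ≤ ⟦ 9 ⟧ * x
        z≤ = ≤-by (gap h₁ ⊕ 0≤⟦ 34 ⟧ ⊗ 0≤x ⊗ gap h₃ ⊕ 0≤½ ⊗ 0≤x ⊗ gap x≤1) (eq q u k x)
          where
          eq : ∀ q u k x → ⟦ 9 ⟧ * x - (q * u - ½) ≡ k * (⟦ 34 ⟧ * (x * x)) + ½ * (x * x) - (q * u - ½ - k * 0ℚ)
            + ⟦ 34 ⟧ * x * (+ 1 / 4 - k * x) + ½ * x * (1ℚ - x)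
          eq q u k x = solve (q ∷ u ∷ k ∷ x ∷ []) ℚ-ring
        v≤ : - (u * u - + 1 / 4 - k * (⟦ 2 ⟧ * x)) ≤ ⟦ 5 ⟧ * x
        v≤ = ≤-by (gap h₂ ⊕ 0≤⟦ 18 ⟧ ⊗ 0≤x ⊗ gap h₃ ⊕ 0≤x ⊗ (gap x≤¼ ⊕ nonNegative⁻¹ (+ 1 / 4))) (eq u k x)
          where
          eq : ∀ u k x → ⟦ 5 ⟧ * x - - (u * u - + 1 / 4 - k * (⟦ 2 ⟧ * x))
            ≡ k * (⟦ 18 ⟧ * (x * x)) + x * x - - (u * u - + 1 / 4 - k * (⟦ 2 ⟧ * x))
            + ⟦ 18 ⟧ * x * (+ 1 / 4 - k * x) + x * (+ 1 / 4 - x + + 1 / 4)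
          eq u k x = solve (u ∷ k ∷ x ∷ []) ℚ-ring
        eq : ∀ q u k x → ⟦ 74 ⟧ * x - (q * q * (1ℚ + ⟦ 8 ⟧ * (k * x)) - 1ℚ) ≡
          ⟦ 2 ⟧ * (⟦ 9 ⟧ * x - (q * u - ½)) * (⟦ 2 ⟧ * (q * u) + 1ℚ) + ⟦ 36 ⟧ * x * (1ℚ - q * u)
          + ⟦ 4 ⟧ * (q * q) * (⟦ 5 ⟧ * x - - (u * u - + 1 / 4 - k * (⟦ 2 ⟧ * x))) + ⟦ 20 ⟧ * x * ((1ℚ - q) * (1ℚ + q))
        eq q u k x = solve (q ∷ u ∷ k ∷ x ∷ []) ℚ-ring
      lower : ∀ q u k → - (q * u - ½ - k * 0ℚ) ≤ k * (⟦ 34 ⟧ * (x * x)) + ½ * (x * x) →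
        u * u - + 1 / 4 - k * (⟦ 2 ⟧ * x) ≤ k * (⟦ 18 ⟧ * (x * x)) + x * x →
        k * x ≤ + 1 / 4 → 0ℚ ≤ q × q ≤ 1ℚ → ½ ≤ u × u ≤ 1ℚ →
        - (q * q * (1ℚ + ⟦ 8 ⟧ * (k * x)) - 1ℚ) ≤ ⟦ 74 ⟧ * x
      lower q u k h₁ h₂ h₃ (0≤q , q≤1) (½≤u , u≤1) = ≤-by
        (0≤⟦ 2 ⟧ ⊗ gap z≤ ⊗ (0≤⟦ 2 ⟧ ⊗ 0≤qu ⊕ 0≤1) ⊕ 0≤⟦ 36 ⟧ ⊗ 0≤x ⊗ gap qu≤1
          ⊕ 0≤⟦ 4 ⟧ ⊗ (0≤q ⊗ 0≤q) ⊗ gap v≤ ⊕ 0≤⟦ 20 ⟧ ⊗ 0≤x ⊗ (gap q≤1 ⊗ (0≤1 ⊕ 0≤q)))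
        (eq q u k x)
        where
        0≤qu : 0ℚ ≤ q * u
        0≤qu = 0≤q ⊗ ≤-trans 0≤½ ½≤u
        qu≤1 : q * u ≤ 1ℚ
        qu≤1 = *-mono 0≤q q≤1 (≤-trans 0≤½ ½≤u) u≤1
        z≤ : - (q * u - ½) ≤ ⟦ 9 ⟧ * x
        z≤ = ≤-by (gap h₁ ⊕ 0≤⟦ 34 ⟧ ⊗ 0≤x ⊗ gap h₃ ⊕ 0≤½ ⊗ 0≤x ⊗ gap x≤1) (eq q u k x)
          where
          eq : ∀ q u k x → ⟦ 9 ⟧ * x - - (q * u - ½) ≡ k * (⟦ 34 ⟧ * (x * x)) + ½ * (x * x) - - (q * u - ½ - k * 0ℚ)
            + ⟦ 34 ⟧ * x * (+ 1 / 4 - k * x) + ½ * x * (1ℚ - x)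
          eq q u k x = solve (q ∷ u ∷ k ∷ x ∷ []) ℚ-ring
        v≤ : u * u - + 1 / 4 - k * (⟦ 2 ⟧ * x) ≤ ⟦ 5 ⟧ * x
        v≤ = ≤-by (gap h₂ ⊕ 0≤⟦ 18 ⟧ ⊗ 0≤x ⊗ gap h₃ ⊕ 0≤x ⊗ (gap x≤¼ ⊕ nonNegative⁻¹ (+ 1 / 4))) (eq u k x)
          where
          eq : ∀ u k x → ⟦ 5 ⟧ * x - (u * u - + 1 / 4 - k * (⟦ 2 ⟧ * x))
            ≡ k * (⟦ 18 ⟧ * (x * x)) + x * x - (u * u - + 1 / 4 - k * (⟦ 2 ⟧ * x))
            + ⟦ 18 ⟧ * x * (+ 1 / 4 - k * x) + x * (+ 1 / 4 - x + + 1 / 4)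
          eq u k x = solve (u ∷ k ∷ x ∷ []) ℚ-ring
        eq : ∀ q u k x → ⟦ 74 ⟧ * x - - (q * q * (1ℚ + ⟦ 8 ⟧ * (k * x)) - 1ℚ) ≡
          ⟦ 2 ⟧ * (⟦ 9 ⟧ * x - - (q * u - ½)) * (⟦ 2 ⟧ * (q * u) + 1ℚ) + ⟦ 36 ⟧ * x * (1ℚ - q * u)
          + ⟦ 4 ⟧ * (q * q) * (⟦ 5 ⟧ * x - (u * u - + 1 / 4 - k * (⟦ 2 ⟧ * x))) + ⟦ 20 ⟧ * x * ((1ℚ - q) * (1ℚ + q))
        eq q u k x = solve (q ∷ u ∷ k ∷ x ∷ []) ℚ-ring

    -- Linear in the rank: q can leave the neighbourhood of 1 only after a number of steps of order
    -- m. This drives the converse about cuts.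
    q-near-1 : ∀ k → k ℕ.≤ K → 1ℚ - q k ≤ ⟦ k ⟧ * (⟦ 10 ⟧ * x)
    q-near-1 zero    _     = ≤-reflexive (trans (cong (λ z → 1ℚ - z) q0≡1) (sym (*-zeroˡ (⟦ 10 ⟧ * x))))
    q-near-1 (suc k) 1+k≤K = subst (λ z → 1ℚ - q (suc k) ≤ z * (⟦ 10 ⟧ * x)) (sym (⟦⟧-suc k))
      (≤-by (gap (q-near-1 k (ℕ.<⇒≤ 1+k≤K)) ⊕ gap (q-drop 0≤x x≤1 (steps k 1+k≤K))) (eq (q k) (q (suc k)) ⟦ k ⟧ x))
      where
      eq : ∀ q r k x → (1ℚ + k) * (⟦ 10 ⟧ * x) - (1ℚ - r) ≡ (k * (⟦ 10 ⟧ * x) - (1ℚ - q)) + (⟦ 10 ⟧ * x - (q - r))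
      eq q r k x = solve (q ∷ r ∷ k ∷ x ∷ []) ℚ-ring

  -- Counting outputs

  private
    variable
      A B C : Set

  -- Counting is done by rational weights: the length of a filtered list is the sum of an indicator,
  -- and sums factor over products where filters would not.
  ∑ₗ : List A → (A → ℚ) → ℚ
  ∑ₗ []       f = 0ℚ
  ∑ₗ (x ∷ xs) f = f x + ∑ₗ xs f

  ∑ₗ-cong : ∀ (xs : List A) {f g} → (∀ x → f x ≡ g x) → ∑ₗ xs f ≡ ∑ₗ xs g
  ∑ₗ-cong []       eq = refl
  ∑ₗ-cong (x ∷ xs) eq = cong₂ _+_ (eq x) (∑ₗ-cong xs eq)

  ∑ₗ-mono : ∀ (xs : List A) {f g} → (∀ x → f x ≤ g x) → ∑ₗ xs f ≤ ∑ₗ xs g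
  ∑ₗ-mono []       le = ≤-refl
  ∑ₗ-mono (x ∷ xs) le = +-mono-≤ (le x) (∑ₗ-mono xs le)

  ∑ₗ-zero : ∀ (xs : List A) → ∑ₗ xs (λ _ → 0ℚ) ≡ 0ℚ
  ∑ₗ-zero []       = refl
  ∑ₗ-zero (x ∷ xs) = trans (+-identityˡ _) (∑ₗ-zero xs)

  ∑ₗ-+ : ∀ (xs : List A) f g → ∑ₗ xs (λ x → f x + g x) ≡ ∑ₗ xs f + ∑ₗ xs g
  ∑ₗ-+ []       f g = refl
  ∑ₗ-+ (x ∷ xs) f g = trans (cong (_+_ (f x + g x)) (∑ₗ-+ xs f g)) (eq (f x) (g x) _ _)
    where
    eq : ∀ a b c d → a + b + (c + d) ≡ a + c + (b + d)
    eq a b c d = solve (a ∷ b ∷ c ∷ d ∷ []) ℚ-ring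

  ∑ₗ-*ˡ : ∀ (xs : List A) c f → ∑ₗ xs (λ x → c * f x) ≡ c * ∑ₗ xs f
  ∑ₗ-*ˡ []       c f = sym (*-zeroʳ c)
  ∑ₗ-*ˡ (x ∷ xs) c f = trans (cong (_+_ (c * f x)) (∑ₗ-*ˡ xs c f)) (sym (*-distribˡ-+ c (f x) _))

  ∑ₗ-*ʳ : ∀ (xs : List A) c f → ∑ₗ xs (λ x → f x * c) ≡ ∑ₗ xs f * c
  ∑ₗ-*ʳ xs c f = trans (∑ₗ-cong xs λ x → *-comm (f x) c) (trans (∑ₗ-*ˡ xs c f) (*-comm c _))

  ∑ₗ-++ : ∀ (xs ys : List A) f → ∑ₗ (xs ++ ys) f ≡ ∑ₗ xs f + ∑ₗ ys f
  ∑ₗ-++ []       ys f = sym (+-identityˡ _)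
  ∑ₗ-++ (x ∷ xs) ys f = trans (cong (_+_ (f x)) (∑ₗ-++ xs ys f)) (sym (+-assoc (f x) _ _))

  ∑ₗ-map : ∀ (g : A → B) xs f → ∑ₗ (map g xs) f ≡ ∑ₗ xs (f ∘ g)
  ∑ₗ-map g []       f = refl
  ∑ₗ-map g (x ∷ xs) f = cong (_+_ (f (g x))) (∑ₗ-map g xs f)

  ∑ₗ-concatMap : ∀ (g : A → List B) xs f → ∑ₗ (concatMap g xs) f ≡ ∑ₗ xs (λ x → ∑ₗ (g x) f)
  ∑ₗ-concatMap g []       f = refl
  ∑ₗ-concatMap g (x ∷ xs) f = trans (∑ₗ-++ (g x) (concatMap g xs) f) (cong (_+_ (∑ₗ (g x) f)) (∑ₗ-concatMap g xs f))

  ∑ₗ-cartesianProductWith : ∀ (h : A → B → C) xs ys f →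
    ∑ₗ (cartesianProductWith h xs ys) f ≡ ∑ₗ xs (λ x → ∑ₗ ys (λ y → f (h x y)))
  ∑ₗ-cartesianProductWith h []       ys f = refl
  ∑ₗ-cartesianProductWith h (x ∷ xs) ys f = trans (∑ₗ-++ (map (h x) ys) (cartesianProductWith h xs ys) f)
    (cong₂ _+_ (∑ₗ-map (h x) ys f) (∑ₗ-cartesianProductWith h xs ys f))

  ∑ₗ-product : ∀ (xs : List A) (ys : List B) f g →
    ∑ₗ xs (λ x → ∑ₗ ys (λ y → f x * g y)) ≡ ∑ₗ xs f * ∑ₗ ys g
  ∑ₗ-product xs ys f g = trans (∑ₗ-cong xs λ x → ∑ₗ-*ˡ ys (f x) g) (∑ₗ-*ʳ xs (∑ₗ ys g) f)

  ∑ₗ-applyUpTo : ∀ (g : ℕ → A) n f → ∑ₗ (applyUpTo g n) f ≡ ∑ n (f ∘ g)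
  ∑ₗ-applyUpTo g zero    f = refl
  ∑ₗ-applyUpTo g (suc n) f = cong (_+_ (f (g 0))) (∑ₗ-applyUpTo (g ∘ suc) n f)

  ∑ₗ-tabulate : ∀ {n} (g : Fin n → A) f {h} → (∀ i → f (g i) ≡ h (toℕ i)) → ∑ₗ (tabulate g) f ≡ ∑ n h
  ∑ₗ-tabulate {n = zero}  g f eq = refl
  ∑ₗ-tabulate {n = suc n} g f eq = cong₂ _+_ (eq Fin.zero) (∑ₗ-tabulate (g ∘ Fin.suc) f (eq ∘ Fin.suc))

  ⟦sum⟧ : ∀ (f : A → ℕ) xs → ⟦ sum (map f xs) ⟧ ≡ ∑ₗ xs (⟦_⟧ ∘ f)
  ⟦sum⟧ f []       = refl
  ⟦sum⟧ f (x ∷ xs) = trans (⟦⟧-+ (f x) _) (cong (_+_ ⟦ f x ⟧) (⟦sum⟧ f xs))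

  χ : ∀ {P : Set} → Dec P → ℚ
  χ d = if does d then 1ℚ else 0ℚ

  χ-nonneg : ∀ {P : Set} (d : Dec P) → 0ℚ ≤ χ d
  χ-nonneg (yes _) = nonNegative⁻¹ 1ℚ
  χ-nonneg (no  _) = ≤-refl

  χ-≤1 : ∀ {P : Set} (d : Dec P) → χ d ≤ 1ℚ
  χ-≤1 (yes _) = ≤-refl
  χ-≤1 (no  _) = nonNegative⁻¹ 1ℚ

  χ-yes : ∀ {P : Set} (d : Dec P) → P → χ d ≡ 1ℚ
  χ-yes (yes _)  p = refl
  χ-yes (no ¬p)  p = ⊥-elim (¬p p)

  χ-no : ∀ {P : Set} (d : Dec P) → (P → Data.Empty.⊥) → χ d ≡ 0ℚ
  χ-no (yes p) ¬p = ⊥-elim (¬p p)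
  χ-no (no _)  ¬p = refl

  ⟦length-filter⟧ : ∀ {P : A → Set} (P? : ∀ x → Dec (P x)) xs → ⟦ length (filter P? xs) ⟧ ≡ ∑ₗ xs (χ ∘ P?)
  ⟦length-filter⟧ P? []       = refl
  ⟦length-filter⟧ P? (x ∷ xs) with does (P? x)
  ... | true  = trans (⟦⟧-suc (length (filter P? xs))) (cong (_+_ 1ℚ) (⟦length-filter⟧ P? xs))
  ... | false = trans (⟦length-filter⟧ P? xs) (sym (+-identityˡ _))

  ⟦length⟧ : ∀ (xs : List A) → ⟦ length xs ⟧ ≡ ∑ₗ xs (λ _ → 1ℚ)
  ⟦length⟧ []       = refl
  ⟦length⟧ (x ∷ xs) = trans (⟦⟧-suc (length xs)) (cong (_+_ 1ℚ) (⟦length⟧ xs))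

  -- The variables at the leaves are distinct, so a valuation of s ⇒ t is a pair of independent
  -- valuations of s and t.
  ∑ₗ-valuations-split : ∀ m a b φ ψ →
    ∑ₗ (valuations m (a ℕ.+ b)) (λ ρ → φ (take a ρ) * ψ (drop a ρ)) ≡ ∑ₗ (valuations m a) φ * ∑ₗ (valuations m b) ψ
  ∑ₗ-valuations-split m zero    b φ ψ = trans (∑ₗ-*ˡ (valuations m b) (φ Vec.[]) ψ)
    (cong (_* ∑ₗ (valuations m b) ψ) (sym (+-identityʳ (φ Vec.[]))))
  ∑ₗ-valuations-split m (suc a) b φ ψ = begin
    ∑ₗ (valuations m (suc a ℕ.+ b)) (λ ρ → φ (take (suc a) ρ) * ψ (drop (suc a) ρ))
      ≡⟨ ∑ₗ-cartesianProductWith Vec._∷_ (allFin m) (valuations m (a ℕ.+ b)) _ ⟩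
    ∑ₗ (allFin m) (λ v → ∑ₗ (valuations m (a ℕ.+ b)) (λ ρ → φ (v Vec.∷ take a ρ) * ψ (drop a ρ)))
      ≡⟨ ∑ₗ-cong (allFin m) (λ v → ∑ₗ-valuations-split m a b (φ ∘ (v Vec.∷_)) ψ) ⟩
    ∑ₗ (allFin m) (λ v → ∑ₗ (valuations m a) (φ ∘ (v Vec.∷_)) * ∑ₗ (valuations m b) ψ)
      ≡⟨ ∑ₗ-*ʳ (allFin m) (∑ₗ (valuations m b) ψ) (λ v → ∑ₗ (valuations m a) (φ ∘ (v Vec.∷_))) ⟩
    ∑ₗ (allFin m) (λ v → ∑ₗ (valuations m a) (φ ∘ (v Vec.∷_))) * ∑ₗ (valuations m b) ψ
      ≡⟨ cong (_* ∑ₗ (valuations m b) ψ) (∑ₗ-cartesianProductWith Vec._∷_ (allFin m) (valuations m a) φ) ⟨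
    ∑ₗ (valuations m (suc a)) φ * ∑ₗ (valuations m b) ψ ∎
    where open ≡-Reasoning

  ∑ₗ-bracketings : ∀ fuel k φ → ∑ₗ (bracketingsWithin (suc fuel) (suc (suc k))) φ ≡
    ∑ (suc k) (λ i → ∑ₗ (bracketingsWithin fuel (suc i)) λ s → ∑ₗ (bracketingsWithin fuel
        (suc (k ∸ i))) λ t → φ (s ⇒ t))
  ∑ₗ-bracketings fuel k φ = trans
    (∑ₗ-concatMap (λ i → cartesianProductWith _⇒_ (bracketingsWithin fuel (suc i))
        (bracketingsWithin fuel (suc (k ∸ i)))) (upTo (suc k)) φ)
    (trans (∑ₗ-cong (upTo (suc k)) λ i → ∑ₗ-cartesianProductWith _⇒_ (bracketingsWithin fuel (suc i))
        (bracketingsWithin fuel (suc (k ∸ i))) φ)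
      (∑ₗ-applyUpTo id (suc k) λ i → ∑ₗ (bracketingsWithin fuel (suc i)) λ s → ∑ₗ (bracketingsWithin fuel
          (suc (k ∸ i))) λ t → φ (s ⇒ t)))

  -- The recursion lists both subtrees with the same fuel, which may exceed their numbers of leaves.
  -- This identifies their sums with those over `bracketings` proper.
  ∑ₗ-fuel : ∀ f g n φ → n ℕ.≤ f → n ℕ.≤ g → ∑ₗ (bracketingsWithin f n) φ ≡ ∑ₗ (bracketingsWithin g n) φ
  ∑ₗ-fuel zero    zero    zero          φ _         _         = refl
  ∑ₗ-fuel zero    (suc g) zero          φ _         _         = refl
  ∑ₗ-fuel (suc f) zero    zero          φ _         _         = refl
  ∑ₗ-fuel (suc f) (suc g) zero          φ _         _         = refl
  ∑ₗ-fuel (suc f) (suc g) (suc zero)    φ _         _         = refl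
  ∑ₗ-fuel (suc f) (suc g) (suc (suc k)) φ (s≤s n≤f) (s≤s n≤g) = begin
    ∑ₗ (bracketingsWithin (suc f) (suc (suc k))) φ
      ≡⟨ ∑ₗ-bracketings f k φ ⟩
    ∑ (suc k) (λ i → ∑ₗ (bracketingsWithin f (suc i)) λ s → ∑ₗ (bracketingsWithin f (suc (k ∸ i))) λ t → φ (s ⇒ t))
      ≡⟨ ∑-cong (suc k) (λ i i<1+k → trans
           (∑ₗ-fuel f g (suc i) (λ s → ∑ₗ (bracketingsWithin f (suc (k ∸ i))) λ t → φ (s ⇒ t))
               (ℕ.≤-trans i<1+k n≤f) (ℕ.≤-trans i<1+k n≤g))
           (∑ₗ-cong (bracketingsWithin g (suc i)) λ s → ∑ₗ-fuel f g (suc (k ∸ i)) (λ t → φ (s ⇒ t))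
             (ℕ.≤-trans (s≤s (ℕ.m∸n≤m k i)) n≤f) (ℕ.≤-trans (s≤s (ℕ.m∸n≤m k i)) n≤g))) ⟩
    ∑ (suc k) (λ i → ∑ₗ (bracketingsWithin g (suc i)) λ s → ∑ₗ (bracketingsWithin g (suc (k ∸ i))) λ t → φ (s ⇒ t))
      ≡⟨ ∑ₗ-bracketings g k φ ⟨
    ∑ₗ (bracketingsWithin (suc g) (suc (suc k))) φ ∎
    where open ≡-Reasoning

  -- Indexed by the number of leaves minus one, since a bracketing has at least one leaf.
  total : ∀ {m} → (Fin m → ℚ) → ℕ → ℚ
  total {m} f n = ∑ₗ (outputs m (suc n)) f

  module _ {m : ℕ} where

    private
      weight : (Fin m → ℚ) → Bracketing → ℚ
      weight f t = ∑ₗ (valuations m (leaves t)) (f ∘ value t)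

      total-weight : ∀ f n → total f n ≡ ∑ₗ (bracketings (suc n)) (weight f)
      total-weight f n = trans (∑ₗ-concatMap _ (bracketings (suc n)) f)
        (∑ₗ-cong (bracketings (suc n)) λ t → ∑ₗ-map (value t) (valuations m (leaves t)) f)

    total-zero : ∀ f → total f 0 ≡ ∑ₗ (allFin m) f
    total-zero f = trans (total-weight f 0) (trans (+-identityʳ (weight f var)) (trans
      (∑ₗ-cartesianProductWith Vec._∷_ (allFin m) (Vec.[] ∷ []) (f ∘ value var))
      (∑ₗ-cong (allFin m) λ v → +-identityʳ (f v))))

    -- The root splits a bracketing into two independent ones. A weight that factors over the two
    -- arguments of `⇒G` thus yields a product of generating functions.
    total-suc : ∀ f f₁ f₂ → (∀ a b → f (a ⇒G b) ≡ f₁ a * f₂ b) → ∀ n → total f (suc n) ≡ conv (total f₁) (total f₂) n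
    total-suc f f₁ f₂ factor n = begin
      total f (suc n)
        ≡⟨ total-weight f (suc n) ⟩
      ∑ₗ (bracketingsWithin (suc (suc n)) (suc (suc n))) (weight f)
        ≡⟨ ∑ₗ-bracketings (suc n) n (weight f) ⟩
      ∑ (suc n) (λ i → ∑ₗ (bracketingsWithin (suc n) (suc i)) λ s → ∑ₗ (bracketingsWithin (suc n)
          (suc (n ∸ i))) λ t → weight f (s ⇒ t))
        ≡⟨ ∑-cong (suc n) (λ i i<1+n → begin
             ∑ₗ (bracketingsWithin (suc n) (suc i))
                 (λ s → ∑ₗ (bracketingsWithin (suc n) (suc (n ∸ i))) λ t → weight f (s ⇒ t))
               ≡⟨ ∑ₗ-cong (bracketingsWithin (suc n) (suc i))
                   (λ s → ∑ₗ-cong (bracketingsWithin (suc n) (suc (n ∸ i))) λ t → weight-⇒ s t) ⟩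
             ∑ₗ (bracketingsWithin (suc n) (suc i))
                 (λ s → ∑ₗ (bracketingsWithin (suc n) (suc (n ∸ i))) λ t → weight f₁ s * weight f₂ t)
               ≡⟨ ∑ₗ-product (bracketingsWithin (suc n) (suc i)) (bracketingsWithin (suc n) (suc (n ∸ i)))
                   (weight f₁) (weight f₂) ⟩
             ∑ₗ (bracketingsWithin (suc n) (suc i)) (weight f₁) * ∑ₗ (bracketingsWithin (suc n) (suc (n ∸ i)))
                 (weight f₂)
               ≡⟨ cong₂ _*_ (trans (∑ₗ-fuel (suc n) (suc i) (suc i) (weight f₁) i<1+n ℕ.≤-refl)
                   (sym (total-weight f₁ i)))
                            (trans (∑ₗ-fuel (suc n) (suc (n ∸ i)) (suc (n ∸ i)) (weight f₂)
                                (s≤s (ℕ.m∸n≤m n i)) ℕ.≤-refl) (sym (total-weight f₂ (n ∸ i)))) ⟩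
             total f₁ i * total f₂ (n ∸ i) ∎) ⟩
      conv (total f₁) (total f₂) n ∎
      where
      open ≡-Reasoning
      weight-⇒ : ∀ s t → weight f (s ⇒ t) ≡ weight f₁ s * weight f₂ t
      weight-⇒ s t = trans (∑ₗ-cong (valuations m (leaves s ℕ.+ leaves t)) λ ρ → factor _ _)
        (∑ₗ-valuations-split m (leaves s) (leaves t) (f₁ ∘ value s) (f₂ ∘ value t))

  atLeast exactly : ∀ {m} → ℕ → Fin m → ℚ
  atLeast k v = χ (k ℕ.≤? toℕ v)
  exactly j v = χ (toℕ v ℕ.≟ j)

  atLeast-split : ∀ {m} k (v : Fin m) → atLeast k v ≡ atLeast (suc k) v + exactly k v
  atLeast-split k v with ℕ.<-cmp k (toℕ v)
  ... | tri< k<v k≢v _ = trans (χ-yes (k ℕ.≤? toℕ v) (ℕ.<⇒≤ k<v))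
    (sym (cong₂ _+_ (χ-yes (suc k ℕ.≤? toℕ v) k<v) (χ-no (toℕ v ℕ.≟ k) (k≢v ∘ sym))))
  ... | tri≈ k≮v k≡v _ = trans (χ-yes (k ℕ.≤? toℕ v) (ℕ.≤-reflexive k≡v))
    (sym (cong₂ _+_ (χ-no (suc k ℕ.≤? toℕ v) k≮v) (χ-yes (toℕ v ℕ.≟ k) (sym k≡v))))
  ... | tri> k≮v k≢v v<k = trans (χ-no (k ℕ.≤? toℕ v) (ℕ.<⇒≱ v<k))
    (sym (cong₂ _+_ (χ-no (suc k ℕ.≤? toℕ v) k≮v) (χ-no (toℕ v ℕ.≟ k) (k≢v ∘ sym))))

  -- If a ≤ b the output is the top, which j < M excludes, and b = v_j with a > v_j is impossible as
  -- well. Otherwise the output is b, and b = v_j gives a > v_j.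
  exactly-⇒G : ∀ {M} j → j ℕ.< M → (a b : Fin (suc M)) → exactly j (a ⇒G b) ≡ atLeast (suc j) a * exactly j b
  exactly-⇒G {M} j j<M a b with a Fin.≤? b
  ... | yes a≤b = trans (χ-no (toℕ (Fin.fromℕ M) ℕ.≟ j) (λ M≡j → ℕ.<⇒≢ j<M (trans (sym M≡j) (Fin.toℕ-fromℕ M))))
      (sym rhs)
    where
    rhs : atLeast (suc j) a * exactly j b ≡ 0ℚ
    rhs with toℕ b ℕ.≟ j
    ... | yes b≡j = trans (cong (_* exactly j b) (χ-no (suc j ℕ.≤? toℕ a) (ℕ.≤⇒≯ (subst (toℕ a ℕ.≤_) b≡j a≤b))))
      (*-zeroˡ (exactly j b))
    ... | no  b≢j = trans (cong (atLeast (suc j) a *_) (χ-no (toℕ b ℕ.≟ j) b≢j)) (*-zeroʳ (atLeast (suc j) a))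
  ... | no  a≰b with toℕ b ℕ.≟ j
  ...   | yes b≡j = sym (trans (cong (_* exactly j b) (χ-yes (suc j ℕ.≤? toℕ a) (subst (ℕ._< toℕ a) b≡j (ℕ.≰⇒> a≰b))))
            (*-identityˡ (exactly j b)))
  ...   | no  b≢j = trans (χ-no (toℕ b ℕ.≟ j) b≢j)
            (sym (trans (cong (atLeast (suc j) a *_) (χ-no (toℕ b ℕ.≟ j) b≢j)) (*-zeroʳ (atLeast (suc j) a))))

  ∑-indicator : ∀ n j → j ℕ.< n → ∑ n (λ i → χ (i ℕ.≟ j)) ≡ 1ℚ
  ∑-indicator (suc n) zero    _         = cong (_+_ 1ℚ) (trans (∑-cong n λ i _ → χ-no (suc i ℕ.≟ 0) λ ()) (∑-zero n))
  ∑-indicator (suc n) (suc j) (s≤s j<n) = trans (cong₂ _+_ (χ-no (0 ℕ.≟ suc j) λ ()) (∑-cong n λ i _ → χ-suc i))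
      (trans (+-identityˡ _) (∑-indicator n j j<n))
    where
    χ-suc : ∀ i → χ (suc i ℕ.≟ suc j) ≡ χ (i ℕ.≟ j)
    χ-suc i = refl

  ∑-one : ∀ n → ∑ n (λ _ → 1ℚ) ≡ ⟦ n ⟧
  ∑-one zero    = refl
  ∑-one (suc n) = trans (cong (_+_ 1ℚ) (∑-one n)) (sym (⟦⟧-suc n))

  total-≡ : ∀ {m} {f g : Fin m → ℚ} → (∀ v → f v ≡ g v) → ∀ n → total f n ≡ total g n
  total-≡ {m} eq n = ∑ₗ-cong (outputs m (suc n)) eq

  total-atLeast-split : ∀ {m} k n → total {m} (atLeast k) n ≡ total (atLeast (suc k)) n + total (exactly k) n
  total-atLeast-split {m} k n = trans (total-≡ (atLeast-split k) n)
      (∑ₗ-+ (outputs m (suc n)) (atLeast (suc k)) (exactly k))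

  ⟦G⟨⟩⟧ : ∀ j m n → ⟦ G⟨ j ⟩ m (suc n) ⟧ ≡ total {m} (exactly j) n
  ⟦G⟨⟩⟧ j m n = ⟦length-filter⟧ (λ v → toℕ v ℕ.≟ j) (outputs m (suc n))

  ⟦#outputs≥⟧ : ∀ k m n → ⟦ #outputs≥ k m (suc n) ⟧ ≡ total {m} (atLeast k) n
  ⟦#outputs≥⟧ k m n = ⟦length-filter⟧ (λ v → k ℕ.≤? toℕ v) (outputs m (suc n))

  ⟦#outputs⟧ : ∀ m n → ⟦ #outputs m (suc n) ⟧ ≡ total {m} (atLeast 0) n
  ⟦#outputs⟧ m n = ⟦length⟧ (outputs m (suc n))

  +-rotate : ∀ a b c → a + (b + c) ≡ (a + c) + b
  +-rotate a b c = trans (cong (_+_ a) (+-comm b c)) (sym (+-assoc a c b))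

  ⟦H⟨⟩⟧ : ∀ k m n → k ℕ.≤ m → ⟦ H⟨ k ⟩ m (suc n) ⟧ ≡ total {m} (atLeast k) n
  ⟦H⟨⟩⟧ k m n k≤m = begin
    ⟦ H⟨ k ⟩ m (suc n) ⟧
      ≡⟨ ⟦sum⟧ (λ i → G⟨ k ℕ.+ i ⟩ m (suc n)) (upTo (m ∸ k)) ⟩
    ∑ₗ (upTo (m ∸ k)) (λ i → ⟦ G⟨ k ℕ.+ i ⟩ m (suc n) ⟧)
      ≡⟨ ∑ₗ-applyUpTo id (m ∸ k) _ ⟩
    ∑ (m ∸ k) (λ i → ⟦ G⟨ k ℕ.+ i ⟩ m (suc n) ⟧)
      ≡⟨ ∑-cong (m ∸ k) (λ i _ → ⟦G⟨⟩⟧ (k ℕ.+ i) m n) ⟩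
    ∑ (m ∸ k) (λ i → total {m} (exactly (k ℕ.+ i)) n)
      ≡⟨ +-identityˡ _ ⟨
    0ℚ + ∑ (m ∸ k) (λ i → total {m} (exactly (k ℕ.+ i)) n)
      ≡⟨ cong (_+ ∑ (m ∸ k) (λ i → total {m} (exactly (k ℕ.+ i)) n)) (sym top) ⟩
    total {m} (atLeast (k ℕ.+ (m ∸ k))) n + ∑ (m ∸ k) (λ i → total {m} (exactly (k ℕ.+ i)) n)
      ≡⟨ telescoped (m ∸ k) ⟩
    total {m} (atLeast k) n ∎
    where
    open ≡-Reasoning
    top : total {m} (atLeast (k ℕ.+ (m ∸ k))) n ≡ 0ℚ
    top = trans (total-≡ (λ v → χ-no (k ℕ.+ (m ∸ k) ℕ.≤? toℕ v)
        (ℕ.<⇒≱ (subst (toℕ v ℕ.<_) (sym (ℕ.m+[n∸m]≡n k≤m)) (Fin.toℕ<n v)))) n)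
      (∑ₗ-zero (outputs m (suc n)))
    telescoped : ∀ l → total {m} (atLeast (k ℕ.+ l)) n + ∑ l (λ i → total {m} (exactly (k ℕ.+ i)) n)
        ≡ total {m} (atLeast k) n
    telescoped zero    = trans (+-identityʳ _) (cong (λ z → total {m} (atLeast z) n) (ℕ.+-identityʳ k))
    telescoped (suc l) = begin
      total {m} (atLeast (k ℕ.+ suc l)) n + ∑ (suc l) (λ i → total {m} (exactly (k ℕ.+ i)) n)
        ≡⟨ cong₂ (λ z w → total {m} (atLeast z) n + w) (ℕ.+-suc k l)
            (∑-snoc l (λ i → total {m} (exactly (k ℕ.+ i)) n)) ⟩
      total {m} (atLeast (suc (k ℕ.+ l))) n + (∑ l (λ i → total {m} (exactly (k ℕ.+ i)) n)
          + total {m} (exactly (k ℕ.+ l)) n)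
        ≡⟨ +-rotate (total {m} (atLeast (suc (k ℕ.+ l))) n) _ _ ⟩
      (total {m} (atLeast (suc (k ℕ.+ l))) n + total {m} (exactly (k ℕ.+ l)) n)
          + ∑ l (λ i → total {m} (exactly (k ℕ.+ i)) n)
        ≡⟨ cong (_+ ∑ l (λ i → total {m} (exactly (k ℕ.+ i)) n)) (total-atLeast-split (k ℕ.+ l) n) ⟨
      total {m} (atLeast (k ℕ.+ l)) n + ∑ l (λ i → total {m} (exactly (k ℕ.+ i)) n)
        ≡⟨ telescoped l ⟩
      total {m} (atLeast k) n ∎

  ⟦⟧-injective : ∀ {a b} → ⟦ a ⟧ ≡ ⟦ b ⟧ → a ≡ b
  ⟦⟧-injective eq = ℕ.≤-antisym (⟦⟧-cancel (≤-reflexive eq)) (⟦⟧-cancel (≤-reflexive (sym eq)))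

  conv-unique : ∀ {f} → f 0 ≡ catalan 0 → (∀ n → f (suc n) ≡ conv f f n) → ∀ n → f n ≡ catalan n
  conv-unique {f} f0 f-suc n = below-n n n ℕ.≤-refl
    where
    below-n : ∀ N n → n ℕ.≤ N → f n ≡ catalan n
    below-n N       zero    _         = f0
    below-n (suc N) (suc n) (s≤s n≤N) = begin
      f (suc n)               ≡⟨ f-suc n ⟩
      conv f f n              ≡⟨ conv-cong n (λ i i≤n → below-n N i (ℕ.≤-trans i≤n n≤N))
          (λ i i≤n → below-n N i (ℕ.≤-trans i≤n n≤N)) ⟩
      conv catalan catalan n  ≡⟨ catalan-conv n ⟨
      catalan (suc n)         ∎
      where open ≡-Reasoning

  seq-÷ : ∀ a b i → 0ℚ < ⟦ b ⟧ → seq (a ÷ b) i * ⟦ b ⟧ ≡ ⟦ a ⟧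
  seq-÷ a zero    i 0<0 = ⊥-elim (<-irrefl refl 0<0)
  seq-÷ a (suc b) i _   = /-* a (suc b)

  module Counting (M : ℕ) where

    m : ℕ
    m = suc M

    x : ℚ
    x = + 1 / (4 ℕ.* m)

    0<x : 0ℚ < x
    0<x = positive⁻¹ x {{normalize-pos 1 (4 ℕ.* m)}}

    x*4m : x * (⟦ 4 ⟧ * ⟦ m ⟧) ≡ 1ℚ
    x*4m = trans (cong (x *_) (sym (⟦⟧-* 4 m))) (/-* 1 (4 ℕ.* m))

    mx≡¼ : ⟦ m ⟧ * x ≡ + 1 / 4
    mx≡¼ = trans (quarter x ⟦ m ⟧) (cong (+ 1 / 4 *_) x*4m)
      where
      quarter : ∀ x m → m * x ≡ (+ 1 / 4) * (x * (⟦ 4 ⟧ * m))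
      quarter x m = solve (x ∷ m ∷ []) ℚ-ring

    -- The power x^(n+1), in accordance with n + 1 leaves at index n.
    scale : ℕ → ℚ
    scale zero    = x
    scale (suc n) = x * scale n

    scale-+ : ∀ i j → scale (suc (i ℕ.+ j)) ≡ scale i * scale j
    scale-+ zero    j = refl
    scale-+ (suc i) j = trans (cong (x *_) (scale-+ i j)) (sym (*-assoc x (scale i) (scale j)))

    0<scale : ∀ n → 0ℚ < scale n
    0<scale zero    = 0<x
    0<scale (suc n) = 0<-* 0<x (0<scale n)

    normalised : (Fin m → ℚ) → ℕ → ℚ
    normalised f n = total f n * scale n

    normalised-suc : ∀ f f₁ f₂ → (∀ a b → f (a ⇒G b) ≡ f₁ a * f₂ b) → ∀ n →
      normalised f (suc n) ≡ conv (normalised f₁) (normalised f₂) n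
    normalised-suc f f₁ f₂ factor n = begin
      total f (suc n) * scale (suc n)
        ≡⟨ cong (_* scale (suc n)) (total-suc f f₁ f₂ factor n) ⟩
      conv (total f₁) (total f₂) n * scale (suc n)
        ≡⟨ ∑-*ʳ (suc n) (λ i → total f₁ i * total f₂ (n ∸ i)) (scale (suc n)) ⟨
      ∑ (suc n) (λ i → total f₁ i * total f₂ (n ∸ i) * scale (suc n))
        ≡⟨ ∑-cong (suc n) (λ i i<1+n → trans
             (cong (total f₁ i * total f₂ (n ∸ i) *_) (trans
               (cong (scale ∘ suc) (sym (ℕ.m+[n∸m]≡n (ℕ.s≤s⁻¹ i<1+n)))) (scale-+ i (n ∸ i))))
             (eq (total f₁ i) (total f₂ (n ∸ i)) (scale i) (scale (n ∸ i)))) ⟩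
      conv (normalised f₁) (normalised f₂) n ∎
      where
      open ≡-Reasoning
      eq : ∀ a b c d → a * b * (c * d) ≡ a * c * (b * d)
      eq a b c d = solve (a ∷ b ∷ c ∷ d ∷ []) ℚ-ring

    normalised-mono : ∀ {f g} → (∀ v → f v ≤ g v) → ∀ n → normalised f n ≤ normalised g n
    normalised-mono f≤g n = *-monoʳ-≤-nonNeg (scale n) {{nonNegative (<⇒≤ (0<scale n))}}
        (∑ₗ-mono (outputs m (suc n)) f≤g)

    -- The constant weight 1 factors trivially, which is the equation for G; its initial value m x
    -- is ¼, the first scaled Catalan number.
    normalised-all : ∀ n → normalised (λ _ → 1ℚ) n ≡ catalan n
    normalised-all = conv-unique
      (trans (cong (_* x) (trans (total-zero {m} one)
          (trans (∑ₗ-tabulate {n = m} id one {one} λ _ → refl) (∑-one m)))) mx≡¼)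
      (normalised-suc (λ _ → 1ℚ) (λ _ → 1ℚ) (λ _ → 1ℚ) (λ _ _ → refl))
      where
      one : ∀ {A : Set} → A → ℚ
      one _ = 1ℚ

    normalised-≼ : ∀ {f} → (∀ v → 0ℚ ≤ f v) → (∀ v → f v ≤ 1ℚ) → normalised f ≼ catalan
    normalised-≼ {f} 0≤f f≤1 = dominated
      (λ n → subst (_≤ normalised f n) (trans (cong (_* scale n) (∑ₗ-zero (outputs m (suc n))))
          (*-zeroˡ (scale n))) (normalised-mono 0≤f n))
      (λ n → subst (normalised f n ≤_) (normalised-all n) (normalised-mono f≤1 n))

    ⟦G⟧*scale : ∀ n → ⟦ G m (suc n) ⟧ * scale n ≡ catalan n
    -- `H⟨ 0 ⟩` agrees with `G` by computation, and so does `atLeast 0` with the constant weight 1.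
    ⟦G⟧*scale n = trans (cong (_* scale n) (⟦H⟨⟩⟧ 0 m n z≤n)) (normalised-all n)

    0<⟦G⟧ : ∀ n → 0ℚ < ⟦ G m (suc n) ⟧
    0<⟦G⟧ n = *-cancelʳ-<-nonNeg (scale n) {{nonNegative (<⇒≤ (0<scale n))}}
      (subst₂ _<_ (sym (*-zeroˡ (scale n))) (sym (⟦G⟧*scale n)) (catalan-positive n))

    proportion-scaled : ∀ c f n → ⟦ c ⟧ ≡ total f n → seq (c ÷ G m (suc n)) 0 * catalan n ≡ normalised f n
    proportion-scaled c f n c≡ = begin
      seq (c ÷ G m (suc n)) 0 * catalan n                       ≡⟨ cong (seq (c ÷ G m (suc n)) 0 *_) (⟦G⟧*scale n) ⟨
      seq (c ÷ G m (suc n)) 0 * (⟦ G m (suc n) ⟧ * scale n)     ≡⟨ *-assoc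
          (seq (c ÷ G m (suc n)) 0) ⟦ G m (suc n) ⟧ (scale n) ⟨
      seq (c ÷ G m (suc n)) 0 * ⟦ G m (suc n) ⟧ * scale n       ≡⟨ cong (_* scale n)
          (trans (seq-÷ c (G m (suc n)) 0 (0<⟦G⟧ n)) c≡) ⟩
      normalised f n                                            ∎
      where open ≡-Reasoning

  -- Proportions for a fixed m

  eventually-× : ∀ {P Q : ℕ → Set} → Eventually P → Eventually Q → Eventually (λ n → P n × Q n)
  eventually-× (N₁ , p) (N₂ , q) = N₁ ℕ.⊔ N₂ , λ n N≤n →
    p n (ℕ.m⊔n≤o⇒m≤o N₁ N₂ N≤n) , q n (ℕ.m⊔n≤o⇒n≤o N₁ N₂ N≤n)

  eventually-map : ∀ {P Q : ℕ → Set} → (∀ n → P n → Q n) → Eventually P → Eventually Q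
  eventually-map f (N , p) = N , λ n N≤n → f n (p n N≤n)

  -- Only finitely many ranks occur for a given m, so all of their recurrences become available at a
  -- common n.
  eventually-all : ∀ K {P : ℕ → ℕ → Set} → (∀ k → k ℕ.< K → Eventually (P k)) →
    Eventually (λ n → ∀ k → k ℕ.< K → P k n)
  eventually-all zero    ev = 0 , λ _ _ _ ()
  eventually-all (suc K) {P} ev = eventually-map (λ n (p , ps) k k<1+K → pick n p ps k (ℕ.m≤n⇒m<n∨m≡n (ℕ.s≤s⁻¹ k<1+K)))
    (eventually-× (ev K ℕ.≤-refl) (eventually-all K λ k k<K → ev k (ℕ.m≤n⇒m≤1+n k<K)))
    where
    pick : ∀ n → P K n → (∀ k → k ℕ.< K → P k n) → ∀ k → k ℕ.< K ⊎ k ≡ K → P k n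
    pick n p ps k (inj₁ k<K)  = ps k k<K
    pick n p ps k (inj₂ refl) = p

  module Proportions (M : ℕ) where
    open Counting M public

    -- A quotient `÷` is a constant sequence of rationals; index 0 reads off its value.
    η ρ : ℕ → ℕ → ℚ
    η k n = seq (H⟨ k ⟩ m (suc n) ÷ G m (suc n)) 0
    ρ k n = seq (G⟨ k ⟩ m (suc n) ÷ G m (suc n)) 0

    η-ratio : ∀ k → k ℕ.≤ m → Ratio (normalised (atLeast k)) (η k)
    η-ratio k k≤m = record
      { dom    = normalised-≼ (λ v → χ-nonneg (k ℕ.≤? toℕ v)) (λ v → χ-≤1 (k ℕ.≤? toℕ v))
      ; scaled = λ n → proportion-scaled (H⟨ k ⟩ m (suc n)) (atLeast k) n (⟦H⟨⟩⟧ k m n k≤m)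
      }

    ρ-ratio : ∀ k → Ratio (normalised (exactly k)) (ρ k)
    ρ-ratio k = record
      { dom    = normalised-≼ (λ v → χ-nonneg (toℕ v ℕ.≟ k)) (λ v → χ-≤1 (toℕ v ℕ.≟ k))
      ; scaled = λ n → proportion-scaled (G⟨ k ⟩ m (suc n)) (exactly k) n (⟦G⟨⟩⟧ k m n)
      }

    rank : ∀ k → k ℕ.< M → Rank x (normalised (atLeast k)) (normalised (atLeast (suc k)))
        (normalised (exactly k)) (η k) (η (suc k)) (ρ k)
    rank k k<M = record
      { h:η    = η-ratio k (ℕ.m≤n⇒m≤1+n (ℕ.<⇒≤ k<M))
      ; a:α    = η-ratio (suc k) (ℕ.m≤n⇒m≤1+n k<M)
      ; d:ρ    = ρ-ratio k
      ; split  = λ n → trans (cong (_* scale n) (total-atLeast-split k n))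
          (*-distribʳ-+ (scale n) (total (atLeast (suc k)) n) (total (exactly k) n))
      -- Exactly one valuation of a single variable takes the value v_k.
      ; d-zero = trans (cong (_* x) (trans (total-zero {m} (exactly k))
          (trans (∑ₗ-tabulate {n = m} id (exactly k) {λ i → χ (i ℕ.≟ k)} λ _ → refl) (∑-indicator m k
              (ℕ.m≤n⇒m≤1+n k<M))))) (*-identityˡ x)
      ; d-suc  = λ n → trans (normalised-suc (exactly k) (atLeast (suc k)) (exactly k) (exactly-⇒G k k<M) n)
          (conv-comm (normalised (atLeast (suc k))) (normalised (exactly k)) n)
      }

    normalised-atLeast-0 : ∀ n → normalised (atLeast 0) n ≡ catalan n
    normalised-atLeast-0 = normalised-all

    η-0 : ∀ n → η 0 n ≡ 1ℚ
    η-0 n = *-cancelʳ (catalan-positive n)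
      (trans (scaled (η-ratio 0 z≤n) n) (trans (normalised-atLeast-0 n) (sym (*-identityˡ (catalan n)))))

    η-cauchy : ∀ k → k ℕ.≤ M → Cauchyℚ (η k)
    η-cauchy zero    _   ε 0<ε = 0 , λ i j _ _ →
      subst (_≤ ε) (sym (cong₂ (λ a b → ∣ a - b ∣) (η-0 i) (η-0 j))) (<⇒≤ 0<ε)
    η-cauchy (suc k) k<M = α-cauchy (rank k k<M) (η-cauchy k (ℕ.<⇒≤ k<M))

    η-split : ∀ k → k ℕ.≤ M → ∀ n → η k n ≡ η (suc k) n + ρ k n
    η-split k k≤M n = *-cancelʳ (catalan-positive n) (begin
      η k n * catalan n       ≡⟨ scaled (η-ratio k (ℕ.m≤n⇒m≤1+n k≤M)) n ⟩
      normalised (atLeast k) n ≡⟨ cong (_* scale n) (total-atLeast-split k n) ⟩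
      (total (atLeast (suc k)) n + total (exactly k) n) * scale n
        ≡⟨ *-distribʳ-+ (scale n) (total (atLeast (suc k)) n) (total (exactly k) n) ⟩
      normalised (atLeast (suc k)) n + normalised (exactly k) n
        ≡⟨ cong₂ _+_ (scaled (η-ratio (suc k) (s≤s k≤M)) n) (scaled (ρ-ratio k) n) ⟨
      η (suc k) n * catalan n + ρ k n * catalan n
        ≡⟨ *-distribʳ-+ (catalan n) (η (suc k) n) (ρ k n) ⟨
      (η (suc k) n + ρ k n) * catalan n ∎)
      where open ≡-Reasoning

    u : ℕ → ℕ → ℚ
    u k = mass (normalised (atLeast k))

    u-≤1 : ∀ k n → k ℕ.≤ m → u k n ≤ 1ℚ
    u-≤1 k n k≤m = ≤-by (∑-nonneg n (nonneg (dom (η-ratio k k≤m)))) (eq (∑ n (normalised (atLeast k))))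
      where
      eq : ∀ s → 1ℚ - (1ℚ - s) ≡ s
      eq s = solve (s ∷ []) ℚ-ring

    ½≤u : ∀ k n → k ℕ.≤ m → ½ ≤ u k n
    ½≤u k n k≤m = ≤-by (gap (≤-trans (∑-≼ n (dom (η-ratio k k≤m))) (∑-catalan-≤½ n)))
        (eq (∑ n (normalised (atLeast k))))
      where
      eq : ∀ s → 1ℚ - s - ½ ≡ ½ - s
      eq s = solve (s ∷ []) ℚ-ring

    u-mono : ∀ k n → k ℕ.< M → u k n ≤ u (suc k) n
    u-mono k n k<M = ≤-by (∑-nonneg n (nonneg (dom (ρ-ratio k))))
      (eq (∑ n (normalised (atLeast k))) (∑ n (normalised (atLeast (suc k)))) (∑ n (normalised (exactly k)))
          (trans (∑-cong n λ i _ → Rank.split (rank k k<M) i)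
        (∑-+ n (normalised (atLeast (suc k))) (normalised (exactly k)))))
      where
      cancel : ∀ a d → 1ℚ - a - (1ℚ - (a + d)) ≡ d
      cancel a d = solve (a ∷ d ∷ []) ℚ-ring
      eq : ∀ h a d → h ≡ a + d → 1ℚ - a - (1ℚ - h) ≡ d
      eq _ a d refl = cancel a d

    u-0 : ∀ n → u 0 n - ½ ≡ ½ * tail n
    u-0 n = trans (cong (λ s → 1ℚ - s - ½) (∑-cong n λ i _ → normalised-atLeast-0 i))
        (eq (∑ n catalan) (tail n) (∑-catalan n))
      where
      lhs : ∀ S t → 1ℚ - S - ½ ≡ ½ * t + ½ * (1ℚ - (⟦ 2 ⟧ * S + t))
      lhs S t = solve (S ∷ t ∷ []) ℚ-ring
      rhs : ∀ t → ½ * t + ½ * (1ℚ - 1ℚ) ≡ ½ * t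
      rhs t = solve (t ∷ []) ℚ-ring
      eq : ∀ S t → ⟦ 2 ⟧ * S + t ≡ 1ℚ → 1ℚ - S - ½ ≡ ½ * t
      eq S t h = trans (lhs S t) (trans (cong (λ z → ½ * t + ½ * (1ℚ - z)) h) (rhs t))

    0≤x : 0ℚ ≤ x
    0≤x = <⇒≤ 0<x

    kx≤¼ : ∀ {k} → k ℕ.≤ m → ⟦ k ⟧ * x ≤ + 1 / 4
    kx≤¼ {k} k≤m = subst (⟦ k ⟧ * x ≤_) mx≡¼ (*-mono 0≤⟦ k ⟧ (⟦⟧-mono k≤m) 0≤x ≤-refl)

    x≤¼ : x ≤ + 1 / 4
    x≤¼ = subst (_≤ + 1 / 4) (*-identityˡ x) (kx≤¼ (s≤s z≤n))

    record Estimates (n : ℕ) : Set where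
      field
        square    : ∀ k → k ℕ.≤ M → ∣ η k n * η k n * (1ℚ + ⟦ 8 ⟧ * (⟦ k ⟧ * x)) - 1ℚ ∣ ≤ ⟦ 74 ⟧ * x
        near-1    : ∀ k → k ℕ.≤ M → 1ℚ - η k n ≤ ⟦ k ⟧ * (⟦ 10 ⟧ * x)
        decrement : ∀ k → k ℕ.< M → η k n - η (suc k) n ≤ ⟦ 10 ⟧ * x

    -- The threshold in n depends on m, as the tolerance x² does, but covers all ranks at once.
    -- Hence the constants 74 and 10 are independent of m and k.
    estimates : Eventually Estimates
    estimates = eventually-map combine (eventually-× small-tail (eventually-all M step))
      where
      0<x² : 0ℚ < x * x
      0<x² = 0<-* 0<x 0<x
      small-tail : Eventually (λ n → tail n ≤ x * x)
      small-tail = tail-vanishes (x * x) 0<x²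
      StepAt : ℕ → ℕ → Set
      StepAt k n = Step x (u k n) (u (suc k) n) (η k n) (η (suc k) n)
      step : ∀ k → k ℕ.< M → Eventually (StepAt k)
      step k k<M = eventually-map make (eventually-× (eventually-× small-tail (1 , λ n 1≤n → 1≤n))
        (ratio-recurrence (rank k k<M) (η-cauchy k (ℕ.<⇒≤ k<M)) (x * x) 0<x²))
        where
        make : ∀ n → (tail n ≤ x * x × 1 ℕ.≤ n) × _ → StepAt k n
        make n ((small , 1≤n) , q-close) = record
          { u≤u′   = u-mono k n k<M
          ; ½≤u    = ½≤u k n (ℕ.m≤n⇒m≤1+n (ℕ.<⇒≤ k<M))
          ; u′≤1   = u-≤1 (suc k) n (ℕ.m≤n⇒m≤1+n k<M)
          ; 0≤q′   = ratio-nonneg (η-ratio (suc k) (ℕ.m≤n⇒m≤1+n k<M)) n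
          ; q′≤1   = ratio-≤1 (η-ratio (suc k) (ℕ.m≤n⇒m≤1+n k<M)) n
          ; u-step = ≤-trans (mass-recurrence (rank k k<M) n 1≤n) small
          ; q-step = q-close
          }
      combine : ∀ n → tail n ≤ x * x × (∀ k → k ℕ.< M → StepAt k n) → Estimates n
      combine n (small , steps) = record
        { square    = q²-estimate 0≤x x≤¼ (λ k → u k n) (λ k → η k n) M (kx≤¼ (ℕ.n≤1+n M)) (η-0 n) (½≤u 0 n z≤n)
            (u-≤1 0 n z≤n) u0-small steps
        ; near-1    = q-near-1 0≤x x≤¼ (λ k → u k n) (λ k → η k n) M (kx≤¼ (ℕ.n≤1+n M)) (η-0 n) (½≤u 0 n z≤n)
            (u-≤1 0 n z≤n) u0-small steps
        ; decrement = λ k k<M → q-drop 0≤x (≤-trans x≤¼ ¼≤1) (steps k k<M)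
        }
        where
        ¼≤1 : + 1 / 4 ≤ 1ℚ
        ¼≤1 = ≤-by (nonNegative⁻¹ (+ 3 / 4)) refl
        u0-small : u 0 n - ½ ≤ ½ * (x * x)
        u0-small = subst (_≤ ½ * (x * x)) (sym (u-0 n)) (*-monoˡ-≤-nonNeg ½ small)

  -- Inverse square roots

  ∣∣-cancel : ∀ {y w c} b → 0ℚ < c → c ≤ w → ∣ y * w ∣ ≤ b * c → ∣ y ∣ ≤ b
  ∣∣-cancel {y} {w} {c} b 0<c c≤w le = ≤-cancel 0<c (≤-trans
    (≤-by (0≤∣p∣ y ⊗ gap c≤w) (eq ∣ y ∣ w c))
    (subst (_≤ b * c) ∣yw∣≡ le))
    where
    eq : ∀ y w c → y * w - y * c ≡ y * (w - c)
    eq y w c = solve (y ∷ w ∷ c ∷ []) ℚ-ring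
    ∣yw∣≡ : ∣ y * w ∣ ≡ ∣ y ∣ * w
    ∣yw∣≡ = trans (∣p*q∣≡∣p∣*∣q∣ y w) (cong (∣ y ∣ *_) (0≤p⇒∣p∣≡p (≤-trans (<⇒≤ 0<c) c≤w)))

  -- With a ≤ 4, a value s < ¼ would give s² a ≤ ¼, whereas s² a is at least ¾.
  inverse-sqrt-≥¼ : ∀ {s a δ} → 0ℚ ≤ s → 0ℚ ≤ a → a ≤ ⟦ 4 ⟧ → δ ≤ + 1 / 4 → ∣ s * s * a - 1ℚ ∣ ≤ δ → + 1 / 4 ≤ s
  inverse-sqrt-≥¼ {s} {a} {δ} 0≤s 0≤a a≤4 δ≤¼ s²a≈1 = ≮⇒≥ λ s<¼ → <-irrefl refl (<-≤-trans
    (positive⁻¹ ½)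
    (≤-by (gap (*-mono (0≤s ⊗ 0≤s) (*-mono 0≤s (<⇒≤ s<¼) 0≤s (<⇒≤ s<¼)) 0≤a a≤4) ⊕ gap (∣∣-lo s²a≈1) ⊕ gap δ≤¼)
      (eq s a δ)))
    where
    eq : ∀ s a δ → 0ℚ - ½ ≡ (+ 1 / 4) * (+ 1 / 4) * ⟦ 4 ⟧ - s * s * a + (δ - - (s * s * a - 1ℚ)) + (+ 1 / 4 - δ)
    eq s a δ = solve (s ∷ a ∷ δ ∷ []) ℚ-ring

  -- (s′ - s)(s + s′) a is the difference of the two errors plus s′²(a - a′), at most 3δ in absolute
  -- value. The factor (s + s′) a is at least ¼ · ½, whence 24.
  inverse-sqrt-close : ∀ {s s′ a a′ δ} → 0ℚ ≤ s → 0ℚ ≤ s′ → s′ ≤ 1ℚ → ½ ≤ a → a ≤ ⟦ 4 ⟧ → δ ≤ + 1 / 4 →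
    ∣ s * s * a - 1ℚ ∣ ≤ δ → ∣ s′ * s′ * a′ - 1ℚ ∣ ≤ δ → ∣ a - a′ ∣ ≤ δ → ∣ s′ - s ∣ ≤ ⟦ 24 ⟧ * δ
  inverse-sqrt-close {s} {s′} {a} {a′} {δ} 0≤s 0≤s′ s′≤1 ½≤a a≤4 δ≤¼ h h′ Δa =
    ∣∣-cancel (⟦ 24 ⟧ * δ) (positive⁻¹ (+ 1 / 8))
      (≤-by (gap ¼≤s ⊗ 0≤a ⊕ nonNegative⁻¹ (+ 1 / 4) ⊗ gap ½≤a ⊕ 0≤s′ ⊗ 0≤a) (weight s s′ a))
      (subst (∣ (s′ - s) * ((s + s′) * a) ∣ ≤_) (scale δ)
        (∣∣≤ (≤-by (gap (∣∣-hi h′) ⊕ gap (∣∣-lo h) ⊕ (0≤s′ ⊗ 0≤s′ ⊗ gap (∣∣-hi Δa) ⊕ 1-s′² ⊗ 0≤δ)) (hi s s′ a a′ δ))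
             (≤-by (gap (∣∣-lo h′) ⊕ gap (∣∣-hi h) ⊕ (0≤s′ ⊗ 0≤s′ ⊗ gap (∣∣-lo Δa) ⊕ 1-s′² ⊗ 0≤δ)) (lo s s′ a a′ δ))))
    where
    0≤a : 0ℚ ≤ a
    0≤a = ≤-trans 0≤½ ½≤a
    0≤δ : 0ℚ ≤ δ
    0≤δ = ≤-trans (0≤∣p∣ (a - a′)) Δa
    ¼≤s = inverse-sqrt-≥¼ 0≤s 0≤a a≤4 δ≤¼ h
    1-s′² : 0ℚ ≤ 1ℚ - s′ * s′
    1-s′² = gap (*-mono 0≤s′ s′≤1 0≤s′ s′≤1)
    weight : ∀ s s′ a → (s + s′) * a - + 1 / 8 ≡ (s - + 1 / 4) * a + (+ 1 / 4) * (a - ½) + s′ * a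
    weight s s′ a = solve (s ∷ s′ ∷ a ∷ []) ℚ-ring
    scale : ∀ δ → ⟦ 3 ⟧ * δ ≡ ⟦ 24 ⟧ * δ * (+ 1 / 8)
    scale δ = solve (δ ∷ []) ℚ-ring
    hi : ∀ s s′ a a′ δ → ⟦ 3 ⟧ * δ - (s′ - s) * ((s + s′) * a) ≡ δ - (s′ * s′ * a′ - 1ℚ) + (δ - - (s * s * a - 1ℚ))
      + (s′ * s′ * (δ - (a - a′)) + (1ℚ - s′ * s′) * δ)
    hi s s′ a a′ δ = solve (s ∷ s′ ∷ a ∷ a′ ∷ δ ∷ []) ℚ-ring
    lo : ∀ s s′ a a′ δ → ⟦ 3 ⟧ * δ - - ((s′ - s) * ((s + s′) * a)) ≡ δ - - (s′ * s′ * a′ - 1ℚ) + (δ - (s * s * a - 1ℚ))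
      + (s′ * s′ * (δ - - (a - a′)) + (1ℚ - s′ * s′) * δ)
    lo s s′ a a′ δ = solve (s ∷ s′ ∷ a ∷ a′ ∷ δ ∷ []) ℚ-ring

  -- The inverse direction: (a - a′) s² is the difference of the two errors minus a′(s + s′)(s -
  -- s′), at most 10δ in absolute value, and s² is at least 1/16.
  radicand-close : ∀ {s s′ a a′ δ} → 0ℚ ≤ s → s ≤ 1ℚ → 0ℚ ≤ s′ → s′ ≤ 1ℚ → 0ℚ ≤ a → a ≤ ⟦ 4 ⟧ → 0ℚ ≤ a′
      → a′ ≤ ⟦ 4 ⟧ → δ ≤ + 1 / 4 →
    ∣ s * s * a - 1ℚ ∣ ≤ δ → ∣ s′ * s′ * a′ - 1ℚ ∣ ≤ δ → ∣ s - s′ ∣ ≤ δ → ∣ a - a′ ∣ ≤ ⟦ 160 ⟧ * δ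
  radicand-close {s} {s′} {a} {a′} {δ} 0≤s s≤1 0≤s′ s′≤1 0≤a a≤4 0≤a′ a′≤4 δ≤¼ h h′ Δs =
    ∣∣-cancel (⟦ 160 ⟧ * δ) (positive⁻¹ (+ 1 / 16)) s²≥1/16
      (subst (∣ (a - a′) * (s * s) ∣ ≤_) (scale δ) (∣∣≤
        (≤-by (gap (∣∣-hi h) ⊕ gap (∣∣-lo h′) ⊕ 0≤w ⊗ gap (∣∣-lo Δs) ⊕ gap w≤8 ⊗ 0≤δ) (hi s s′ a a′ δ))
        (≤-by (gap (∣∣-lo h) ⊕ gap (∣∣-hi h′) ⊕ 0≤w ⊗ gap (∣∣-hi Δs) ⊕ gap w≤8 ⊗ 0≤δ) (lo s s′ a a′ δ))))
    where
    0≤δ : 0ℚ ≤ δ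
    0≤δ = ≤-trans (0≤∣p∣ (s - s′)) Δs
    ¼≤s = inverse-sqrt-≥¼ 0≤s 0≤a a≤4 δ≤¼ h
    s²≥1/16 : + 1 / 16 ≤ s * s
    s²≥1/16 = *-mono {a = + 1 / 4} {c = + 1 / 4} (nonNegative⁻¹ (+ 1 / 4)) ¼≤s (nonNegative⁻¹ (+ 1 / 4)) ¼≤s
    0≤w : 0ℚ ≤ a′ * (s + s′)
    0≤w = 0≤a′ ⊗ (0≤s ⊕ 0≤s′)
    w≤8 : a′ * (s + s′) ≤ ⟦ 8 ⟧
    w≤8 = *-mono 0≤a′ a′≤4 (0≤s ⊕ 0≤s′) (+-mono-≤ s≤1 s′≤1)
    scale : ∀ δ → ⟦ 10 ⟧ * δ ≡ ⟦ 160 ⟧ * δ * (+ 1 / 16)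
    scale δ = solve (δ ∷ []) ℚ-ring
    hi : ∀ s s′ a a′ δ → ⟦ 10 ⟧ * δ - (a - a′) * (s * s) ≡ δ - (s * s * a - 1ℚ) + (δ - - (s′ * s′ * a′ - 1ℚ))
      + a′ * (s + s′) * (δ - - (s - s′)) + (⟦ 8 ⟧ - a′ * (s + s′)) * δ
    hi s s′ a a′ δ = solve (s ∷ s′ ∷ a ∷ a′ ∷ δ ∷ []) ℚ-ring
    lo : ∀ s s′ a a′ δ → ⟦ 10 ⟧ * δ - - ((a - a′) * (s * s)) ≡ δ - - (s * s * a - 1ℚ) + (δ - (s′ * s′ * a′ - 1ℚ))
      + a′ * (s + s′) * (δ - (s - s′)) + (⟦ 8 ⟧ - a′ * (s + s′)) * δ
    lo s s′ a a′ δ = solve (s ∷ s′ ∷ a ∷ a′ ∷ δ ∷ []) ℚ-ring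

  last : ∀ {P : ℕ → Set} → (∀ j → Dec (P j)) → P 0 → ∀ N → ∃[ j ] j ℕ.≤ N × P j × (j ≡ N ⊎ ¬ P (suc j))
  last P? p0 zero    = 0 , z≤n , p0 , inj₁ refl
  last P? p0 (suc N) with P? (suc N)
  ... | yes p = suc N , ℕ.≤-refl , p , inj₁ refl
  ... | no ¬p with last P? p0 N
  ...   | j , j≤N , pj , inj₁ refl = j , ℕ.m≤n⇒m≤1+n j≤N , pj , inj₂ ¬p
  ...   | j , j≤N , pj , inj₂ ¬pj  = j , ℕ.m≤n⇒m≤1+n j≤N , pj , inj₂ ¬pj

  -- The largest multiple s ≤ 1 of w = 1/(n+1) with s² a ≤ 1.
  module InverseSqrt (a : ℚ) (n : ℕ) where
    w : ℚ
    w = + 1 / suc n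

    private
      w*1+n : w * ⟦ suc n ⟧ ≡ 1ℚ
      w*1+n = /-* 1 (suc n)

      found = last (λ j → ⟦ j ⟧ * w * (⟦ j ⟧ * w) * a ≤? 1ℚ)
        (subst (_≤ 1ℚ) (sym (zero-eq w a)) 0≤1) (suc n)
        where
        zero-eq : ∀ w a → 0ℚ * w * (0ℚ * w) * a ≡ 0ℚ
        zero-eq w a = solve (w ∷ a ∷ []) ℚ-ring

    inverse-sqrt : ℚ
    inverse-sqrt = ⟦ proj₁ found ⟧ * w

    0≤w : 0ℚ ≤ w
    0≤w = nonNegative⁻¹ w {{normalize-nonNeg 1 (suc n)}}

    w≤1 : w ≤ 1ℚ
    w≤1 = subst₂ _≤_ (*-identityʳ w) w*1+n (*-monoˡ-≤-nonNeg w {{nonNegative 0≤w}} (⟦⟧-mono {1} {suc n} (s≤s z≤n)))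

    inverse-sqrt-nonneg : 0ℚ ≤ inverse-sqrt
    inverse-sqrt-nonneg = 0≤⟦ proj₁ found ⟧ ⊗ 0≤w

    inverse-sqrt-≤1 : inverse-sqrt ≤ 1ℚ
    inverse-sqrt-≤1 = subst (inverse-sqrt ≤_) (trans (*-comm ⟦ suc n ⟧ w) w*1+n)
      (*-monoʳ-≤-nonNeg w {{nonNegative 0≤w}} (⟦⟧-mono (proj₁ (proj₂ found))))

    -- If the search stops at the end, s = 1 and s² a = a ≥ 1 - δ. Otherwise (s + w)² a > 1, and one
    -- grid step changes s² a by at most 8w + 4w.
    inverse-sqrt-error : ∀ {δ} → 0ℚ ≤ δ → 1ℚ - δ ≤ a → a ≤ ⟦ 4 ⟧ → 0ℚ ≤ a
        → ∣ inverse-sqrt * inverse-sqrt * a - 1ℚ ∣ ≤ δ + ⟦ 12 ⟧ * w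
    inverse-sqrt-error {δ} 0≤δ 1-δ≤a a≤4 0≤a = ∣∣≤
      (≤-by (gap (proj₁ (proj₂ (proj₂ found))) ⊕ 0≤δ ⊕ 0≤⟦ 12 ⟧ ⊗ 0≤w) (hi s a δ w))
      ([ at-end , before-end ]′ (proj₂ (proj₂ (proj₂ found))))
      where
      s = inverse-sqrt
      hi : ∀ s a δ w → δ + ⟦ 12 ⟧ * w - (s * s * a - 1ℚ) ≡ 1ℚ - s * s * a + δ + ⟦ 12 ⟧ * w
      hi s a δ w = solve (s ∷ a ∷ δ ∷ w ∷ []) ℚ-ring
      at-end : proj₁ found ≡ suc n → - (s * s * a - 1ℚ) ≤ δ + ⟦ 12 ⟧ * w
      at-end j≡ = subst (λ z → - (z * z * a - 1ℚ) ≤ δ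
          + ⟦ 12 ⟧ * w) (sym (trans (cong (λ j → ⟦ j ⟧ * w) j≡) (trans (*-comm ⟦ suc n ⟧ w) w*1+n)))
        (≤-by (gap 1-δ≤a ⊕ 0≤⟦ 12 ⟧ ⊗ 0≤w) (eq a δ w))
        where
        eq : ∀ a δ w → δ + ⟦ 12 ⟧ * w - - (1ℚ * 1ℚ * a - 1ℚ) ≡ a - (1ℚ - δ) + ⟦ 12 ⟧ * w
        eq a δ w = solve (a ∷ δ ∷ w ∷ []) ℚ-ring
      before-end : ¬ (⟦ suc (proj₁ found) ⟧ * w * (⟦ suc (proj₁ found) ⟧ * w) * a ≤ 1ℚ)
          → - (s * s * a - 1ℚ) ≤ δ + ⟦ 12 ⟧ * w
      before-end ¬le = ≤-by
        (0≤δ ⊕ gap (<⇒≤ (≰⇒> ¬le′)) ⊕ 0≤⟦ 2 ⟧ ⊗ 0≤w ⊗ (inverse-sqrt-nonneg ⊗ gap a≤4 ⊕ 0≤⟦ 4 ⟧ ⊗ gap inverse-sqrt-≤1)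
          ⊕ 0≤w ⊗ (0≤w ⊗ gap a≤4 ⊕ 0≤⟦ 4 ⟧ ⊗ gap w≤1))
        (eq s a δ w)
        where
        next : ∀ j w → (1ℚ + j) * w ≡ j * w + w
        next j w = solve (j ∷ w ∷ []) ℚ-ring
        next≡ : ⟦ suc (proj₁ found) ⟧ * w ≡ s + w
        next≡ = trans (cong (_* w) (⟦⟧-suc (proj₁ found))) (next ⟦ proj₁ found ⟧ w)
        ¬le′ : ¬ ((s + w) * (s + w) * a ≤ 1ℚ)
        ¬le′ = subst (λ z → ¬ (z * z * a ≤ 1ℚ)) next≡ ¬le
        eq : ∀ s a δ w → δ + ⟦ 12 ⟧ * w - - (s * s * a - 1ℚ) ≡ δ + ((s + w) * (s + w) * a - 1ℚ)
          + ⟦ 2 ⟧ * w * (s * (⟦ 4 ⟧ - a) + ⟦ 4 ⟧ * (1ℚ - s)) + w * (w * (⟦ 4 ⟧ - a) + ⟦ 4 ⟧ * (1ℚ - w))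
        eq s a δ w = solve (s ∷ a ∷ δ ∷ w ∷ []) ℚ-ring

  -- Real limits

  ½*<ε : ∀ {ε} → 0ℚ < ε → ½ * ε < ε
  ½*<ε {ε} 0<ε = subst₂ _<_ (+-identityˡ (½ * ε)) (halves ε) (+-monoˡ-< (½ * ε) (0<-* (positive⁻¹ ½) 0<ε))
    where
    halves : ∀ ε → ½ * ε + ½ * ε ≡ ε
    halves ε = solve (ε ∷ []) ℚ-ring

  cauchyℚ⇒isCauchy : ∀ f → Cauchyℚ f → IsCauchy f
  cauchyℚ⇒isCauchy f c ε 0<ε =
    let N , osc = c (½ * ε) (0<-* (positive⁻¹ ½) 0<ε)
    in N , λ i j N≤i N≤j → ≤-<-trans (osc i j N≤i N≤j) (½*<ε 0<ε)

  isCauchy⇒cauchyℚ : ∀ f → IsCauchy f → Cauchyℚ f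
  isCauchy⇒cauchyℚ f c ε 0<ε =
    let N , close = c ε 0<ε
    in N , λ i j N≤i N≤j → <⇒≤ (close i j N≤i N≤j)

  -- Distance of reals measured on approximants. Estimates are proved in this form; `close⇒<` turns
  -- them into the strict order at the price of a larger bound.
  Close : ℝ → ℝ → ℚ → Set
  Close y z δ = Eventually (λ n → ∣ seq y n - seq z n ∣ ≤ δ)

  close⇒< : ∀ {y z δ ε} → δ < ε → Close y z δ → ∣ y -ᴿ z ∣ᴿ <ᴿ fromℚ ε
  close⇒< {y} {z} {δ} {ε} δ<ε = λ (N , close) →
    ε - δ , 0<ε-δ , N , λ n N≤n → subst (∣ seq y n - seq z n ∣ + (ε - δ) ≤_) (eq δ ε) (+-monoˡ-≤ (ε - δ) (close n N≤n))
    where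
    0<ε-δ : 0ℚ < ε - δ
    0<ε-δ = subst (_< ε - δ) (+-inverseʳ δ) (+-monoˡ-< (- δ) δ<ε)
    eq : ∀ δ ε → δ + (ε - δ) ≡ ε
    eq δ ε = solve (δ ∷ ε ∷ []) ℚ-ring

  close-½ : ∀ {y z ε} → 0ℚ < ε → Close y z (½ * ε) → ∣ y -ᴿ z ∣ᴿ <ᴿ fromℚ ε
  close-½ {y} {z} {ε} 0<ε = close⇒< {y} {z} {½ * ε} {ε} (½*<ε 0<ε)

  <⇒close : ∀ {y z ε} → ∣ y -ᴿ z ∣ᴿ <ᴿ fromℚ ε → Close y z ε
  <⇒close {y} {z} {ε} (ε′ , 0<ε′ , ev) = eventually-map
    (λ n h → ≤-trans (≤-by (<⇒≤ 0<ε′) (eq ∣ seq y n - seq z n ∣ ε′)) h) ev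
    where
    eq : ∀ a b → a + b - a ≡ b
    eq a b = solve (a ∷ b ∷ []) ℚ-ring

  pointwise-≃ : ∀ {y z} → (∀ n → seq y n ≡ seq z n) → y ≃ᴿ z
  pointwise-≃ {y} {z} eq =
      (λ ε 0<ε → 0 , λ n _ → subst (seq y n ≤_) (cong (_+ ε) (eq n)) (raise (<⇒≤ 0<ε)))
    , (λ ε 0<ε → 0 , λ n _ → subst (seq z n ≤_) (cong (_+ ε) (sym (eq n))) (raise (<⇒≤ 0<ε)))
    where
    raise : ∀ {a ε} → 0ℚ ≤ ε → a ≤ a + ε
    raise {a} {ε} 0≤ε = subst (_≤ a + ε) (+-identityʳ a) (+-monoʳ-≤ a 0≤ε)

  null-≃ : ∀ {y z} → (∀ ε → 0ℚ < ε → Close y z ε) → y ≃ᴿ z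
  null-≃ {y} {z} close =
      (λ ε 0<ε → eventually-map (λ n h → ≤-by (gap (∣∣-hi h)) (hi (seq y n) (seq z n) ε)) (close ε 0<ε))
    , (λ ε 0<ε → eventually-map (λ n h → ≤-by (gap (∣∣-lo h)) (lo (seq y n) (seq z n) ε)) (close ε 0<ε))
    where
    hi : ∀ y z ε → z + ε - y ≡ ε - (y - z)
    hi y z ε = solve (y ∷ z ∷ ε ∷ []) ℚ-ring
    lo : ∀ y z ε → y + ε - z ≡ ε - - (y - z)
    lo y z ε = solve (y ∷ z ∷ ε ∷ []) ℚ-ring

  seq-÷-constant : ∀ a b i → seq (a ÷ b) i ≡ seq (a ÷ b) 0
  seq-÷-constant a zero    i = refl
  seq-÷-constant a (suc b) i = refl

  -- A Cauchy sequence of rationals converges to the real that it represents. The offset c skips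
  -- initial values: one for the proportions, whose sequences start at one leaf.
  converges : ∀ c (f : ℕ → ℝ) z → (∀ l i → seq (f (c ℕ.+ l)) i ≡ seq z l) → f ⟶ z
  converges c f z eq ε 0<ε =
    let N , osc = isCauchy⇒cauchyℚ (seq z) (cauchy z) (½ * ε) (0<-* (positive⁻¹ ½) 0<ε)
        at : ∀ l → N ℕ.≤ l → ∣ f (c ℕ.+ l) -ᴿ z ∣ᴿ <ᴿ fromℚ ε
        at l N≤l = close-½ {f (c ℕ.+ l)} {z} {ε} 0<ε
            (N , λ i N≤i → subst (λ y → ∣ y - seq z i ∣ ≤ ½ * ε) (sym (eq l i)) (osc l i N≤l N≤i))
    in c ℕ.+ N , λ n c+N≤n → subst (λ n → ∣ f n -ᴿ z ∣ᴿ <ᴿ fromℚ ε) (ℕ.m+[n∸m]≡n (ℕ.m+n≤o⇒m≤o c c+N≤n))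
         (at (n ∸ c) (ℕ.m+n≤o⇒m≤o∸n N (subst (ℕ._≤ n) (ℕ.+-comm c N) c+N≤n)))

  -- The tail sum is empty here. At k = m this makes the top proportion p equal to q.
  η-above : ∀ M k → M ℕ.< k → ∀ n → Proportions.η M k n ≡ 0ℚ
  η-above M k M<k n = *-cancelʳ (Counting.0<⟦G⟧ M n) (begin
    seq (H⟨ k ⟩ m (suc n) ÷ g) 0 * ⟦ g ⟧   ≡⟨ seq-÷ (H⟨ k ⟩ m (suc n)) g 0 (Counting.0<⟦G⟧ M n) ⟩
    ⟦ H⟨ k ⟩ m (suc n) ⟧                   ≡⟨ cong (λ l → ⟦ sum (map (λ i → G⟨ k ℕ.+ i ⟩ m (suc n)) (upTo l)) ⟧)
        (ℕ.m≤n⇒m∸n≡0 M<k) ⟩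
    0ℚ                                     ≡⟨ *-zeroˡ ⟦ g ⟧ ⟨
    0ℚ * ⟦ g ⟧                             ∎)
    where
    open ≡-Reasoning
    m = suc M
    g = G m (suc n)

  η-isCauchy : ∀ M k → IsCauchy (Proportions.η M k)
  η-isCauchy M k with k ℕ.≤? M
  ... | yes k≤M = cauchyℚ⇒isCauchy (Proportions.η M k) (Proportions.η-cauchy M k k≤M)
  ... | no  k≰M = cauchyℚ⇒isCauchy (Proportions.η M k) λ ε 0<ε → 0 , λ i j _ _ →
      subst (_≤ ε) (sym (cong₂ (λ a b → ∣ a - b ∣) (η-above M k (ℕ.≰⇒> k≰M) i) (η-above M k (ℕ.≰⇒> k≰M) j))) (<⇒≤ 0<ε)

  -- The proportions for 1, 2, ... leaves are themselves the approximants. For m = 0 the chain is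
  -- empty and 0 is a default.
  q : ℕ → ℕ → ℝ
  q zero    k = 0ᴿ
  q (suc M) k = mkℝ (Proportions.η M k) (η-isCauchy M k)

  p : ℕ → ℕ → ℝ
  p m j = q m j -ᴿ q m (suc j)

  -- The limit m → ∞

  -- The witness is min(ε, 1)/(4 + C); the bound ¼ is what the estimates on inverse roots require.
  shrink : ∀ C ε → 0ℚ < ε → ∃[ δ ] 0ℚ < δ × δ ≤ + 1 / 4 × ⟦ C ⟧ * δ ≤ ε
  shrink C ε 0<ε = [ (λ ε≤1 → scaled-by 0<ε ε≤1 ≤-refl) , (λ 1≤ε → scaled-by (positive⁻¹ 1ℚ) ≤-refl 1≤ε) ]′
      (≤-total ε 1ℚ)
    where
    w = + 1 / (4 ℕ.+ C)
    w≡ : w * (⟦ 4 ⟧ + ⟦ C ⟧) ≡ 1ℚ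
    w≡ = trans (cong (w *_) (sym (⟦⟧-+ 4 C))) (/-* 1 (4 ℕ.+ C))
    0<w : 0ℚ < w
    0<w = positive⁻¹ w {{normalize-pos 1 (4 ℕ.+ C)}}
    w≤¼ : w ≤ + 1 / 4
    w≤¼ = ≤-by (nonNegative⁻¹ (+ 1 / 4) ⊗ (<⇒≤ 0<w ⊗ 0≤⟦ C ⟧)) (eq w ⟦ C ⟧ w≡)
      where
      lhs : ∀ w C → + 1 / 4 * (w * (⟦ 4 ⟧ + C)) - w ≡ (+ 1 / 4) * (w * C)
      lhs w C = solve (w ∷ C ∷ []) ℚ-ring
      eq : ∀ w C → w * (⟦ 4 ⟧ + C) ≡ 1ℚ → + 1 / 4 - w ≡ (+ 1 / 4) * (w * C)
      eq w C h = trans (cong (λ z → + 1 / 4 * z - w) (sym h)) (lhs w C)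
    scaled-by : ∀ {e} → 0ℚ < e → e ≤ 1ℚ → e ≤ ε → ∃[ δ ] 0ℚ < δ × δ ≤ + 1 / 4 × ⟦ C ⟧ * δ ≤ ε
    scaled-by {e} 0<e e≤1 e≤ε = w * e , 0<-* 0<w 0<e
      , subst (w * e ≤_) (*-identityʳ (+ 1 / 4)) (*-mono (<⇒≤ 0<w) w≤¼ (<⇒≤ 0<e) e≤1)
      , ≤-trans (≤-by (0≤⟦ 4 ⟧ ⊗ (<⇒≤ 0<w ⊗ <⇒≤ 0<e)) (eq w ⟦ C ⟧ e w≡)) e≤ε
      where
      lhs : ∀ w C e → w * (⟦ 4 ⟧ + C) * e - C * (w * e) ≡ ⟦ 4 ⟧ * (w * e)
      lhs w C e = solve (w ∷ C ∷ e ∷ []) ℚ-ring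
      eq : ∀ w C e → w * (⟦ 4 ⟧ + C) ≡ 1ℚ → e - C * (w * e) ≡ ⟦ 4 ⟧ * (w * e)
      eq w C e h = trans (cong (_- C * (w * e)) (sym (trans (cong (_* e) h) (*-identityˡ e)))) (lhs w C e)

  reciprocal-small : ∀ {C δ N y b} → 0ℚ ≤ y → 0ℚ ≤ δ → C < N * δ → N ≤ b → y * b ≡ 1ℚ → C * y ≤ δ
  reciprocal-small {C} {δ} {N} {y} {b} 0≤y 0≤δ C<Nδ N≤b yb≡1 =
    ≤-by (0≤y ⊗ (gap (<⇒≤ C<Nδ) ⊕ gap N≤b ⊗ 0≤δ)) (eq C δ N y b yb≡1)
    where
    lhs : ∀ C δ N y b → y * b * δ - C * y ≡ y * (N * δ - C + (b - N) * δ)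
    lhs C δ N y b = solve (C ∷ δ ∷ N ∷ y ∷ b ∷ []) ℚ-ring
    eq : ∀ C δ N y b → y * b ≡ 1ℚ → δ - C * y ≡ y * (N * δ - C + (b - N) * δ)
    eq C δ N y b h = trans (cong (_- C * y) (sym (trans (cong (_* δ) h) (*-identityˡ δ)))) (lhs C δ N y b)

  x-small : ∀ C δ → 0ℚ < δ → ∃[ N ] ∀ M → N ℕ.≤ M → C * Counting.x M ≤ δ
  x-small C δ 0<δ =
    let N , C<Nδ = archimedean C δ 0<δ
    in N , λ M N≤M → reciprocal-small {C} {δ} {⟦ N ⟧} (<⇒≤ (Counting.0<x M)) (<⇒≤ 0<δ) C<Nδ
         (subst (⟦ N ⟧ ≤_) (⟦⟧-* 4 (suc M)) (⟦⟧-mono (ℕ.≤-trans (ℕ.m≤n⇒m≤1+n N≤M) (ℕ.m≤n*m (suc M) 4))))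
             (Counting.x*4m M)

  rank-ratio : ℕ → ℕ → ℚ
  rank-ratio M k = seq (k ÷ M) 0

  rank-ratio-* : ∀ M′ k → rank-ratio (suc M′) k * ⟦ suc M′ ⟧ ≡ ⟦ k ⟧
  rank-ratio-* M′ k = seq-÷ k (suc M′) 0 0<⟦suc M′ ⟧

  rank-ratio-bounds : ∀ M′ k → k ℕ.≤ suc M′ → 0ℚ ≤ rank-ratio (suc M′) k × rank-ratio (suc M′) k ≤ 1ℚ
  rank-ratio-bounds M′ k k≤M =
      ≤-cancel 0<⟦suc M′ ⟧ (subst₂ _≤_ (sym (*-zeroˡ ⟦ suc M′ ⟧)) (sym (rank-ratio-* M′ k)) 0≤⟦ k ⟧)
    , ≤-cancel 0<⟦suc M′ ⟧ (subst₂ _≤_ (sym (rank-ratio-* M′ k)) (sym (*-identityˡ ⟦ suc M′ ⟧)) (⟦⟧-mono k≤M))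

  -- As x = 1/(4m), the quantity 8 k x is 2k/m, and rank-ratio is k/(m-1).
  rank-ratio-x : ∀ M′ k → let M = suc M′ ; τ = rank-ratio M k ; x = Counting.x M in
    ⟦ 8 ⟧ * (⟦ k ⟧ * x) ≡ ⟦ 2 ⟧ * τ - ⟦ 8 ⟧ * (x * τ)
  rank-ratio-x M′ k = eq (rank-ratio M k) ⟦ M ⟧ ⟦ k ⟧ x (rank-ratio-* M′ k)
    (trans (cong (λ z → x * (⟦ 4 ⟧ * z)) (sym (⟦⟧-suc M))) (Counting.x*4m M))
    where
    M = suc M′
    x = Counting.x M
    ring : ∀ τ M x → ⟦ 8 ⟧ * (τ * M * x) ≡ ⟦ 2 ⟧ * (τ * (x * (⟦ 4 ⟧ * (1ℚ + M)))) - ⟦ 8 ⟧ * (x * τ)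
    ring τ M x = solve (τ ∷ M ∷ x ∷ []) ℚ-ring
    eq : ∀ τ M k x → τ * M ≡ k → x * (⟦ 4 ⟧ * (1ℚ + M)) ≡ 1ℚ → ⟦ 8 ⟧ * (k * x) ≡ ⟦ 2 ⟧ * τ - ⟦ 8 ⟧ * (x * τ)
    eq τ M k x refl h = trans (ring τ M x) (cong (λ z → ⟦ 2 ⟧ * z - ⟦ 8 ⟧ * (x * τ)) (trans (cong (τ *_) h)
        (*-identityʳ τ)))

  rank-radicand : ∀ M′ k → let M = suc M′ in k ℕ.≤ M → ∀ t {δ} → ⟦ 74 ⟧ * Counting.x M ≤ δ
      → ∣ t - rank-ratio M k ∣ ≤ + 1 / 8 * δ →
    ∣ 1ℚ + ⟦ 2 ⟧ * t - (1ℚ + ⟦ 8 ⟧ * (⟦ k ⟧ * Counting.x M)) ∣ ≤ δ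
  rank-radicand M′ k k≤M t {δ} 74x≤δ near =
    subst (λ z → ∣ 1ℚ + ⟦ 2 ⟧ * t - (1ℚ + z) ∣ ≤ δ) (sym (rank-ratio-x M′ k)) (∣∣≤
      (≤-by (0≤⟦ 2 ⟧ ⊗ gap (∣∣-hi near) ⊕ 0≤⟦ 8 ⟧ ⊗ (0≤x ⊗ gap τ≤1) ⊕ nonNegative⁻¹ (+ 3 / 4) ⊗ gap 74x≤δ
          ⊕ nonNegative⁻¹ (+ 95 / 2) ⊗ 0≤x) (hi t τ x δ))
      (≤-by (0≤⟦ 2 ⟧ ⊗ gap (∣∣-lo near) ⊕ 0≤⟦ 8 ⟧ ⊗ (0≤x ⊗ 0≤τ) ⊕ nonNegative⁻¹ (+ 3 / 4) ⊗ gap 74x≤δ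
          ⊕ nonNegative⁻¹ (+ 111 / 2) ⊗ 0≤x) (lo t τ x δ)))
    where
    M = suc M′
    τ = rank-ratio M k
    x = Counting.x M
    0≤x = <⇒≤ (Counting.0<x M)
    0≤τ = proj₁ (rank-ratio-bounds M′ k k≤M)
    τ≤1 = proj₂ (rank-ratio-bounds M′ k k≤M)
    hi : ∀ t τ x δ → δ - (1ℚ + ⟦ 2 ⟧ * t - (1ℚ + (⟦ 2 ⟧ * τ - ⟦ 8 ⟧ * (x * τ))))
      ≡ ⟦ 2 ⟧ * (+ 1 / 8 * δ - (t - τ)) + ⟦ 8 ⟧ * (x * (1ℚ - τ)) + (+ 3 / 4) * (δ - ⟦ 74 ⟧ * x) + (+ 95 / 2) * x
    hi t τ x δ = solve (t ∷ τ ∷ x ∷ δ ∷ []) ℚ-ring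
    lo : ∀ t τ x δ → δ - - (1ℚ + ⟦ 2 ⟧ * t - (1ℚ + (⟦ 2 ⟧ * τ - ⟦ 8 ⟧ * (x * τ))))
      ≡ ⟦ 2 ⟧ * (+ 1 / 8 * δ - - (t - τ)) + ⟦ 8 ⟧ * (x * τ) + (+ 3 / 4) * (δ - ⟦ 74 ⟧ * x) + (+ 111 / 2) * x
    lo t τ x δ = solve (t ∷ τ ∷ x ∷ δ ∷ []) ℚ-ring

  sqrt-error : ∀ s a ε → 0ℚ ≤ ε → 0ℚ ≤ a → a ≤ ⟦ 4 ⟧ → ∣ s * s * a - 1ℚ ∣ ≤ + 1 / 4 * ε → ∣ s * a * (s * a) - a ∣ ≤ ε
  sqrt-error s a ε 0≤ε 0≤a a≤4 acc = subst (λ z → ∣ z ∣ ≤ ε) (eq s a)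
    (≤-trans (∣∣-scale {s * s * a - 1ℚ} {+ 1 / 4 * ε} {a} 0≤a acc)
        (≤-by (nonNegative⁻¹ (+ 1 / 4) ⊗ gap a≤4 ⊗ 0≤ε) (quarter a ε)))
    where
    eq : ∀ s a → a * (s * s * a - 1ℚ) ≡ s * a * (s * a) - a
    eq s a = solve (s ∷ a ∷ []) ℚ-ring
    quarter : ∀ a ε → ε - a * (+ 1 / 4 * ε) ≡ + 1 / 4 * (⟦ 4 ⟧ - a) * ε
    quarter a ε = solve (a ∷ ε ∷ []) ℚ-ring

  module Limit (t : ℝ) (0≤t : 0ᴿ ≤ᴿ t) (t≤1 : t ≤ᴿ 1ᴿ) where

    radicand : ℝ
    radicand = 1ᴿ +ᴿ fromℕ 2 *ᴿ t

    private
      a : ℕ → ℚ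
      a = seq radicand

    a-lower : ∀ δ → 0ℚ < δ → Eventually (λ n → 1ℚ - δ ≤ a n)
    a-lower δ 0<δ = eventually-map (λ n h → ≤-by (0≤⟦ 2 ⟧ ⊗ gap h) (eq (seq t n) δ))
        (0≤t (½ * δ) (0<-* (positive⁻¹ ½) 0<δ))
      where
      eq : ∀ t δ → 1ℚ + ⟦ 2 ⟧ * t - (1ℚ - δ) ≡ ⟦ 2 ⟧ * (t + ½ * δ - 0ℚ)
      eq t δ = solve (t ∷ δ ∷ []) ℚ-ring

    a-upper : Eventually (λ n → a n ≤ ⟦ 4 ⟧)
    a-upper = eventually-map (λ n h → ≤-by (0≤⟦ 2 ⟧ ⊗ gap h) (eq (seq t n))) (t≤1 ½ (positive⁻¹ ½))
      where
      eq : ∀ t → ⟦ 4 ⟧ - (1ℚ + ⟦ 2 ⟧ * t) ≡ ⟦ 2 ⟧ * (1ℚ + ½ - t)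
      eq t = solve (t ∷ []) ℚ-ring

    a-range : Eventually (λ n → ½ ≤ a n × a n ≤ ⟦ 4 ⟧)
    a-range = eventually-× (a-lower ½ (positive⁻¹ ½)) a-upper

    -- The n-th approximant of the radicand is inverted on a grid of width 1/(n+1), so both sources
    -- of error vanish together.
    sₙ : ℕ → ℚ
    sₙ n = InverseSqrt.inverse-sqrt (a n) n

    sₙ-accurate : ∀ ε → 0ℚ < ε → Eventually (λ n → ∣ sₙ n * sₙ n * a n - 1ℚ ∣ ≤ ε)
    sₙ-accurate ε 0<ε = eventually-map make (eventually-× (eventually-× (a-lower (½ * ε) 0<ε/2) a-range)
        (N , λ n N≤n → N≤n))
      where
      0<ε/2 : 0ℚ < ½ * ε
      0<ε/2 = 0<-* (positive⁻¹ ½) 0<ε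
      N = proj₁ (archimedean ⟦ 12 ⟧ (½ * ε) 0<ε/2)
      make : ∀ n → (1ℚ - ½ * ε ≤ a n × ½ ≤ a n × a n ≤ ⟦ 4 ⟧) × N ℕ.≤ n → ∣ sₙ n * sₙ n * a n - 1ℚ ∣ ≤ ε
      make n ((lower , ½≤a , a≤4) , N≤n) = ≤-trans
        (InverseSqrt.inverse-sqrt-error (a n) n (<⇒≤ 0<ε/2) lower a≤4 (≤-trans 0≤½ ½≤a))
        (≤-by (gap w-small) (eq ε (InverseSqrt.w (a n) n)))
        where
        w-small : ⟦ 12 ⟧ * InverseSqrt.w (a n) n ≤ ½ * ε
        w-small = reciprocal-small {⟦ 12 ⟧} {½ * ε} {⟦ N ⟧} (InverseSqrt.0≤w (a n) n) (<⇒≤ 0<ε/2)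
          (proj₂ (archimedean ⟦ 12 ⟧ (½ * ε) 0<ε/2)) (⟦⟧-mono (ℕ.m≤n⇒m≤1+n N≤n)) (/-* 1 (suc n))
        eq : ∀ ε w → ε - (½ * ε + ⟦ 12 ⟧ * w) ≡ ½ * ε - ⟦ 12 ⟧ * w
        eq ε w = solve (ε ∷ w ∷ []) ℚ-ring

    sₙ-cauchy : Cauchyℚ sₙ
    sₙ-cauchy ε 0<ε =
      let δ , 0<δ , δ≤¼ , 24δ≤ε = shrink 24 ε 0<ε
          N₁ , good = eventually-× (sₙ-accurate δ 0<δ) a-range
          N₂ , osc  = isCauchy⇒cauchyℚ a (cauchy radicand) δ 0<δ
      in N₁ ℕ.+ N₂ , λ i j N≤i N≤j →
        let acc-i , _ = good i (ℕ.m+n≤o⇒m≤o N₁ N≤i)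
            acc-j , ½≤a , a≤4 = good j (ℕ.m+n≤o⇒m≤o N₁ N≤j)
        in ≤-trans (inverse-sqrt-close {sₙ j} {sₙ i} {a j} {a i} {δ}
             (InverseSqrt.inverse-sqrt-nonneg (a j) j) (InverseSqrt.inverse-sqrt-nonneg (a i) i)
                 (InverseSqrt.inverse-sqrt-≤1 (a i) i)
             ½≤a a≤4 δ≤¼ acc-j acc-i (osc j i (ℕ.m+n≤o⇒n≤o N₁ N≤j) (ℕ.m+n≤o⇒n≤o N₁ N≤i))) 24δ≤ε

    s : ℝ
    s = mkℝ sₙ (cauchyℚ⇒isCauchy sₙ sₙ-cauchy)

    -- √a = a · (1/√a): the root is derived from its inverse, so a single search serves both.
    r : ℝ
    r = s *ᴿ radicand

    s-reciprocal : s IsReciprocalOf r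
    s-reciprocal = null-≃ {s *ᴿ r} {1ᴿ} λ ε 0<ε → eventually-map
      (λ n h → subst (λ z → ∣ z - 1ℚ ∣ ≤ ε) (*-assoc (sₙ n) (sₙ n) (a n)) h) (sₙ-accurate ε 0<ε)

    r-square : r *ᴿ r ≃ᴿ radicand
    r-square = null-≃ {r *ᴿ r} {radicand} λ ε 0<ε → eventually-map
      (λ n (acc , ½≤a , a≤4) → sqrt-error (sₙ n) (a n) ε (<⇒≤ 0<ε) (≤-trans 0≤½ ½≤a) a≤4 acc)
      (eventually-× (sₙ-accurate (+ 1 / 4 * ε) (0<-* (positive⁻¹ (+ 1 / 4)) 0<ε)) a-range)

    r-nonneg : 0ᴿ ≤ᴿ r
    r-nonneg ε 0<ε = eventually-map (λ n (½≤a , _) → nonneg-product (sₙ n) (a n) ε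
      (InverseSqrt.inverse-sqrt-nonneg (a n) n) (≤-trans 0≤½ ½≤a) (<⇒≤ 0<ε)) a-range
      where
      nonneg-product : ∀ s a ε → 0ℚ ≤ s → 0ℚ ≤ a → 0ℚ ≤ ε → 0ℚ ≤ s * a + ε
      nonneg-product s a ε 0≤s 0≤a 0≤ε = 0≤s ⊗ 0≤a ⊕ 0≤ε

    r-sqrt : r IsSqrtOf radicand
    r-sqrt = r-nonneg , r-square

    -- The floor and an arbitrary sequence with k/(m-1) → t enter the argument only through the
    -- distance of 1 + 2t from 1 + 8kx.
    q-close : ∀ M k δ → k ℕ.≤ M → 0ℚ < δ → δ ≤ + 1 / 4 → ⟦ 74 ⟧ * Counting.x M ≤ δ →
      Eventually (λ n → ∣ a n - (1ℚ + ⟦ 8 ⟧ * (⟦ k ⟧ * Counting.x M)) ∣ ≤ δ) →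
      Close (q (suc M) k) s (⟦ 24 ⟧ * δ)
    q-close M k δ k≤M 0<δ δ≤¼ 74x≤δ Δa = eventually-map
      (λ n (((acc , ½≤a , a≤4) , est) , Δ) → inverse-sqrt-close {sₙ n} {η k n} {a n} {_} {δ}
        (InverseSqrt.inverse-sqrt-nonneg (a n) n) (ratio-nonneg (η-ratio k (ℕ.m≤n⇒m≤1+n k≤M)) n)
            (ratio-≤1 (η-ratio k (ℕ.m≤n⇒m≤1+n k≤M)) n)
        ½≤a a≤4 δ≤¼ acc (≤-trans (Estimates.square est k k≤M) 74x≤δ) Δ)
      (eventually-× (eventually-× (eventually-× (sₙ-accurate δ 0<δ) a-range) estimates) Δa)
      where open Proportions M

    -- The floor relation and 0 ≤ t ≤ 1 at one approximant of t. Non-strict inequalities of reals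
    -- hold there with a slack only; for t ≤ 1 it is x, as Mx is at most ¼.
    record FloorAt (M k n : ℕ) : Set where
      field
        k≤tM+¼ : ⟦ k ⟧ ≤ seq t n * ⟦ M ⟧ + + 1 / 4
        tM≤1+k : seq t n * ⟦ M ⟧ ≤ 1ℚ + ⟦ k ⟧
        -1≤t   : 0ℚ ≤ seq t n + 1ℚ
        t≤1+x  : seq t n ≤ 1ℚ + Counting.x M

    floor-at : ∀ M k → k IsFloorOf (t *ᴿ fromℕ M) → Eventually (FloorAt M k)
    floor-at M k (k≤tM , ε′ , 0<ε′ , tM<1+k) = eventually-map
      (λ n (lo , hi , -1≤t , t≤1+x) → record
        { k≤tM+¼ = lo
        ; tM≤1+k = subst (seq t n * ⟦ M ⟧ ≤_) (⟦⟧-suc k) (≤-trans (≤-by (<⇒≤ 0<ε′) (eq (seq t n * ⟦ M ⟧) ε′)) hi)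
        ; -1≤t   = -1≤t
        ; t≤1+x  = t≤1+x
        })
      (eventually-× (k≤tM (+ 1 / 4) (positive⁻¹ (+ 1 / 4))) (eventually-× tM<1+k
        (eventually-× (0≤t 1ℚ (positive⁻¹ 1ℚ)) (t≤1 (Counting.x M) (Counting.0<x M)))))
      where
      eq : ∀ a b → a + b - a ≡ b
      eq a b = solve (a ∷ b ∷ []) ℚ-ring

    -- From k ≥ M + 1 would follow M + 1 ≤ tM + ¼ ≤ M + xM + ¼ ≤ M + ½.
    floor-≤ : ∀ M k → k IsFloorOf (t *ᴿ fromℕ M) → k ℕ.≤ M
    floor-≤ M k floor = ℕ.≮⇒≥ λ M<k → <-irrefl refl (<-≤-trans (positive⁻¹ ½)
      (≤-by (gap (subst (_≤ ⟦ k ⟧) (⟦⟧-suc M) (⟦⟧-mono M<k)) ⊕ gap k≤tM+¼ ⊕ gap t≤1+x ⊗ 0≤⟦ M ⟧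
          ⊕ gap (kx≤¼ (ℕ.n≤1+n M)))
        (eq (seq t N) ⟦ M ⟧ ⟦ k ⟧ x)))
      where
      open Proportions M using (x; kx≤¼)
      N = proj₁ (floor-at M k floor)
      open FloorAt (proj₂ (floor-at M k floor) N ℕ.≤-refl)
      eq : ∀ t M k x → 0ℚ - ½ ≡ k - (1ℚ + M) + (t * M + + 1 / 4 - k) + (1ℚ + x - t) * M + (+ 1 / 4 - M * x)
      eq t M k x = solve (t ∷ M ∷ k ∷ x ∷ []) ℚ-ring

    -- As 4x(M + 1) = 1, the difference is 8x(tM - k + t), and the floor relation keeps the bracket
    -- bounded.
    floor-radicand : ∀ M k δ n → ⟦ 74 ⟧ * Counting.x M ≤ δ → FloorAt M k n →
      ∣ a n - (1ℚ + ⟦ 8 ⟧ * (⟦ k ⟧ * Counting.x M)) ∣ ≤ δ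
    floor-radicand M k δ n 74x≤δ at = subst (λ z → ∣ z ∣ ≤ δ) (sym (eq (seq t n) ⟦ M ⟧ ⟦ k ⟧ x x*4[1+M]))
      (∣∣≤ (≤-by (gap 74x≤δ ⊕ 0≤⟦ 8 ⟧ ⊗ 0≤x ⊗ (gap tM≤1+k ⊕ gap t≤1+x ⊕ gap x≤¼ ⊕ nonNegative⁻¹ (+ 7 / 1)))
             (hi (seq t n) ⟦ M ⟧ ⟦ k ⟧ x δ))
           (≤-by (gap 74x≤δ ⊕ 0≤⟦ 8 ⟧ ⊗ 0≤x ⊗ (gap k≤tM+¼ ⊕ -1≤t ⊕ nonNegative⁻¹ (+ 8 / 1)))
             (lo (seq t n) ⟦ M ⟧ ⟦ k ⟧ x δ)))
      where
      open Proportions M using (x; 0≤x; x≤¼; x*4m)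
      open FloorAt at
      x*4[1+M] : x * (⟦ 4 ⟧ * (1ℚ + ⟦ M ⟧)) ≡ 1ℚ
      x*4[1+M] = trans (cong (λ z → x * (⟦ 4 ⟧ * z)) (sym (⟦⟧-suc M))) x*4m
      ring : ∀ t M k x → 1ℚ + ⟦ 2 ⟧ * (t * (x * (⟦ 4 ⟧ * (1ℚ + M)))) - (1ℚ + ⟦ 8 ⟧ * (k * x))
          ≡ ⟦ 8 ⟧ * x * (t * M - k + t)
      ring t M k x = solve (t ∷ M ∷ k ∷ x ∷ []) ℚ-ring
      eq : ∀ t M k x → x * (⟦ 4 ⟧ * (1ℚ + M)) ≡ 1ℚ
          → 1ℚ + ⟦ 2 ⟧ * t - (1ℚ + ⟦ 8 ⟧ * (k * x)) ≡ ⟦ 8 ⟧ * x * (t * M - k + t)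
      eq t M k x h = trans (cong (λ z → 1ℚ + ⟦ 2 ⟧ * z - (1ℚ + ⟦ 8 ⟧ * (k * x))) (sym
          (trans (cong (t *_) h) (*-identityʳ t)))) (ring t M k x)
      hi : ∀ t M k x δ → δ - ⟦ 8 ⟧ * x * (t * M - k + t)
        ≡ δ - ⟦ 74 ⟧ * x + ⟦ 8 ⟧ * x * (1ℚ + k - t * M + (1ℚ + x - t) + (+ 1 / 4 - x) + + 7 / 1)
      hi t M k x δ = solve (t ∷ M ∷ k ∷ x ∷ δ ∷ []) ℚ-ring
      lo : ∀ t M k x δ → δ - - (⟦ 8 ⟧ * x * (t * M - k + t))
        ≡ δ - ⟦ 74 ⟧ * x + ⟦ 8 ⟧ * x * (t * M + + 1 / 4 - k + (t + 1ℚ) + + 8 / 1)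
      lo t M k x δ = solve (t ∷ M ∷ k ∷ x ∷ δ ∷ []) ℚ-ring

    q-at-floor : ∀ ε → 0ℚ < ε → Eventually (λ m → ∀ k → k IsFloorOf (t *ᴿ fromℕ (m ∸ 1)) →
      ∣ q m k -ᴿ s ∣ᴿ <ᴿ fromℚ ε)
    q-at-floor ε 0<ε =
      let δ , 0<δ , δ≤¼ , 24δ≤ε/2 = shrink 24 (½ * ε) (0<-* (positive⁻¹ ½) 0<ε)
          N , small = x-small ⟦ 74 ⟧ δ 0<δ
      in suc N , close δ 0<δ δ≤¼ 24δ≤ε/2 N small
      where
      close : ∀ δ → 0ℚ < δ → δ ≤ + 1 / 4 → ⟦ 24 ⟧ * δ ≤ ½ * ε → ∀ N → (∀ M → N ℕ.≤ M → ⟦ 74 ⟧ * Counting.x M ≤ δ) →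
        ∀ m → suc N ℕ.≤ m → ∀ k → k IsFloorOf (t *ᴿ fromℕ (m ∸ 1)) → ∣ q m k -ᴿ s ∣ᴿ <ᴿ fromℚ ε
      close δ 0<δ δ≤¼ 24δ≤ε/2 N small (suc M) (s≤s N≤M) k floor = close-½ {q (suc M) k} {s} {ε} 0<ε
        (eventually-map (λ n h → ≤-trans h 24δ≤ε/2)
          (q-close M k δ (floor-≤ M k floor) 0<δ δ≤¼ (small M N≤M)
            (eventually-map (λ n → floor-radicand M k δ n (small M N≤M)) (floor-at M k floor))))

    q-along : (k : ℕ → ℕ) → (∀ m → 2 ℕ.≤ m → k m ℕ.< m) → (λ m → k m ÷ (m ∸ 1)) ⟶ t → (λ m → q m (k m)) ⟶ s
    q-along k k<m k→t ε 0<ε =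
      let δ , 0<δ , δ≤¼ , 24δ≤ε/2 = shrink 24 (½ * ε) (0<-* (positive⁻¹ ½) 0<ε)
          N₁ , small = x-small ⟦ 74 ⟧ δ 0<δ
          N₂ , near  = k→t (+ 1 / 8 * δ) (0<-* (positive⁻¹ (+ 1 / 8)) 0<δ)
      in 2 ℕ.+ (N₁ ℕ.+ N₂) , close δ 0<δ δ≤¼ 24δ≤ε/2 N₁ small N₂ near
      where
      close : ∀ δ → 0ℚ < δ → δ ≤ + 1 / 4 → ⟦ 24 ⟧ * δ ≤ ½ * ε →
        ∀ N₁ → (∀ M → N₁ ℕ.≤ M → ⟦ 74 ⟧ * Counting.x M ≤ δ) →
        ∀ N₂ → (∀ m → N₂ ℕ.≤ m → ∣ k m ÷ (m ∸ 1) -ᴿ t ∣ᴿ <ᴿ fromℚ (+ 1 / 8 * δ)) →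
        ∀ m → 2 ℕ.+ (N₁ ℕ.+ N₂) ℕ.≤ m → ∣ q m (k m) -ᴿ s ∣ᴿ <ᴿ fromℚ ε
      close δ 0<δ δ≤¼ 24δ≤ε/2 N₁ small N₂ near m@(suc M@(suc M′)) (s≤s (s≤s N≤M′)) = close-½ {q m (k m)} {s} {ε} 0<ε
        (eventually-map (λ n h → ≤-trans h 24δ≤ε/2)
          (q-close M (k m) δ k≤M 0<δ δ≤¼ 74x≤δ
            (eventually-map (λ n h → rank-radicand M′ (k m) k≤M (seq t n) 74x≤δ
                (subst (_≤ + 1 / 8 * δ) (∣∣-sym (rank-ratio M (k m)) (seq t n)) h))
              (<⇒close {k m ÷ M} {t} {+ 1 / 8 * δ} (near m N₂≤m)))))
        where
        k≤M = ℕ.s≤s⁻¹ (k<m m (s≤s (s≤s z≤n)))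
        74x≤δ = small M (ℕ.≤-trans (ℕ.m+n≤o⇒m≤o N₁ N≤M′) (ℕ.n≤1+n M′))
        N₂≤m = ℕ.≤-trans (ℕ.m+n≤o⇒n≤o N₁ N≤M′) (ℕ.m≤n⇒m≤1+n (ℕ.n≤1+n M′))

  -- Single levels and macroscopic cuts

  witness : ∀ {P : ℕ → Set} → Eventually P → ∃[ n ] P n
  witness (N , p) = N , p N ℕ.≤-refl

  -- A level below the top is one step of the recursion. The top level has no such step: its
  -- proportion is q itself, with limit 1/√3.
  p-small : ∀ M j → j ℕ.< M → Eventually (λ n → ∣ seq (p (suc M) j) n ∣ ≤ ⟦ 10 ⟧ * Counting.x M)
  p-small M j j<M = eventually-map (λ n est → bound (η j n) (η (suc j) n) (ρ j n) (⟦ 10 ⟧ * x)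
      (Estimates.decrement est j j<M) (η-split j (ℕ.<⇒≤ j<M) n) (ratio-nonneg (ρ-ratio j) n)) estimates
    where
    open Proportions M
    cancel : ∀ b c → 0ℚ - - (b + c - b) ≡ c
    cancel b c = solve (b ∷ c ∷ []) ℚ-ring
    bound : ∀ a b c d → a - b ≤ d → a ≡ b + c → 0ℚ ≤ c → ∣ a - b ∣ ≤ d
    bound _ b c d le refl 0≤c = ∣∣≤ le (≤-trans (≤-by 0≤c (cancel b c)) (≤-trans 0≤b+c-b le))
      where
      0≤b+c-b : 0ℚ ≤ b + c - b
      0≤b+c-b = ≤-by 0≤c (eq b c)
        where
        eq : ∀ b c → b + c - b - 0ℚ ≡ c
        eq b c = solve (b ∷ c ∷ []) ℚ-ring

  level-vanishes : ∀ j → (λ m → p m j) ⟶ 0ᴿ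
  level-vanishes j ε 0<ε =
    let N , small = x-small ⟦ 10 ⟧ (½ * ε) (0<-* (positive⁻¹ ½) 0<ε)
    -- The summand `suc j` keeps level j strictly below the top.
    in suc (N ℕ.+ suc j) , close N small
    where
    close : ∀ N → (∀ M → N ℕ.≤ M → ⟦ 10 ⟧ * Counting.x M ≤ ½ * ε) → ∀ m → suc (N ℕ.+ suc j) ℕ.≤ m
        → ∣ p m j -ᴿ 0ᴿ ∣ᴿ <ᴿ fromℚ ε
    close N small (suc M) (s≤s le) = close-½ {p (suc M) j} {0ᴿ} {ε} 0<ε (eventually-map
      (λ n h → subst (λ z → ∣ z ∣ ≤ ½ * ε) (sym (+-identityʳ (seq (p (suc M) j) n)))
          (≤-trans h (small M (ℕ.m+n≤o⇒m≤o N le))))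
      (p-small M j (ℕ.m+n≤o⇒n≤o N le)))

  apart-bound : ∀ {L} → L #ᴿ 0ᴿ → ∃[ ε ] 0ℚ < ε × Eventually (λ n → ε ≤ ∣ seq L n ∣)
  apart-bound {L} (inj₁ (ε , 0<ε , ev)) = ε , 0<ε , eventually-map
    (λ n h → ≤-trans (≤-by (gap h) (eq (seq L n) ε)) (-a≤∣a∣ (seq L n))) ev
    where
    eq : ∀ a ε → - a - ε ≡ 0ℚ - (a + ε)
    eq a ε = solve (a ∷ ε ∷ []) ℚ-ring
  apart-bound {L} (inj₂ (ε , 0<ε , ev)) = ε , 0<ε , eventually-map
    (λ n h → ≤-trans (subst (_≤ seq L n) (+-identityˡ ε) h) (a≤∣a∣ (seq L n))) ev

  apart-close : ∀ {L z ε} → ε ≤ ∣ L ∣ → ∣ z - L ∣ ≤ ½ * ε → ½ * ε ≤ ∣ z ∣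
  apart-close {L} {z} {ε} ε≤L close = ≤-by (gap ε≤L ⊕ gap triangle ⊕ gap close) (eq (∣ L ∣) (∣ z ∣) (∣ z - L ∣) ε)
    where
    back : ∀ z L → z - (z - L) ≡ L
    back z L = solve (z ∷ L ∷ []) ℚ-ring
    triangle : ∣ L ∣ ≤ ∣ z ∣ + ∣ z - L ∣
    triangle = subst (λ y → ∣ y ∣ ≤ ∣ z ∣ + ∣ z - L ∣) (back z L) (∣p-q∣≤∣p∣+∣q∣ z (z - L))
    eq : ∀ l z d ε → z - ½ * ε ≡ l - ε + (z + d - l) + (½ * ε - d)
    eq l z d ε = solve (l ∷ z ∷ d ∷ ε ∷ []) ℚ-ring

  -- Below the top the proportion is at most 10x, so a limit apart from 0 forces j m = m - 1 for all
  -- large m. The constant 2 comes from m ≤ 2(m - 1).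
  level-rank : (j : ℕ → ℕ) → (∀ m → 2 ℕ.≤ m → j m ℕ.< m) →
    ∀ L → (λ m → p m (j m)) ⟶ L → L #ᴿ 0ᴿ → j ≍ (λ m → m)
  level-rank j j<m L p→L L#0 =
    let ε , 0<ε , away = apart-bound {L} L#0
        N₁ , near  = p→L (½ * ε) (0<-* (positive⁻¹ ½) 0<ε)
        N₂ , small = x-small ⟦ 10 ⟧ (+ 1 / 4 * ε) (0<-* (positive⁻¹ (+ 1 / 4)) 0<ε)
    in 2 , 2 ℕ.+ (N₁ ℕ.+ N₂) , bounds ε 0<ε away N₁ near N₂ small
    where
    absurd : ∀ {ε z b} → 0ℚ < ε → ½ * ε ≤ z → z ≤ b → b ≤ + 1 / 4 * ε → ⊥
    absurd {ε} {z} {b} 0<ε h₁ h₂ h₃ = <-irrefl refl (<-≤-trans 0<ε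
      (≤-by (0≤⟦ 4 ⟧ ⊗ (gap h₁ ⊕ gap h₂ ⊕ gap h₃)) (eq ε z b)))
      where
      eq : ∀ ε z b → 0ℚ - ε ≡ ⟦ 4 ⟧ * (z - ½ * ε + (b - z) + (+ 1 / 4 * ε - b))
      eq ε z b = solve (ε ∷ z ∷ b ∷ []) ℚ-ring
    bounds : ∀ ε → 0ℚ < ε → Eventually (λ n → ε ≤ ∣ seq L n ∣) →
      ∀ N₁ → (∀ m → N₁ ℕ.≤ m → ∣ p m (j m) -ᴿ L ∣ᴿ <ᴿ fromℚ (½ * ε)) →
      ∀ N₂ → (∀ M → N₂ ℕ.≤ M → ⟦ 10 ⟧ * Counting.x M ≤ + 1 / 4 * ε) →
      ∀ m → 2 ℕ.+ (N₁ ℕ.+ N₂) ℕ.≤ m → j m ℕ.≤ 2 ℕ.* m × m ℕ.≤ 2 ℕ.* j m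
    bounds ε 0<ε away N₁ near N₂ small m@(suc M@(suc M′)) (s≤s (s≤s N≤M′)) =
        ℕ.≤-trans (ℕ.<⇒≤ jm<m) (ℕ.m≤n*m m 2)
      , subst (λ i → m ℕ.≤ 2 ℕ.* i) (sym jm≡M) (s≤s (ℕ.≤-trans (ℕ.m≤n+m M M′) (ℕ.+-monoʳ-≤ M′ (ℕ.m≤m+n M 0))))
      where
      jm<m : j m ℕ.< m
      jm<m = j<m m (s≤s (s≤s z≤n))
      N₁≤m : N₁ ℕ.≤ m
      N₁≤m = ℕ.≤-trans (ℕ.m+n≤o⇒m≤o N₁ N≤M′) (ℕ.m≤n⇒m≤1+n (ℕ.n≤1+n M′))
      N₂≤M : N₂ ℕ.≤ M
      N₂≤M = ℕ.≤-trans (ℕ.m+n≤o⇒n≤o N₁ N≤M′) (ℕ.n≤1+n M′)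
      not-below : ¬ (j m ℕ.< M)
      not-below jm<M =
        let n , tiny , close , far = witness (eventually-× (p-small M (j m) jm<M)
              (eventually-× (<⇒close {p m (j m)} {L} {½ * ε} (near m N₁≤m)) away))
        in absurd 0<ε (apart-close {seq L n} {seq (p m (j m)) n} {ε} far close) tiny (small M N₂≤M)
      jm≡M : j m ≡ M
      jm≡M = ℕ.≤-antisym (ℕ.s≤s⁻¹ jm<m) (ℕ.≮⇒≥ not-below)

  module Cut (k : ℕ → ℕ) (k<m : ∀ m → 2 ℕ.≤ m → k m ℕ.< m) (L : ℝ)
             (q→L : (λ m → 1ᴿ -ᴿ q m (k m)) ⟶ L) (L#0 : L #ᴿ 0ᴿ) where

    private
      ε₀ = proj₁ (apart-bound {L} L#0)
      0<ε₀ = proj₁ (proj₂ (apart-bound {L} L#0))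
      away = proj₂ (proj₂ (apart-bound {L} L#0))
      N₀ = proj₁ (q→L (½ * ε₀) (0<-* (positive⁻¹ ½) 0<ε₀))

      k≤M : ∀ M′ → k (suc (suc M′)) ℕ.≤ suc M′
      k≤M M′ = ℕ.s≤s⁻¹ (k<m (suc (suc M′)) (s≤s (s≤s z≤n)))

      -- The deviation of q from 1 is at least ε₀/2 and at most 10kx; multiply by 2m and use 4mx =
      -- 1.
      rank-large : ∀ M′ → N₀ ℕ.≤ M′ → ε₀ * ⟦ suc (suc M′) ⟧ ≤ ⟦ 5 ⟧ * ⟦ k (suc (suc M′)) ⟧
      rank-large M′ N₀≤M′ = final ε₀ x ⟦ suc M ⟧ ⟦ k (suc M) ⟧ 0≤⟦ suc M ⟧ x*4m half
        where
        M = suc M′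
        open Proportions M using (η; x; x*4m; Estimates; estimates; η-ratio)
        half : ½ * ε₀ ≤ ⟦ k (suc M) ⟧ * (⟦ 10 ⟧ * x)
        half =
          let n , est , close , far = witness (eventually-× estimates (eventually-×
                (<⇒close {1ᴿ -ᴿ q (suc M) (k (suc M))} {L} {½ * ε₀}
                  (proj₂ (q→L (½ * ε₀) (0<-* (positive⁻¹ ½) 0<ε₀)) (suc M)
                      (ℕ.≤-trans N₀≤M′ (ℕ.m≤n⇒m≤1+n (ℕ.n≤1+n M′))))) away))
              η≤1 = ratio-≤1 (η-ratio (k (suc M)) (ℕ.m≤n⇒m≤1+n (k≤M M′))) n
          in ≤-trans (apart-close {seq L n} {1ℚ - η (k (suc M)) n} {ε₀} far close)
               (subst (_≤ ⟦ k (suc M) ⟧ * (⟦ 10 ⟧ * x)) (sym (0≤p⇒∣p∣≡p (gap η≤1)))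
                   (Estimates.near-1 est (k (suc M)) (k≤M M′)))
        ring : ∀ ε x m k → ⟦ 5 ⟧ * (k * (x * (⟦ 4 ⟧ * m))) - ε * m ≡ ⟦ 2 ⟧ * m * (k * (⟦ 10 ⟧ * x) - ½ * ε)
        ring ε x m k = solve (ε ∷ x ∷ m ∷ k ∷ []) ℚ-ring
        final : ∀ ε x m k → 0ℚ ≤ m → x * (⟦ 4 ⟧ * m) ≡ 1ℚ → ½ * ε ≤ k * (⟦ 10 ⟧ * x) → ε * m ≤ ⟦ 5 ⟧ * k
        final ε x m k 0≤m h le = ≤-by (0≤⟦ 2 ⟧ ⊗ 0≤m ⊗ gap le)
          (trans (cong (λ z → ⟦ 5 ⟧ * z - ε * m) (sym (trans (cong (k *_) h) (*-identityʳ k)))) (ring ε x m k))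

    τ : ℕ → ℚ
    τ m = rank-ratio (m ∸ 1) (k m)

    rank-order : k ≍ (λ m → m)
    rank-order =
      let C , 5<Cε = archimedean ⟦ 5 ⟧ ε₀ 0<ε₀
      in suc C , 2 ℕ.+ N₀ , bounds C 5<Cε
      where
      bounds : ∀ C → ⟦ 5 ⟧ < ⟦ C ⟧ * ε₀ → ∀ m → 2 ℕ.+ N₀ ℕ.≤ m → k m ℕ.≤ suc C ℕ.* m × m ℕ.≤ suc C ℕ.* k m
      bounds C 5<Cε m@(suc (suc M′)) (s≤s (s≤s N₀≤M′)) =
          ℕ.≤-trans (ℕ.<⇒≤ (k<m m (s≤s (s≤s z≤n)))) (ℕ.m≤n*m m (suc C))
        , ℕ.≤-trans (⟦⟧-cancel (subst (⟦ m ⟧ ≤_) (sym (⟦⟧-* C (k m)))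
            (m≤Ck ⟦ m ⟧ ⟦ k m ⟧ ⟦ C ⟧ ε₀ 0<ε₀ 0≤⟦ k m ⟧ 5<Cε (rank-large M′ N₀≤M′)))) (ℕ.m≤n+m (C ℕ.* k m) (k m))
        where
        m≤Ck : ∀ m k C ε → 0ℚ < ε → 0ℚ ≤ k → ⟦ 5 ⟧ < C * ε → ε * m ≤ ⟦ 5 ⟧ * k → m ≤ C * k
        m≤Ck m k C ε 0<ε 0≤k 5<Cε le = ≤-cancel 0<ε (≤-by (gap (<⇒≤ 5<Cε) ⊗ 0≤k ⊕ gap le) (eq m k C ε))
          where
          eq : ∀ m k C ε → C * k * ε - m * ε ≡ (C * ε - ⟦ 5 ⟧) * k + (⟦ 5 ⟧ * k - ε * m)
          eq m k C ε = solve (m ∷ k ∷ C ∷ ε ∷ []) ℚ-ring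

    τ-lower : ∀ M′ → N₀ ℕ.≤ M′ → + 1 / 5 * ε₀ ≤ τ (suc (suc M′))
    τ-lower M′ N₀≤M′ = bound ε₀ (τ (suc M)) ⟦ M ⟧ ⟦ suc M ⟧ ⟦ k (suc M) ⟧ 0<⟦suc M′ ⟧ (<⇒≤ 0<ε₀)
      (⟦⟧-mono (ℕ.n≤1+n M)) (rank-ratio-* M′ (k (suc M))) (rank-large M′ N₀≤M′)
      where
      M = suc M′
      bound : ∀ ε τ M m k → 0ℚ < M → 0ℚ ≤ ε → M ≤ m → τ * M ≡ k → ε * m ≤ ⟦ 5 ⟧ * k → + 1 / 5 * ε ≤ τ
      bound ε τ M m _ 0<M 0≤ε M≤m refl le = ≤-cancel 0<M
        (≤-by (nonNegative⁻¹ (+ 1 / 5) ⊗ (gap le ⊕ 0≤ε ⊗ gap M≤m)) (eq ε τ M m))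
        where
        eq : ∀ ε τ M m → τ * M - + 1 / 5 * ε * M ≡ + 1 / 5 * (⟦ 5 ⟧ * (τ * M) - ε * m + ε * (m - M))
        eq ε τ M m = solve (ε ∷ τ ∷ M ∷ m ∷ []) ℚ-ring

    record Good (δ : ℚ) (M n : ℕ) : Set where
      field
        est   : Proportions.Estimates M n
        close : ∣ 1ℚ - Proportions.η M (k (suc M)) n - seq L n ∣ ≤ ½ * δ

    -- Convergence of q along the cuts makes any two late values close. By `radicand-close` the
    -- numbers 1 + 8kx are then close, and these differ from 1 + 2k/(m-1) by at most 8x.
    τ-cauchy : Cauchyℚ τ
    τ-cauchy ε 0<ε =
      let δ , 0<δ , δ≤¼ , 200δ≤ε = shrink 200 ε 0<ε
          N₁ , small = x-small ⟦ 74 ⟧ δ 0<δ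
          N₂ , near  = q→L (½ * δ) (0<-* (positive⁻¹ ½) 0<δ)
      in 2 ℕ.+ (N₁ ℕ.+ N₂) , osc δ 0<δ δ≤¼ 200δ≤ε N₁ small N₂ near
      where
      osc : ∀ δ → 0ℚ < δ → δ ≤ + 1 / 4 → ⟦ 200 ⟧ * δ ≤ ε →
        ∀ N₁ → (∀ M → N₁ ℕ.≤ M → ⟦ 74 ⟧ * Counting.x M ≤ δ) →
        ∀ N₂ → (∀ m → N₂ ℕ.≤ m → ∣ 1ᴿ -ᴿ q m (k m) -ᴿ L ∣ᴿ <ᴿ fromℚ (½ * δ)) →
        Osc τ ε (2 ℕ.+ (N₁ ℕ.+ N₂))
      osc δ 0<δ δ≤¼ 200δ≤ε N₁ small N₂ near m₁@(suc M₁@(suc M₁′)) m₂@(suc M₂@(suc M₂′)) (s≤s (s≤s N≤M₁′))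
          (s≤s (s≤s N≤M₂′)) =
        -- The comparison of two values of m takes place at one n that is late enough for both.
        let n , good₁ , good₂ = witness (eventually-× (good M₁′ N≤M₁′) (good M₂′ N≤M₂′))
        in ≤-trans (rank-close n good₁ good₂) 200δ≤ε
        where
        good : ∀ M′ → N₁ ℕ.+ N₂ ℕ.≤ M′ → Eventually (Good δ (suc M′))
        good M′ N≤M′ = eventually-map (λ n (est , close) → record { est = est ; close = close })
          (eventually-× (Proportions.estimates (suc M′))
            (<⇒close {1ᴿ -ᴿ q m (k m)} {L} {½ * δ} (near m
                (ℕ.≤-trans (ℕ.m+n≤o⇒n≤o N₁ N≤M′) (ℕ.m≤n⇒m≤1+n (ℕ.n≤1+n M′))))))
          where
          m = suc (suc M′)
        rank-close : ∀ n → Good δ M₁ n → Good δ M₂ n → ∣ τ m₁ - τ m₂ ∣ ≤ ⟦ 200 ⟧ * δ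
        rank-close n good₁ good₂ = ranks _ _ (τ m₁) (τ m₂) (Counting.x M₁) (Counting.x M₂) δ
          (rank-ratio-x M₁′ (k m₁)) (rank-ratio-x M₂′ (k m₂)) (<⇒≤ 0<δ)
          (<⇒≤ (Counting.0<x M₁)) (<⇒≤ (Counting.0<x M₂))
          (rank-ratio-bounds M₁′ (k m₁) (k≤M M₁′)) (rank-ratio-bounds M₂′ (k m₂) (k≤M M₂′))
          (small M₁ (N₁≤ M₁′ N≤M₁′)) (small M₂ (N₁≤ M₂′ N≤M₂′))
          (radicand-close {η₁} {η₂} {radicand₁} {radicand₂} {δ}
            (ratio-nonneg (Proportions.η-ratio M₁ (k m₁) (ℕ.m≤n⇒m≤1+n (k≤M M₁′))) n)
            (ratio-≤1 (Proportions.η-ratio M₁ (k m₁) (ℕ.m≤n⇒m≤1+n (k≤M M₁′))) n)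
            (ratio-nonneg (Proportions.η-ratio M₂ (k m₂) (ℕ.m≤n⇒m≤1+n (k≤M M₂′))) n)
            (ratio-≤1 (Proportions.η-ratio M₂ (k m₂) (ℕ.m≤n⇒m≤1+n (k≤M M₂′))) n)
            (proj₁ (range M₁′)) (proj₂ (range M₁′)) (proj₁ (range M₂′)) (proj₂ (range M₂′)) δ≤¼
            (≤-trans (Proportions.Estimates.square (Good.est good₁) (k m₁) (k≤M M₁′)) (small M₁ (N₁≤ M₁′ N≤M₁′)))
            (≤-trans (Proportions.Estimates.square (Good.est good₂) (k m₂) (k≤M M₂′)) (small M₂ (N₁≤ M₂′ N≤M₂′)))
            (subst (∣ η₁ - η₂ ∣ ≤_) (double δ) (subst (λ z → ∣ z ∣ ≤ ½ * δ + ½ * δ) (difference η₁ η₂ (seq L n))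
              (≤-trans (∣p-q∣≤∣p∣+∣q∣ (1ℚ - η₂ - seq L n) (1ℚ - η₁ - seq L n))
                  (+-mono-≤ (Good.close good₂) (Good.close good₁))))))
          where
          η₁ = Proportions.η M₁ (k m₁) n
          η₂ = Proportions.η M₂ (k m₂) n
          radicand₁ = 1ℚ + ⟦ 8 ⟧ * (⟦ k m₁ ⟧ * Counting.x M₁)
          radicand₂ = 1ℚ + ⟦ 8 ⟧ * (⟦ k m₂ ⟧ * Counting.x M₂)
          N₁≤ : ∀ M′ → N₁ ℕ.+ N₂ ℕ.≤ M′ → N₁ ℕ.≤ suc M′
          N₁≤ M′ N≤M′ = ℕ.≤-trans (ℕ.m+n≤o⇒m≤o N₁ N≤M′) (ℕ.n≤1+n M′)
          double : ∀ δ → ½ * δ + ½ * δ ≡ δ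
          double δ = solve (δ ∷ []) ℚ-ring
          difference : ∀ a b l → 1ℚ - b - l - (1ℚ - a - l) ≡ a - b
          difference a b l = solve (a ∷ b ∷ l ∷ []) ℚ-ring
          range : ∀ M′ → let κ = 1ℚ + ⟦ 8 ⟧ * (⟦ k (suc (suc M′)) ⟧ * Counting.x (suc M′)) in 0ℚ ≤ κ × κ ≤ ⟦ 4 ⟧
          range M′ = bound (⟦ k (suc (suc M′)) ⟧ * Counting.x (suc M′))
              (0≤⟦ k (suc (suc M′)) ⟧ ⊗ <⇒≤ (Counting.0<x (suc M′)))
              (Proportions.kx≤¼ (suc M′) (ℕ.m≤n⇒m≤1+n (k≤M M′)))
            where
            eq : ∀ y → ⟦ 4 ⟧ - (1ℚ + ⟦ 8 ⟧ * y) ≡ ⟦ 8 ⟧ * (+ 1 / 4 - y) + 1ℚ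
            eq y = solve (y ∷ []) ℚ-ring
            bound : ∀ y → 0ℚ ≤ y → y ≤ + 1 / 4 → 0ℚ ≤ 1ℚ + ⟦ 8 ⟧ * y × 1ℚ + ⟦ 8 ⟧ * y ≤ ⟦ 4 ⟧
            bound y 0≤y y≤¼ = 0≤1 ⊕ 0≤⟦ 8 ⟧ ⊗ 0≤y , ≤-by (0≤⟦ 8 ⟧ ⊗ gap y≤¼ ⊕ 0≤1) (eq y)
          ranks : ∀ y y′ τ τ′ x x′ δ → y ≡ ⟦ 2 ⟧ * τ - ⟦ 8 ⟧ * (x * τ) → y′ ≡ ⟦ 2 ⟧ * τ′ - ⟦ 8 ⟧ * (x′ * τ′) → 0ℚ ≤ δ →
            0ℚ ≤ x → 0ℚ ≤ x′ → 0ℚ ≤ τ × τ ≤ 1ℚ → 0ℚ ≤ τ′ × τ′ ≤ 1ℚ → ⟦ 74 ⟧ * x ≤ δ → ⟦ 74 ⟧ * x′ ≤ δ →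
            ∣ 1ℚ + y - (1ℚ + y′) ∣ ≤ ⟦ 160 ⟧ * δ → ∣ τ - τ′ ∣ ≤ ⟦ 200 ⟧ * δ
          ranks _ _ τ τ′ x x′ δ refl refl 0≤δ 0≤x 0≤x′ (0≤τ , τ≤1) (0≤τ′ , τ′≤1) 74x≤δ 74x′≤δ le = ∣∣≤
            (≤-by (0≤½ ⊗ gap (∣∣-hi le) ⊕ 0≤⟦ 4 ⟧ ⊗ (0≤x ⊗ gap τ≤1) ⊕ 0≤⟦ 4 ⟧ ⊗ (0≤x′ ⊗ 0≤τ′)
                   ⊕ 0≤⟦ 4 ⟧ ⊗ gap 74x≤δ ⊕ 0≤⟦ 292 ⟧ ⊗ 0≤x ⊕ 0≤⟦ 116 ⟧ ⊗ 0≤δ) (hi τ τ′ x x′ δ))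
            (≤-by (0≤½ ⊗ gap (∣∣-lo le) ⊕ 0≤⟦ 4 ⟧ ⊗ (0≤x′ ⊗ gap τ′≤1) ⊕ 0≤⟦ 4 ⟧ ⊗ (0≤x ⊗ 0≤τ)
                   ⊕ 0≤⟦ 4 ⟧ ⊗ gap 74x′≤δ ⊕ 0≤⟦ 292 ⟧ ⊗ 0≤x′ ⊕ 0≤⟦ 116 ⟧ ⊗ 0≤δ) (lo τ τ′ x x′ δ))
            where
            hi : ∀ τ τ′ x x′ δ → ⟦ 200 ⟧ * δ - (τ - τ′)
              ≡ ½ * (⟦ 160 ⟧ * δ - (1ℚ + (⟦ 2 ⟧ * τ - ⟦ 8 ⟧ * (x * τ)) - (1ℚ + (⟦ 2 ⟧ * τ′ - ⟦ 8 ⟧ * (x′ * τ′)))))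
              + ⟦ 4 ⟧ * (x * (1ℚ - τ)) + ⟦ 4 ⟧ * (x′ * τ′) + ⟦ 4 ⟧ * (δ - ⟦ 74 ⟧ * x) + ⟦ 292 ⟧ * x + ⟦ 116 ⟧ * δ
            hi τ τ′ x x′ δ = solve (τ ∷ τ′ ∷ x ∷ x′ ∷ δ ∷ []) ℚ-ring
            lo : ∀ τ τ′ x x′ δ → ⟦ 200 ⟧ * δ - - (τ - τ′)
              ≡ ½ * (⟦ 160 ⟧ * δ - - (1ℚ + (⟦ 2 ⟧ * τ - ⟦ 8 ⟧ * (x * τ)) - (1ℚ + (⟦ 2 ⟧ * τ′ - ⟦ 8 ⟧ * (x′ * τ′)))))
              + ⟦ 4 ⟧ * (x′ * (1ℚ - τ′)) + ⟦ 4 ⟧ * (x * τ) + ⟦ 4 ⟧ * (δ - ⟦ 74 ⟧ * x′) + ⟦ 292 ⟧ * x′ + ⟦ 116 ⟧ * δ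
            lo τ τ′ x x′ δ = solve (τ ∷ τ′ ∷ x ∷ x′ ∷ δ ∷ []) ℚ-ring

    t : ℝ
    t = mkℝ τ (cauchyℚ⇒isCauchy τ τ-cauchy)

    0<t : 0ᴿ <ᴿ t
    0<t = + 1 / 5 * ε₀ , 0<-* (positive⁻¹ (+ 1 / 5)) 0<ε₀ , 2 ℕ.+ N₀ , large
      where
      large : ∀ m → 2 ℕ.+ N₀ ℕ.≤ m → 0ℚ + + 1 / 5 * ε₀ ≤ τ m
      large (suc (suc M′)) (s≤s (s≤s N₀≤M′)) = subst (_≤ τ (suc (suc M′)))
          (sym (+-identityˡ (+ 1 / 5 * ε₀))) (τ-lower M′ N₀≤M′)

    t≤1 : t ≤ᴿ 1ᴿ
    t≤1 ε 0<ε = 2 , bounded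
      where
      eq : ∀ τ ε → 1ℚ + ε - τ ≡ 1ℚ - τ + ε
      eq τ ε = solve (τ ∷ ε ∷ []) ℚ-ring
      bounded : ∀ m → 2 ℕ.≤ m → τ m ≤ 1ℚ + ε
      bounded (suc zero) (s≤s ())
      bounded (suc (suc M′)) _ = ≤-by (gap (proj₂ (rank-ratio-bounds M′ (k (suc (suc M′))) (k≤M M′))) ⊕ <⇒≤ 0<ε)
          (eq (τ (suc (suc M′))) ε)

    k→t : (λ m → k m ÷ (m ∸ 1)) ⟶ t
    k→t = converges 0 (λ m → k m ÷ (m ∸ 1)) t (λ m i → seq-÷-constant (k m) (m ∸ 1) i)

  -- Identification of the limits over n

  H-converges : ∀ m k → k ℕ.< m → (λ n → H⟨ k ⟩ m n ÷ G m n) ⟶ q m k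
  H-converges (suc M) k k<m = converges 1 (λ n → H⟨ k ⟩ (suc M) n ÷ G (suc M) n) (q (suc M) k)
    λ l i → seq-÷-constant (H⟨ k ⟩ (suc M) (suc l)) (G (suc M) (suc l)) i

  #outputs-converges : ∀ m k → k ℕ.< m → (λ n → #outputs≥ k m n ÷ #outputs m n) ⟶ q m k
  #outputs-converges m@(suc M) k k<m = converges 1 (λ n → #outputs≥ k m n ÷ #outputs m n) (q m k)
    λ l i → trans (cong₂ (λ a b → seq (a ÷ b) i) {#outputs≥ k m (suc l)} {H⟨ k ⟩ m (suc l)} {#outputs m (suc l)}
        {G m (suc l)}
        (⟦⟧-injective {#outputs≥ k m (suc l)} {H⟨ k ⟩ m (suc l)}
            (trans (⟦#outputs≥⟧ k m l) (sym (⟦H⟨⟩⟧ k m l (ℕ.<⇒≤ k<m)))))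
        (⟦⟧-injective {#outputs m (suc l)} {G m (suc l)} (trans (⟦#outputs⟧ m l) (sym (⟦H⟨⟩⟧ 0 m l z≤n)))))
      (seq-÷-constant (H⟨ k ⟩ m (suc l)) (G m (suc l)) i)

  G-converges : ∀ m j → j ℕ.< m → (λ n → G⟨ j ⟩ m n ÷ G m n) ⟶ p m j
  G-converges m@(suc M) j j<m = converges 1 (λ n → G⟨ j ⟩ m n ÷ G m n) (p m j)
    λ l i → trans (seq-÷-constant (G⟨ j ⟩ m (suc l)) (G m (suc l)) i)
      (difference (η j l) (η (suc j) l) (ρ j l) (η-split j (ℕ.s≤s⁻¹ j<m) l))
    where
    open Proportions M using (η; ρ; η-split)
    cancel : ∀ b c → c ≡ b + c - b
    cancel b c = solve (b ∷ c ∷ []) ℚ-ring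
    difference : ∀ a b c → a ≡ b + c → c ≡ a - b
    difference _ b c refl = cancel b c

  top-proportion : ∀ m → 2 ℕ.≤ m → q m (m ∸ 1) ≃ᴿ p m (m ∸ 1)
  top-proportion m@(suc M) _ = pointwise-≃ {q m M} {p m M} λ n →
    sym (trans (cong (λ z → Proportions.η M M n - z) (η-above M m ℕ.≤-refl n)) (+-identityʳ (Proportions.η M M n)))

open Asymptotics
open import Data.Nat using (ℕ; suc; _+_; _∸_; _≤_; _<_)
open import Data.Product using (Σ-syntax; ∃-syntax; _×_; _,_)
open import Data.Rational using (ℚ; 0ℚ) renaming (_<_ to _<ℚ_)
open import Relation.Binary.PropositionalEquality using (refl)

theorem5 : Σ[ q ∈ (ℕ → ℕ → ℝ) ] Σ[ p ∈ (ℕ → ℕ → ℝ) ]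
    (∀ m k → 2 ≤ m → k < m →
    ((λ n → H⟨ k ⟩ m n ÷ G m n) ⟶ q m k)
    × ((λ n → #outputs≥ k m n ÷ #outputs m n) ⟶ q m k))
    × (∀ m j → 2 ≤ m → j < m → (λ n → G⟨ j ⟩ m n ÷ G m n) ⟶ p m j)
    × (∀ m → 2 ≤ m → q m (m ∸ 1) ≃ᴿ p m (m ∸ 1))
    × (∀ m k → 2 ≤ m → k + 2 ≤ m → p m k ≃ᴿ q m k -ᴿ q m (suc k))
    × (∀ t → 0ᴿ ≤ᴿ t → t ≤ᴿ 1ᴿ →
    ∃[ r ] ∃[ s ] r IsSqrtOf (1ᴿ +ᴿ fromℕ 2 *ᴿ t) × s IsReciprocalOf r
    × (∀ ε → 0ℚ <ℚ ε → Eventually (λ m → ∀ k → k IsFloorOf (t *ᴿ fromℕ (m ∸ 1)) →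
    ∣ q m k -ᴿ s ∣ᴿ <ᴿ fromℚ ε))
    × ((k : ℕ → ℕ) → (∀ m → 2 ≤ m → k m < m) → (λ m → k m ÷ (m ∸ 1)) ⟶ t →
    (λ m → q m (k m)) ⟶ s))
    × (∀ j → (λ m → p m j) ⟶ 0ᴿ)
    × ((j : ℕ → ℕ) → (∀ m → 2 ≤ m → j m < m) →
    ∀ L → (λ m → p m (j m)) ⟶ L → L #ᴿ 0ᴿ → j ≍ (λ m → m))
    × ((k : ℕ → ℕ) → (∀ m → 2 ≤ m → k m < m) →
    ∀ L → (λ m → 1ᴿ -ᴿ q m (k m)) ⟶ L → L #ᴿ 0ᴿ →
    k ≍ (λ m → m)
    × ∃[ t ] (0ᴿ <ᴿ t) × (t ≤ᴿ 1ᴿ) × ((λ m → k m ÷ (m ∸ 1)) ⟶ t))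
theorem5 = q , p
  , (λ m k 2≤m k<m → H-converges m k k<m , #outputs-converges m k k<m)
  , (λ m j 2≤m → G-converges m j)
  , top-proportion
  , (λ m k _ _ → pointwise-≃ {p m k} {p m k} λ _ → refl)
  , (λ t 0≤t t≤1 → let open Limit t 0≤t t≤1 in
       r , s , r-sqrt , s-reciprocal , q-at-floor , q-along)
  , level-vanishes
  , level-rank
  , (λ k k<m L q→L L#0 → let open Cut k k<m L q→L L#0 in rank-order , t , 0<t , t≤1 , k→t)
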